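{- For every constant $\ell$ there exist constants $C,c>0$ and $n_0$ such that for all $n\geq n_0$ and all $k$ the following holds. Let $\mathbf{c}=(c_1,\dots,c_k)$ be any initial $k$-color configuration on $n$ nodes (with $c_1\geq c_2\geq\dots\geq c_k$) such that $c_1\geq n/\log^{\ell} n$ and $s(\mathbf{c})=c_1-c_2\geq 22\sqrt{n\log^{\ell+1}n}$. Then, with probability at least $1-n^{ -c}$, the 3-majority protocol started from $\mathbf{c}$ reaches the configuration in which all $n$ nodes have the plurality color $1$ within at most $C\log^{\ell+1}n$ rounds.
   Context: A $k$-color configuration on $n$ nodes is a $k$-tuple $\mathbf{c}=(c_1,\dots,c_k)$ of non-negative integers with $\sum_{j} c_j = n$, where $c_j$ is the number of nodes with color $j\in[k]=\{1,\dots,k\}$. Colors are indexed so that in the initial configuration $c_1\geq c_2\geq\dots\geq c_k$; color $1$ is the plurality color and $s(\mathbf{c})=c_1-c_2$ is the bias. 3-majority protocol (on the clique, synchronous rounds): at every round, every node, independently of the others, picks three nodes uniformly at random (including itself and with repetitions) and recolors itself according to the majority of the colors it sees; if it sees three different colors, it chooses the first one. All nodes update simultaneously, using the colors at the beginning of the round. $\log$ is the natural logarithm, and $\log^{a} n$ means $(\log n)^a$. -}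

module Defs where

open import Data.Bool.Base using (if_then_else_)
open import Data.Empty using (⊥-elim)
open import Data.Fin.Base as Fin using (Fin)
import Data.Fin.Properties as Fin
open import Data.Integer.Base as ℤ using (+_; -[1+_])
import Data.Integer.Properties as ℤ
open import Data.List.Base as List using (List)
open import Data.Nat.Base as ℕ using (ℕ; zero; suc; _!; NonTrivial)
import Data.Nat.Coprimality as Coprime
import Data.Nat.Properties as ℕ
open import Data.Product.Base using (∃; _×_; _,_; proj₁; proj₂)
open import Data.Rational.Base
open import Data.Rational.Properties
import Data.Rational.Solver as ℚ-Solver
import Data.Rational.Unnormalised.Base as ℚᵘ
import Data.Rational.Unnormalised.Properties as ℚᵘ
open import Data.Sum.Base using (_⊎_; inj₁; inj₂)
open import Data.Vec.Base as Vec using (Vec; []; _∷_)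
open import Data.Vec.Relation.Unary.All as All using (All)
open import Data.Vec.Relation.Unary.Linked using (Linked)
open import Data.Vec.Relation.Unary.Any as Any using (Any)
open import Relation.Binary.PropositionalEquality
  using (_≡_; refl; sym; trans; cong; cong₂; subst; subst₂)
open import Relation.Nullary using (Dec; yes; no; does)
open import Relation.Unary using (Decidable)

open ℚ-Solver.+-*-Solver using (solve; _:=_; _:+_; _:*_; _:-_; :-_; con)

fromℕℚ : ℕ → ℚ
fromℕℚ n = mkℚ (+ n) 0 (Coprime.sym (Coprime.1-coprimeTo n))

≤-by : ∀ {p q} d → 0ℚ ≤ d → p + d ≡ q → p ≤ q
≤-by {p} d 0≤d eq =
  subst (p ≤_) eq (subst (_≤ p + d) (+-identityʳ p) (+-monoʳ-≤ p 0≤d))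

<-by : ∀ {p q} d → 0ℚ < d → p + d ≡ q → p < q
<-by {p} d 0<d eq =
  subst (p <_) eq (subst (_< p + d) (+-identityʳ p) (+-monoʳ-< p 0<d))

0≤+ : ∀ {p q} → 0ℚ ≤ p → 0ℚ ≤ q → 0ℚ ≤ p + q
0≤+ 0≤p 0≤q = +-mono-≤ 0≤p 0≤q

0<+ : ∀ {p q} → 0ℚ < p → 0ℚ < q → 0ℚ < p + q
0<+ 0<p 0<q = +-mono-< 0<p 0<q

*-monoˡ : ∀ {p q} r → 0ℚ ≤ r → p ≤ q → r * p ≤ r * q
*-monoˡ r 0≤r = *-monoˡ-≤-nonNeg r {{nonNegative 0≤r}}

*-monoʳ : ∀ {p q} r → 0ℚ ≤ r → p ≤ q → p * r ≤ q * r
*-monoʳ r 0≤r = *-monoʳ-≤-nonNeg r {{nonNegative 0≤r}}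

*-mono : ∀ {p q r s} → 0ℚ ≤ p → 0ℚ ≤ s → p ≤ q → r ≤ s → p * r ≤ q * s
*-mono {p} {q} {r} {s} 0≤p 0≤s p≤q r≤s =
  ≤-trans (*-monoˡ p 0≤p r≤s) (*-monoʳ s 0≤s p≤q)

0≤* : ∀ {p q} → 0ℚ ≤ p → 0ℚ ≤ q → 0ℚ ≤ p * q
0≤* {p} {q} 0≤p 0≤q = subst (_≤ p * q) (*-zeroʳ p) (*-monoˡ p 0≤p 0≤q)

0<* : ∀ {p q} → 0ℚ < p → 0ℚ < q → 0ℚ < p * q
0<* {p} {q} 0<p 0<q =
  subst (_< p * q) (*-zeroʳ p) (*-monoʳ-<-pos p {{positive 0<p}} 0<q)

*-cancelˡ-≤ : ∀ {p q} r → 0ℚ < r → r * p ≤ r * q → p ≤ q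
*-cancelˡ-≤ r 0<r = *-cancelˡ-≤-pos r {{positive 0<r}}

0≤1 : 0ℚ ≤ 1ℚ
0≤1 = *≤* (ℤ.+≤+ ℕ.z≤n)

0<1 : 0ℚ < 1ℚ
0<1 = *<* (ℤ.+<+ ℕ.z<s)

0<½ : 0ℚ < ½
0<½ = *<* (ℤ.+<+ ℕ.z<s)

½+½ : ∀ p → ½ * p + ½ * p ≡ p
½+½ p = trans (sym (*-distribʳ-+ p ½ ½)) (*-identityˡ p)

0≤q-p : ∀ {p q} → p ≤ q → 0ℚ ≤ q - p
0≤q-p {p} {q} p≤q =
  subst (_≤ q - p) (+-inverseʳ p) (+-monoˡ-≤ (- p) p≤q)

∣∣≤ : ∀ {p e} → - e ≤ p → p ≤ e → ∣ p ∣ ≤ e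
∣∣≤ {p} {e} -e≤p p≤e with ∣p∣≡p∨∣p∣≡-p p
... | inj₁ eq = subst (_≤ e) (sym eq) p≤e
... | inj₂ eq = subst₂ _≤_ (sym eq)
  (solve 1 (λ x → :- (:- x) := x) refl e) (neg-antimono-≤ -e≤p)

p≤∣p∣ : ∀ p → p ≤ ∣ p ∣
p≤∣p∣ p with ≤-total 0ℚ p
... | inj₁ 0≤p = ≤-reflexive (sym (0≤p⇒∣p∣≡p 0≤p))
... | inj₂ p≤0 = ≤-trans p≤0 (0≤∣p∣ p)

∣-∣-comm : ∀ p q → ∣ p - q ∣ ≡ ∣ q - p ∣
∣-∣-comm p q = trans (sym (∣-p∣≡∣p∣ (p - q)))
  (cong ∣_∣ (solve 2 (λ x y → :- (x :- y) := y :- x) refl p q))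

∣∣≤⇒≤+ : ∀ {p q e} → ∣ p - q ∣ ≤ e → p ≤ q + e
∣∣≤⇒≤+ {p} {q} {e} h = subst (_≤ q + e)
  (solve 2 (λ x y → y :+ (x :- y) := x) refl p q)
  (+-monoʳ-≤ q (≤-trans (p≤∣p∣ (p - q)) h))

≤+⇒∣∣≤ : ∀ {p q e} → p ≤ q + e → q ≤ p + e → ∣ p - q ∣ ≤ e
≤+⇒∣∣≤ {p} {q} {e} h₁ h₂ = ∣∣≤
  (subst₂ _≤_ (solve 3 (λ x y z → y :- (y :+ z) := :- z) refl p q e) refl
    (subst (q - (q + e) ≤_) refl
      (≤-by ((p + e) - q) (0≤q-p h₂)
        (solve 3 (λ x y z → (y :- (y :+ z)) :+ ((x :+ z) :- y) := x :- y)
          refl p q e))))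
  (≤-by ((q + e) - p) (0≤q-p h₁)
    (solve 3 (λ x y z → (x :- y) :+ ((y :+ z) :- x) := z) refl p q e))

∣∣-triangle : ∀ p q r → ∣ p - r ∣ ≤ ∣ p - q ∣ + ∣ q - r ∣
∣∣-triangle p q r = subst (_≤ ∣ p - q ∣ + ∣ q - r ∣)
  (cong ∣_∣ (solve 3 (λ x y z → (x :- y) :+ (y :- z) := x :- z) refl p q r))
  (∣p+q∣≤∣p∣+∣q∣ (p - q) (q - r))

square-cancel : ∀ {p q} → 0ℚ ≤ p → 0ℚ ≤ q → p * p ≤ q * q → p ≤ q
square-cancel {p} {q} 0≤p 0≤q p²≤q² = ≮⇒≥ λ q<p →
  let 0<p = ≤-<-trans 0≤q q<p in
  <-irrefl refl (≤-<-trans p²≤q²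
    (≤-<-trans (*-monoˡ q 0≤q (<⇒≤ q<p))
      (*-monoˡ-<-pos p {{positive 0<p}} q<p)))

-- The value at 0 is immaterial: it can only affect finitely many terms of the sequences below.
recip : ℚ → ℚ
recip p with p ≟ 0ℚ
... | yes _   = 0ℚ
... | no  p≢0 = (1/ p) {{≢-nonZero p≢0}}

*-recip : ∀ {p} → 0ℚ < p → p * recip p ≡ 1ℚ
*-recip {p} 0<p with p ≟ 0ℚ
... | yes p≡0 = ⊥-elim (<-irrefl (sym p≡0) 0<p)
... | no  p≢0 = *-inverseʳ p {{≢-nonZero p≢0}}

0<recip : ∀ {p} → 0ℚ < p → 0ℚ < recip p
0<recip {p} 0<p = ≰⇒> λ r≤0 → <-irrefl refl (<-≤-trans 0<1
  (subst₂ _≤_ (*-recip 0<p) (*-zeroʳ p) (*-monoˡ p (<⇒≤ 0<p) r≤0)))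

recip-≤ : ∀ {p r} → 0ℚ < r → r ≤ p → recip p ≤ recip r
recip-≤ {p} {r} 0<r r≤p = *-cancelˡ-≤ (p * r) (0<* 0<p 0<r)
  (subst₂ _≤_ (sym lhs) (sym rhs) r≤p)
  where
  0<p = <-≤-trans 0<r r≤p
  lhs : (p * r) * recip p ≡ r
  lhs = trans (solve 3 (λ x y z → (x :* y) :* z := y :* (x :* z)) refl p r (recip p))
    (trans (cong (r *_) (*-recip 0<p)) (*-identityʳ r))
  rhs : (p * r) * recip r ≡ p
  rhs = trans (*-assoc p r (recip r))
    (trans (cong (p *_) (*-recip 0<r)) (*-identityʳ p))

fromℕℚ-mono : ∀ {m n} → m ℕ.≤ n → fromℕℚ m ≤ fromℕℚ n
fromℕℚ-mono m≤n = *≤* (ℤ.*-monoʳ-≤-nonNeg (+ 1) (ℤ.+≤+ m≤n))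

0≤fromℕℚ : ∀ n → 0ℚ ≤ fromℕℚ n
0≤fromℕℚ n = fromℕℚ-mono {0} {n} ℕ.z≤n

fromℕℚ-suc : ∀ n → fromℕℚ (suc n) ≡ 1ℚ + fromℕℚ n
fromℕℚ-suc n = toℚᵘ-injective (ℚᵘ.≃-sym (ℚᵘ.≃-trans (toℚᵘ-homo-+ 1ℚ (fromℕℚ n))
  (ℚᵘ.*≡* (cong (λ i → (+ 1 ℤ.+ i) ℤ.* + 1) (ℤ.*-identityʳ (+ n))))))

0<fromℕℚ-suc : ∀ n → 0ℚ < fromℕℚ (suc n)
0<fromℕℚ-suc n = <-≤-trans 0<1 (fromℕℚ-mono {1} {suc n} (ℕ.s≤s ℕ.z≤n))

fromℕℚ-* : ∀ m n → fromℕℚ (m ℕ.* n) ≡ fromℕℚ m * fromℕℚ n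
fromℕℚ-* m n = toℚᵘ-injective (ℚᵘ.≃-sym (ℚᵘ.≃-trans (toℚᵘ-homo-* (fromℕℚ m) (fromℕℚ n))
  (ℚᵘ.*≡* (cong (ℤ._* + 1) (sym (ℤ.pos-* m n))))))

∃-fromℕℚ≥ : ∀ p → ∃ λ n → p ≤ fromℕℚ n
∃-fromℕℚ≥ p = ℤ.∣ ↥ p ∣ , bound p
  where
  bound : ∀ p → p ≤ fromℕℚ ℤ.∣ ↥ p ∣
  bound (mkℚ (+ n) d _) = *≤* (ℤ.≤-trans
    (ℤ.≤-reflexive (ℤ.*-identityʳ (+ n)))
    (subst (+ n ℤ.≤_) (ℤ.pos-* n (suc d)) (ℤ.+≤+ (ℕ.m≤m*n n (suc d)))))
  bound (mkℚ -[1+ n ] d _) = *≤* (ℤ.≤-trans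
    (ℤ.≤-reflexive (ℤ.*-identityʳ -[1+ n ])) ℤ.-≤+)

∃-fromℕℚ* : ∀ p ε → 0ℚ < ε → ∃ λ n → p ≤ fromℕℚ n * ε
∃-fromℕℚ* p ε 0<ε with ∃-fromℕℚ≥ (p * recip ε)
... | n , h = n , subst (_≤ fromℕℚ n * ε)
  (trans (*-assoc p (recip ε) ε)
    (trans (cong (p *_) (trans (*-comm (recip ε) ε) (*-recip 0<ε))) (*-identityʳ p)))
  (*-monoʳ ε (<⇒≤ 0<ε) h)

Eventually : (ℕ → Set) → Set
Eventually P = ∃ λ N → ∀ n → N ℕ.≤ n → P n

always : ∀ {P : ℕ → Set} → (∀ n → P n) → Eventually P
always h = 0 , λ n _ → h n

⊔-l : ∀ M N {k} → M ℕ.⊔ N ℕ.≤ k → M ℕ.≤ k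
⊔-l M N = ℕ.≤-trans (ℕ.m≤m⊔n M N)

⊔-r : ∀ M N {k} → M ℕ.⊔ N ℕ.≤ k → N ℕ.≤ k
⊔-r M N = ℕ.≤-trans (ℕ.m≤n⊔m M N)

eventually₂ : ∀ {P Q R : ℕ → Set} → (∀ n → P n → Q n → R n) →
              Eventually P → Eventually Q → Eventually R
eventually₂ f (M , p) (N , q) = M ℕ.⊔ N , λ n h →
  f n (p n (⊔-l M N h)) (q n (⊔-r M N h))

eventually₁ : ∀ {P Q : ℕ → Set} → (∀ n → P n → Q n) →
              Eventually P → Eventually Q
eventually₁ f (N , p) = N , λ n h → f n (p n h)

-- A record rather than a function so that the sequence can be inferred.
record Cauchy (s : ℕ → ℚ) : Set where
  constructor mkCauchy
  field
    close : ∀ ε → 0ℚ < ε →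
      ∃ λ N → ∀ m n → N ℕ.≤ m → N ℕ.≤ n → ∣ s m - s n ∣ ≤ ε

open Cauchy public

record ℝ : Set where
  constructor mkℝ
  field
    seq    : ℕ → ℚ
    cauchy : Cauchy seq

open ℝ public

infix 4 _<ℝ_ _≤ℝ_

_<ℝ_ : ℝ → ℝ → Set
x <ℝ y = ∃ λ ε → 0ℚ < ε × Eventually (λ n → seq x n + ε ≤ seq y n)

_≤ℝ_ : ℝ → ℝ → Set
x ≤ℝ y = ∀ ε → 0ℚ < ε → Eventually (λ n → seq x n ≤ seq y n + ε)

Cauchy-by : ∀ {s} K → 0ℚ < K →
  (∀ ε → 0ℚ < ε →
    ∃ λ N → ∀ m n → N ℕ.≤ m → N ℕ.≤ n → ∣ s m - s n ∣ ≤ ε * K) →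
  Cauchy s
Cauchy-by {s} K 0<K h = mkCauchy λ ε 0<ε →
  let N , p = h (ε * recip K) (0<* 0<ε (0<recip 0<K)) in N , λ m n M≤m M≤n → subst (∣ s m - s n ∣ ≤_)
  (trans (*-assoc ε (recip K) K)
    (trans (cong (ε *_) (trans (*-comm (recip K) K) (*-recip 0<K))) (*-identityʳ ε)))
  (p m n M≤m M≤n)

Cauchy-bounded : ∀ {s} → Cauchy s →
  ∃ λ K → 0ℚ < K × Eventually (λ n → ∣ s n ∣ ≤ K)
Cauchy-bounded {s} cs = let N , h = close cs 1ℚ 0<1 in
  1ℚ + ∣ s N ∣ , <-≤-trans 0<1
    (≤-by ∣ s N ∣ (0≤∣p∣ (s N)) refl) , N , λ n N≤n →
  ≤-trans (subst (λ p → ∣ p ∣ ≤ ∣ s n - s N ∣ + ∣ s N ∣)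
      (solve 2 (λ x y → (x :- y) :+ y := x) refl (s n) (s N))
      (∣p+q∣≤∣p∣+∣q∣ (s n - s N) (s N)))
    (+-monoˡ-≤ ∣ s N ∣ (h n N N≤n ℕ.≤-refl))

Cauchy-const : ∀ p → Cauchy (λ _ → p)
Cauchy-const p = mkCauchy λ ε 0<ε → 0 , λ _ _ _ _ →
  subst (λ q → ∣ q ∣ ≤ ε) (sym (+-inverseʳ p)) (<⇒≤ 0<ε)

Cauchy-+ : ∀ {s t} → Cauchy s → Cauchy t → Cauchy (λ n → s n + t n)
Cauchy-+ {s} {t} cs ct = mkCauchy λ ε 0<ε →
  let M , p = close cs (½ * ε) (0<* 0<½ 0<ε)
      N , q = close ct (½ * ε) (0<* 0<½ 0<ε)
  in M ℕ.⊔ N , λ m n h₁ h₂ →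
  ≤-trans (subst (λ r → ∣ r ∣ ≤ ∣ s m - s n ∣ + ∣ t m - t n ∣)
      (solve 4 (λ a b c d → (a :- c) :+ (b :- d) := (a :+ b) :- (c :+ d))
        refl (s m) (t m) (s n) (t n))
      (∣p+q∣≤∣p∣+∣q∣ (s m - s n) (t m - t n)))
    (subst (∣ s m - s n ∣ + ∣ t m - t n ∣ ≤_) (½+½ ε) (+-mono-≤
      (p m n (⊔-l M N h₁) (⊔-l M N h₂))
      (q m n (⊔-r M N h₁) (⊔-r M N h₂))))

Cauchy-neg : ∀ {s} → Cauchy s → Cauchy (λ n → - s n)
Cauchy-neg {s} cs = mkCauchy λ ε 0<ε → let N , p = close cs ε 0<ε in N , λ m n h₁ h₂ → subst (_≤ ε)
  (trans (∣-∣-comm (s m) (s n))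
    (cong ∣_∣ (solve 2 (λ x y → y :- x := (:- x) :- (:- y)) refl (s m) (s n))))
  (p m n h₁ h₂)

*-close : ∀ a b c d K L ε → 0ℚ ≤ ε → 0ℚ ≤ L → ∣ a ∣ ≤ K → ∣ d ∣ ≤ L →
  ∣ a - c ∣ ≤ ε → ∣ b - d ∣ ≤ ε → ∣ a * b - c * d ∣ ≤ ε * (K + L)
*-close a b c d K L ε 0≤ε 0≤L a≤K d≤L a-c b-d = ≤-trans
  (subst (λ r → ∣ r ∣ ≤ ∣ a * (b - d) ∣ + ∣ (a - c) * d ∣) split
    (∣p+q∣≤∣p∣+∣q∣ (a * (b - d)) ((a - c) * d)))
  (subst (∣ a * (b - d) ∣ + ∣ (a - c) * d ∣ ≤_) factor (+-mono-≤ first second))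
  where
  split : a * (b - d) + (a - c) * d ≡ a * b - c * d
  split = solve 4 (λ a b c d → a :* (b :- d) :+ (a :- c) :* d := a :* b :- c :* d)
    refl a b c d
  factor : K * ε + ε * L ≡ ε * (K + L)
  factor = solve 3 (λ k l e → k :* e :+ e :* l := e :* (k :+ l)) refl K L ε
  first : ∣ a * (b - d) ∣ ≤ K * ε
  first = subst (_≤ K * ε) (sym (∣p*q∣≡∣p∣*∣q∣ a (b - d)))
    (*-mono (0≤∣p∣ a) 0≤ε a≤K b-d)
  second : ∣ (a - c) * d ∣ ≤ ε * L
  second = subst (_≤ ε * L) (sym (∣p*q∣≡∣p∣*∣q∣ (a - c) d))
    (*-mono (0≤∣p∣ (a - c)) 0≤L a-c d≤L)

Cauchy-* : ∀ {s t} → Cauchy s → Cauchy t → Cauchy (λ n → s n * t n)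
Cauchy-* {s} {t} cs ct =
  let K , 0<K , M₀ , bs = Cauchy-bounded {s} cs
      L , 0<L , N₀ , bt = Cauchy-bounded {t} ct
  in Cauchy-by {λ n → s n * t n} (K + L) (0<+ 0<K 0<L) λ ε 0<ε →
  let M , p = close cs ε 0<ε
      N , q = close ct ε 0<ε
      left  : ∀ {k} → (M₀ ℕ.⊔ N₀) ℕ.⊔ (M ℕ.⊔ N) ℕ.≤ k → M₀ ℕ.⊔ N₀ ℕ.≤ k
      left  = ⊔-l (M₀ ℕ.⊔ N₀) (M ℕ.⊔ N)
      right : ∀ {k} → (M₀ ℕ.⊔ N₀) ℕ.⊔ (M ℕ.⊔ N) ℕ.≤ k → M ℕ.⊔ N ℕ.≤ k
      right = ⊔-r (M₀ ℕ.⊔ N₀) (M ℕ.⊔ N)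
  in (M₀ ℕ.⊔ N₀) ℕ.⊔ (M ℕ.⊔ N) , λ m n h₁ h₂ →
    *-close (s m) (t m) (s n) (t n) K L ε (<⇒≤ 0<ε) (<⇒≤ 0<L)
      (bs m (⊔-l M₀ N₀ (left h₁))) (bt n (⊔-r M₀ N₀ (left h₂)))
      (p m n (⊔-l M N (right h₁)) (⊔-l M N (right h₂)))
      (q m n (⊔-r M N (right h₁)) (⊔-r M N (right h₂)))

fromℚ : ℚ → ℝ
fromℚ p = mkℝ (λ _ → p) (Cauchy-const p)

fromℕ : ℕ → ℝ
fromℕ n = fromℚ (fromℕℚ n)

0ℝ 1ℝ : ℝ
0ℝ = fromℕ 0
1ℝ = fromℕ 1

infixl 6 _+ℝ_ _-ℝ_
infixl 7 _*ℝ_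
infix  8 -ℝ_

_+ℝ_ : ℝ → ℝ → ℝ
x +ℝ y = mkℝ (λ n → seq x n + seq y n) (Cauchy-+ (cauchy x) (cauchy y))

-ℝ_ : ℝ → ℝ
-ℝ x = mkℝ (λ n → - seq x n) (Cauchy-neg (cauchy x))

_-ℝ_ : ℝ → ℝ → ℝ
x -ℝ y = x +ℝ (-ℝ y)

_*ℝ_ : ℝ → ℝ → ℝ
x *ℝ y = mkℝ (λ n → seq x n * seq y n) (Cauchy-* (cauchy x) (cauchy y))

eventually≥ : ∀ x → 0ℝ <ℝ x →
  ∃ λ δ → 0ℚ < δ × Eventually (λ n → δ ≤ seq x n)
eventually≥ x (δ , 0<δ , N , h) =
  δ , 0<δ , N , λ n N≤n → subst (_≤ seq x n) (+-identityˡ δ) (h n N≤n)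

0<-by : ∀ x δ → 0ℚ < δ → Eventually (λ n → δ ≤ seq x n) → 0ℝ <ℝ x
0<-by x δ 0<δ ev = δ , 0<δ ,
  eventually₁ (λ n → subst (_≤ seq x n) (sym (+-identityˡ δ))) ev

0<+ℝ : ∀ x y → 0ℝ <ℝ x → 0ℝ <ℝ y → 0ℝ <ℝ x +ℝ y
0<+ℝ x y 0<x 0<y =
  let δ , 0<δ , ex = eventually≥ x 0<x
      η , 0<η , ey = eventually≥ y 0<y
  in 0<-by (x +ℝ y) (δ + η) (0<+ 0<δ 0<η)
  (eventually₂ (λ _ → +-mono-≤) ex ey)

0<*ℝ : ∀ x y → 0ℝ <ℝ x → 0ℝ <ℝ y → 0ℝ <ℝ x *ℝ y
0<*ℝ x y 0<x 0<y =
  let δ , 0<δ , ex = eventually≥ x 0<x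
      η , 0<η , ey = eventually≥ y 0<y
  in 0<-by (x *ℝ y) (δ * η) (0<* 0<δ 0<η)
  (eventually₂ (λ _ p q → *-mono (<⇒≤ 0<δ) (≤-trans (<⇒≤ 0<η) q) p q) ex ey)

0<fromℕ : ∀ n .{{_ : ℕ.NonZero n}} → 0ℝ <ℝ fromℕ n
0<fromℕ (suc n) = 0<-by (fromℕ (suc n)) (fromℕℚ (suc n)) (0<fromℕℚ-suc n)
  (always λ _ → ≤-refl)

recip-close : ∀ a b δ ε → 0ℚ < δ → δ ≤ a → δ ≤ b → ∣ a - b ∣ ≤ ε →
  ∣ recip a - recip b ∣ ≤ ε * (recip δ * recip δ)
recip-close a b δ ε 0<δ δ≤a δ≤b a-b = subst (_≤ ε * (recip δ * recip δ))
  (trans (cong₂ _*_ (∣-∣-comm a b) (sym (0≤p⇒∣p∣≡p 0≤rr)))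
    (trans (sym (∣p*q∣≡∣p∣*∣q∣ (b - a) (recip a * recip b))) (cong ∣_∣ eq)))
  (*-mono (0≤∣p∣ (a - b)) (0≤* 0≤rδ 0≤rδ) a-b
    (*-mono 0≤ra 0≤rδ (recip-≤ 0<δ δ≤a) (recip-≤ 0<δ δ≤b)))
  where
  0<a = <-≤-trans 0<δ δ≤a
  0<b = <-≤-trans 0<δ δ≤b
  0≤ra : 0ℚ ≤ recip a
  0≤ra = <⇒≤ (0<recip 0<a)
  0≤rδ : 0ℚ ≤ recip δ
  0≤rδ = <⇒≤ (0<recip 0<δ)
  0≤rr : 0ℚ ≤ recip a * recip b
  0≤rr = 0≤* 0≤ra (<⇒≤ (0<recip 0<b))
  eq : (b - a) * (recip a * recip b) ≡ recip a - recip b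
  eq = trans
    (solve 4 (λ a b r s → (b :- a) :* (r :* s) := r :* (b :* s) :- (a :* r) :* s)
      refl a b (recip a) (recip b))
    (cong₂ _-_ (trans (cong (recip a *_) (*-recip 0<b)) (*-identityʳ (recip a)))
      (trans (cong (_* recip b) (*-recip 0<a)) (*-identityˡ (recip b))))

Cauchy-recip : ∀ {s δ} → 0ℚ < δ → Cauchy s → Eventually (λ n → δ ≤ s n) →
  Cauchy (λ n → recip (s n))
Cauchy-recip {s} {δ} 0<δ cs (M , δ≤) =
  Cauchy-by {λ n → recip (s n)} (recip δ * recip δ) (0<* (0<recip 0<δ) (0<recip 0<δ)) λ ε 0<ε →
  let N , h = close cs ε 0<ε in M ℕ.⊔ N , λ m n h₁ h₂ → recip-close (s m) (s n) δ ε 0<δ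
    (δ≤ m (⊔-l M N h₁)) (δ≤ n (⊔-l M N h₂))
    (h m n (⊔-r M N h₁) (⊔-r M N h₂))

inv : (x : ℝ) → 0ℝ <ℝ x → ℝ
inv x 0<x = mkℝ (λ n → recip (seq x n))
  (let δ , 0<δ , ev = eventually≥ x 0<x in Cauchy-recip 0<δ (cauchy x) ev)

0<inv : ∀ x 0<x → 0ℝ <ℝ inv x 0<x
0<inv x 0<x =
  let δ , 0<δ , ex = eventually≥ x 0<x
      K , 0<K , eK = Cauchy-bounded (cauchy x)
  in 0<-by (inv x 0<x) (recip K) (0<recip 0<K)
  (eventually₂ (λ n δ≤ ≤K → recip-≤ (<-≤-trans 0<δ δ≤) (≤-trans (p≤∣p∣ (seq x n)) ≤K)) ex eK)

-- The largest r ≤ b with r² ≤ p (or 0 if there is none).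
isqrt≤ : ℕ → ℚ → ℕ
isqrt≤ zero    p = zero
isqrt≤ (suc b) p =
  if does (fromℕℚ (suc b) * fromℕℚ (suc b) ≤? p) then suc b else isqrt≤ b p

isqrt : ℚ → ℕ
isqrt p = isqrt≤ (proj₁ (∃-fromℕℚ≥ p)) p

isqrt≤-lower : ∀ b p → 0ℚ ≤ p → fromℕℚ (isqrt≤ b p) * fromℕℚ (isqrt≤ b p) ≤ p
isqrt≤-lower zero    p 0≤p = 0≤p
isqrt≤-lower (suc b) p 0≤p = lower (fromℕℚ (suc b) * fromℕℚ (suc b) ≤? p)
  where
  lower : (d : Dec (fromℕℚ (suc b) * fromℕℚ (suc b) ≤ p)) →
    let r = if does d then suc b else isqrt≤ b p in fromℕℚ r * fromℕℚ r ≤ p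
  lower (yes h) = h
  lower (no  _) = isqrt≤-lower b p 0≤p

isqrt≤-upper : ∀ b p → p ≤ fromℕℚ (suc b) * fromℕℚ (suc b) →
  p ≤ fromℕℚ (suc (isqrt≤ b p)) * fromℕℚ (suc (isqrt≤ b p))
isqrt≤-upper zero    p h = h
isqrt≤-upper (suc b) p h = upper (fromℕℚ (suc b) * fromℕℚ (suc b) ≤? p)
  where
  upper : (d : Dec (fromℕℚ (suc b) * fromℕℚ (suc b) ≤ p)) →
    let r = if does d then suc b else isqrt≤ b p in
    p ≤ fromℕℚ (suc r) * fromℕℚ (suc r)
  upper (yes _) = h
  upper (no  q) = isqrt≤-upper b p (<⇒≤ (≰⇒> q))

isqrt-upper : ∀ p → p ≤ fromℕℚ (suc (isqrt p)) * fromℕℚ (suc (isqrt p))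
isqrt-upper p = let b , p≤b = ∃-fromℕℚ≥ p in isqrt≤-upper b p (≤-trans p≤b
  (subst (fromℕℚ b ≤_) (fromℕℚ-* (suc b) (suc b))
    (fromℕℚ-mono (ℕ.≤-trans (ℕ.n≤1+n b) (ℕ.m≤m*n (suc b) (suc b))))))

unit : ℕ → ℚ
unit n = recip (fromℕℚ (suc n))

0<unit : ∀ n → 0ℚ < unit n
0<unit n = 0<recip (0<fromℕℚ-suc n)

unit-* : ∀ n → unit n * fromℕℚ (suc n) ≡ 1ℚ
unit-* n = trans (*-comm (unit n) (fromℕℚ (suc n))) (*-recip (0<fromℕℚ-suc n))

-- ⌊(n+1)√max(p,0)⌋/(n+1)
√-approx : ℕ → ℚ → ℚ
√-approx n p =
  fromℕℚ (isqrt ((p ⊔ 0ℚ) * (fromℕℚ (suc n) * fromℕℚ (suc n)))) * unit n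

module _ (n : ℕ) (p : ℚ) where
  private
    d = fromℕℚ (suc n)
    h = unit n
    q = p ⊔ 0ℚ
    0≤q : 0ℚ ≤ q
    0≤q = p≤q⊔p p 0ℚ
    0≤d = <⇒≤ (0<fromℕℚ-suc n)
    0≤h : 0ℚ ≤ h
    0≤h = <⇒≤ (0<unit n)
    r = fromℕℚ (isqrt (q * (d * d)))
    r' = fromℕℚ (suc (isqrt (q * (d * d))))
    s = √-approx n p
    scale : (q * (d * d)) * (h * h) ≡ q
    scale = trans (solve 3 (λ q d h → (q :* (d :* d)) :* (h :* h) := q :* ((h :* d) :* (h :* d))) refl q d h)
      (trans (cong (λ e → q * (e * e)) (unit-* n)) (trans (cong (q *_) (*-identityˡ 1ℚ)) (*-identityʳ q)))

  √-approx-nonneg : 0ℚ ≤ √-approx n p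
  √-approx-nonneg = 0≤* (0≤fromℕℚ (isqrt (q * (d * d)))) 0≤h

  √-approx-lower : √-approx n p * √-approx n p ≤ p ⊔ 0ℚ
  √-approx-lower = subst₂ _≤_
    (solve 2 (λ r h → (r :* r) :* (h :* h) := (r :* h) :* (r :* h)) refl r h) scale
    (*-monoʳ (h * h) (0≤* 0≤h 0≤h)
      (isqrt≤-lower (proj₁ (∃-fromℕℚ≥ (q * (d * d)))) (q * (d * d)) (0≤* 0≤q (0≤* 0≤d 0≤d))))

  √-approx-upper : p ⊔ 0ℚ ≤ (√-approx n p + unit n) * (√-approx n p + unit n)
  √-approx-upper = subst₂ _≤_ scale
    (trans (solve 2 (λ r h → (r :* r) :* (h :* h) := (r :* h) :* (r :* h)) refl r' h)
      (cong (λ e → e * e) (trans (cong (_* h) (fromℕℚ-suc (isqrt (q * (d * d)))))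
        (trans (*-distribʳ-+ h 1ℚ r) (trans (cong (_+ r * h) (*-identityˡ h)) (+-comm h (r * h)))))))
    (*-monoʳ (h * h) (0≤* 0≤h 0≤h) (isqrt-upper (q * (d * d))))

√-approx-≤ : ∀ m n p q ε → 0ℚ ≤ ε → p ≤ q + ε * ε →
  √-approx m p ≤ √-approx n q + (unit n + ε)
√-approx-≤ m n p q ε 0≤ε h = square-cancel (√-approx-nonneg m p) 0≤t+ε
  (≤-trans (√-approx-lower m p) (≤-trans
    (⊔-lub (≤-trans h (+-monoˡ-≤ (ε * ε) (p≤p⊔q q 0ℚ)))
      (0≤+ (p≤q⊔p q 0ℚ) (0≤* 0≤ε 0≤ε)))
    (≤-trans (+-monoˡ-≤ (ε * ε) (√-approx-upper n q))
      (≤-by (2t * ε) (0≤* (0≤+ 0≤t 0≤t) 0≤ε)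
        (solve 3 (λ s h e → ((s :+ h) :* (s :+ h) :+ e :* e) :+ ((s :+ h) :+ (s :+ h)) :* e
            := (s :+ (h :+ e)) :* (s :+ (h :+ e)))
          refl (√-approx n q) (unit n) ε)))))
  where
  t = √-approx n q + unit n
  2t = t + t
  0≤t : 0ℚ ≤ t
  0≤t = 0≤+ (√-approx-nonneg n q) (<⇒≤ (0<unit n))
  0≤t+ε : 0ℚ ≤ √-approx n q + (unit n + ε)
  0≤t+ε = subst (0ℚ ≤_) (+-assoc (√-approx n q) (unit n) ε) (0≤+ 0≤t 0≤ε)

unit-small : ∀ ε → 0ℚ < ε → Eventually (λ n → unit n ≤ ε)
unit-small ε 0<ε = let N , h = ∃-fromℕℚ* 1ℚ ε 0<ε in N , λ n N≤n → *-cancelˡ-≤ (fromℕℚ (suc n)) (0<fromℕℚ-suc n)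
  (subst (_≤ fromℕℚ (suc n) * ε)
    (sym (trans (*-comm (fromℕℚ (suc n)) (unit n)) (unit-* n)))
    (≤-trans h (*-monoʳ ε (<⇒≤ 0<ε) (fromℕℚ-mono (ℕ.≤-trans N≤n (ℕ.n≤1+n n))))))

Cauchy-√ : ∀ {s} → Cauchy s → Cauchy (λ n → √-approx n (s n))
Cauchy-√ {s} cs =
  Cauchy-by {λ n → √-approx n (s n)} (1ℚ + 1ℚ) (0<+ 0<1 0<1) λ ε 0<ε →
  let M , h     = close cs (ε * ε) (0<* 0<ε 0<ε)
      N , small = unit-small ε 0<ε
      half : ∀ m n → M ℕ.⊔ N ℕ.≤ m → M ℕ.⊔ N ℕ.≤ n →
        √-approx m (s m) ≤ √-approx n (s n) + ε * (1ℚ + 1ℚ)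
      half = λ m n h₁ h₂ → ≤-trans
        (√-approx-≤ m n (s m) (s n) ε (<⇒≤ 0<ε)
          (∣∣≤⇒≤+ (h m n (⊔-l M N h₁) (⊔-l M N h₂))))
        (+-monoʳ-≤ (√-approx n (s n))
          (subst (unit n + ε ≤_) (double ε) (+-monoˡ-≤ ε (small n (⊔-r M N h₂)))))
  in M ℕ.⊔ N , λ m n h₁ h₂ → ≤+⇒∣∣≤ (half m n h₁ h₂) (half n m h₂ h₁)
  where
  double : ∀ e → e + e ≡ e * (1ℚ + 1ℚ)
  double = solve 1 (λ e → e :+ e := e :* (con 1ℚ :+ con 1ℚ)) refl

infix 8 √_

-- Total on ℝ: this is √max(x,0).
√_ : ℝ → ℝ
√ x = mkℝ (λ n → √-approx n (seq x n)) (Cauchy-√ (cauchy x))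

infixr 8 _^_

_^_ : ℚ → ℕ → ℚ
p ^ zero  = 1ℚ
p ^ suc n = p * p ^ n

-- Σ_{j<n} aⱼ pʲ
partial : (ℕ → ℚ) → ℚ → ℕ → ℚ
partial a p zero    = 0ℚ
partial a p (suc n) = partial a p n + a n * p ^ n

0≤^ : ∀ {p} → 0ℚ ≤ p → ∀ n → 0ℚ ≤ p ^ n
0≤^ 0≤p zero    = 0≤1
0≤^ 0≤p (suc n) = 0≤* 0≤p (0≤^ 0≤p n)

∣^∣-bound : ∀ {p r} → ∣ p ∣ ≤ r → ∀ n → ∣ p ^ n ∣ ≤ r ^ n
∣^∣-bound h zero = ≤-refl
∣^∣-bound {p} {r} h (suc n) = subst (_≤ r * r ^ n) (sym (∣p*q∣≡∣p∣*∣q∣ p (p ^ n)))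
  (*-mono (0≤∣p∣ p) (0≤^ (≤-trans (0≤∣p∣ p) h) n) h (∣^∣-bound h n))

*-^ : ∀ p q n → (p * q) ^ n ≡ p ^ n * q ^ n
*-^ p q zero    = sym (*-identityˡ 1ℚ)
*-^ p q (suc n) = trans (cong ((p * q) *_) (*-^ p q n)) (swap p q (p ^ n) (q ^ n))
  where
  swap : ∀ p q r s → (p * q) * (r * s) ≡ (p * r) * (q * s)
  swap = solve 4 (λ p q r s → (p :* q) :* (r :* s) := (p :* r) :* (q :* s)) refl

fromℕℚ-^ : ∀ b n → fromℕℚ b ^ n ≡ fromℕℚ (b ℕ.^ n)
fromℕℚ-^ b zero    = refl
fromℕℚ-^ b (suc n) = trans (cong (fromℕℚ b *_) (fromℕℚ-^ b n)) (sym (fromℕℚ-* b (b ℕ.^ n)))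

-- |aⱼ| rʲ ≤ M (1-u)ʲ for all j: the series converges uniformly on |p| ≤ r.
record Dominated (a : ℕ → ℚ) (r : ℚ) : Set where
  field
    M u   : ℚ
    0≤M   : 0ℚ ≤ M
    0<u   : 0ℚ < u
    u≤1   : u ≤ 1ℚ
    bound : ∀ j → ∣ a j ∣ * r ^ j ≤ M * (1ℚ - u) ^ j

module _ {a : ℕ → ℚ} {r : ℚ} (dom : Dominated a r) where
  open Dominated dom

  private
    ρ = 1ℚ - u
    0≤ρ : 0ℚ ≤ ρ
    0≤ρ = 0≤q-p u≤1
    0≤u = <⇒≤ 0<u

  tail-bound : ∀ {p} → ∣ p ∣ ≤ r → ∀ N k →
    u * ∣ partial a p (k ℕ.+ N) - partial a p N ∣ ≤ M * (ρ ^ N - ρ ^ (k ℕ.+ N))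
  tail-bound {p} h N zero = ≤-reflexive (trans
    (cong (λ q → u * ∣ q ∣) (+-inverseʳ (partial a p N)))
    (trans (*-zeroʳ u) (sym (trans (cong (M *_) (+-inverseʳ (ρ ^ N))) (*-zeroʳ M)))))
  tail-bound {p} h N (suc k) = ≤-trans (*-monoˡ u 0≤u triangle)
    (subst₂ _≤_ (sym (*-distribˡ-+ u ∣ P - Q ∣ ∣ t ∣)) (telescope M (ρ ^ N) u (ρ ^ j))
      (+-mono-≤ (tail-bound h N k) (*-monoˡ u 0≤u term)))
    where
    j = k ℕ.+ N
    P = partial a p j
    Q = partial a p N
    t = a j * p ^ j
    regroup : ∀ P Q t → (P - Q) + t ≡ (P + t) - Q
    regroup = solve 3 (λ P Q t → (P :- Q) :+ t := (P :+ t) :- Q) refl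
    triangle : ∣ (P + t) - Q ∣ ≤ ∣ P - Q ∣ + ∣ t ∣
    triangle = subst (λ q → ∣ q ∣ ≤ ∣ P - Q ∣ + ∣ t ∣) (regroup P Q t)
      (∣p+q∣≤∣p∣+∣q∣ (P - Q) t)
    term : ∣ t ∣ ≤ M * ρ ^ j
    term = subst (_≤ M * ρ ^ j) (sym (∣p*q∣≡∣p∣*∣q∣ (a j) (p ^ j)))
      (≤-trans (*-monoˡ ∣ a j ∣ (0≤∣p∣ (a j)) (∣^∣-bound h j)) (bound j))
    telescope : ∀ M x u y → M * (x - y) + u * (M * y) ≡ M * (x - (1ℚ - u) * y)
    telescope = solve 4 (λ M x u y →
      M :* (x :- y) :+ u :* (M :* y) := M :* (x :- (con 1ℚ :- u) :* y)) refl

  geometric : ∀ N → ρ ^ N * (1ℚ + fromℕℚ N * u) ≤ 1ℚ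
  geometric zero = ≤-reflexive (trans (*-identityˡ (1ℚ + 0ℚ * u))
    (trans (cong (λ q → 1ℚ + q) (*-zeroˡ u)) (+-identityʳ 1ℚ)))
  geometric (suc N) = ≤-trans
    (subst (_≤ ρ ^ N * (1ℚ + fromℕℚ N * u)) (sym (trans
        (cong (λ q → (ρ * ρ ^ N) * (1ℚ + q * u)) (fromℕℚ-suc N))
        (rearrange u (ρ ^ N) (fromℕℚ N))))
      (*-monoˡ (ρ ^ N) (0≤^ 0≤ρ N)
        (≤-by ((1ℚ + fromℕℚ N) * (u * u)) (0≤* (0≤+ 0≤1 (0≤fromℕℚ N)) (0≤* 0≤u 0≤u))
          (cancel u (fromℕℚ N)))))
    (geometric N)
    where
    rearrange : ∀ u x n → ((1ℚ - u) * x) * (1ℚ + (1ℚ + n) * u) ≡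
                          x * ((1ℚ + n * u) - (1ℚ + n) * (u * u))
    rearrange = solve 3 (λ u x n →
      ((con 1ℚ :- u) :* x) :* (con 1ℚ :+ (con 1ℚ :+ n) :* u) :=
      x :* ((con 1ℚ :+ n :* u) :- (con 1ℚ :+ n) :* (u :* u))) refl
    cancel : ∀ u n → ((1ℚ + n * u) - (1ℚ + n) * (u * u)) + (1ℚ + n) * (u * u) ≡ 1ℚ + n * u
    cancel = solve 2 (λ u n →
      ((con 1ℚ :+ n :* u) :- (con 1ℚ :+ n) :* (u :* u)) :+ (con 1ℚ :+ n) :* (u :* u)
      := con 1ℚ :+ n :* u) refl

  tail-small : ∀ ε → 0ℚ < ε → ∃ λ N → ∀ {p} → ∣ p ∣ ≤ r → ∀ m → N ℕ.≤ m →
    ∣ partial a p m - partial a p N ∣ ≤ ε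
  tail-small ε 0<ε = N , λ {p} h m N≤m →
    *-cancelˡ-≤ u 0<u (≤-trans (tail p h m N≤m) small)
    where
    εuu = ε * (u * u)
    N = proj₁ (∃-fromℕℚ* M εuu (0<* 0<ε (0<* 0<u 0<u)))
    M≤ : M ≤ fromℕℚ N * εuu
    M≤ = proj₂ (∃-fromℕℚ* M εuu (0<* 0<ε (0<* 0<u 0<u)))
    tail : ∀ p → ∣ p ∣ ≤ r → ∀ m → N ℕ.≤ m →
      u * ∣ partial a p m - partial a p N ∣ ≤ M * ρ ^ N
    tail p h m N≤m = ≤-trans
      (subst (λ i → u * ∣ partial a p i - partial a p N ∣ ≤ M * (ρ ^ N - ρ ^ i))
        (ℕ.m∸n+n≡m N≤m) (tail-bound h N (m ℕ.∸ N)))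
      (*-monoˡ M 0≤M (≤-by (ρ ^ m) (0≤^ 0≤ρ m) (restore (ρ ^ N) (ρ ^ m))))
      where
      restore : ∀ x y → (x - y) + y ≡ x
      restore = solve 2 (λ x y → (x :- y) :+ y := x) refl
    small : M * ρ ^ N ≤ u * ε
    small = ≤-trans (*-monoʳ (ρ ^ N) (0≤^ 0≤ρ N) M≤)
      (subst₂ _≤_ (regroup ε u (ρ ^ N) (fromℕℚ N)) (*-identityʳ (u * ε))
        (*-monoˡ (u * ε) (0≤* 0≤u (<⇒≤ 0<ε))
          (≤-trans (*-monoˡ (ρ ^ N) (0≤^ 0≤ρ N) Nu≤) (geometric N))))
      where
      Nu≤ : fromℕℚ N * u ≤ 1ℚ + fromℕℚ N * u
      Nu≤ = ≤-by 1ℚ 0≤1 (+-comm (fromℕℚ N * u) 1ℚ)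
      regroup : ∀ e u x n → (u * e) * (x * (n * u)) ≡ (n * (e * (u * u))) * x
      regroup = solve 4 (λ e u x n →
        (u :* e) :* (x :* (n :* u)) := (n :* (e :* (u :* u))) :* x) refl

Cauchy-^ : ∀ {s} → Cauchy s → ∀ k → Cauchy (λ n → s n ^ k)
Cauchy-^ cs zero    = Cauchy-const 1ℚ
Cauchy-^ {s} cs (suc k) = Cauchy-* {s} {λ n → s n ^ k} cs (Cauchy-^ cs k)

Cauchy-partial : ∀ a {s} → Cauchy s → ∀ k → Cauchy (λ n → partial a (s n) k)
Cauchy-partial a cs zero = Cauchy-const 0ℚ
Cauchy-partial a {s} cs (suc k) =
  Cauchy-+ {λ n → partial a (s n) k} {λ n → a k * s n ^ k} (Cauchy-partial a cs k)
    (Cauchy-* {λ _ → a k} {λ n → s n ^ k} (Cauchy-const (a k)) (Cauchy-^ cs k))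

Cauchy-series : ∀ {a r s} → Dominated a r → Cauchy s →
  Eventually (λ n → ∣ s n ∣ ≤ r) → Cauchy (λ n → partial a (s n) n)
Cauchy-series {a} {r} {s} dom cs (B , s≤r) =
  Cauchy-by {λ n → partial a (s n) n} (1ℚ + (1ℚ + 1ℚ)) (0<+ 0<1 (0<+ 0<1 0<1)) λ ε 0<ε →
  let N , tail = tail-small dom ε 0<ε
      K , h    = close (Cauchy-partial a cs N) ε 0<ε
      B≤ : ∀ {k} → B ℕ.⊔ (N ℕ.⊔ K) ℕ.≤ k → B ℕ.≤ k
      B≤ = ⊔-l B (N ℕ.⊔ K)
      NK≤ : ∀ {k} → B ℕ.⊔ (N ℕ.⊔ K) ℕ.≤ k → N ℕ.⊔ K ℕ.≤ k
      NK≤ = ⊔-r B (N ℕ.⊔ K)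
  in B ℕ.⊔ (N ℕ.⊔ K) , λ m n h₁ h₂ →
    three (partial a (s m) m) (partial a (s m) N) (partial a (s n) N) (partial a (s n) n) ε
      (tail (s≤r m (B≤ h₁)) m (⊔-l N K (NK≤ h₁)))
      (h m n (⊔-r N K (NK≤ h₁)) (⊔-r N K (NK≤ h₂)))
      (subst (_≤ ε) (∣-∣-comm (partial a (s n) n) (partial a (s n) N))
        (tail (s≤r n (B≤ h₂)) n (⊔-l N K (NK≤ h₂))))
  where
  factor : ∀ ε → ε + (ε + ε) ≡ ε * (1ℚ + (1ℚ + 1ℚ))
  factor = solve 1 (λ ε → ε :+ (ε :+ ε) := ε :* (con 1ℚ :+ (con 1ℚ :+ con 1ℚ))) refl
  three : ∀ p q v w ε → ∣ p - q ∣ ≤ ε → ∣ q - v ∣ ≤ ε → ∣ v - w ∣ ≤ ε →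
    ∣ p - w ∣ ≤ ε * (1ℚ + (1ℚ + 1ℚ))
  three p q v w ε h₁ h₂ h₃ = subst (∣ p - w ∣ ≤_) (factor ε)
    (≤-trans (∣∣-triangle p q w)
      (+-mono-≤ h₁ (≤-trans (∣∣-triangle q v w) (+-mono-≤ h₂ h₃))))

expCoeff : ℕ → ℚ
expCoeff j = recip (fromℕℚ (j !))

0<! : ∀ j → 0ℚ < fromℕℚ (j !)
0<! j = <-≤-trans 0<1 (fromℕℚ-mono {1} (ℕ.1≤n! j))

^≤^*! : ∀ b j → suc b ℕ.^ j ℕ.≤ suc b ℕ.^ suc b ℕ.* j !
^≤^*! b zero = ℕ.≤-trans (ℕ.m^n>0 (suc b) (suc b))
  (ℕ.≤-reflexive (sym (ℕ.*-identityʳ (suc b ℕ.^ suc b))))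
^≤^*! b (suc j) = step (suc b ℕ.≤? suc j)
  where
  B = suc b ℕ.^ suc b
  step : Dec (suc b ℕ.≤ suc j) → suc b ℕ.^ suc j ℕ.≤ B ℕ.* (suc j) !
  step (yes h) = ℕ.≤-trans (ℕ.*-mono-≤ h (^≤^*! b j))
    (ℕ.≤-reflexive (trans (sym (ℕ.*-assoc (suc j) B (j !)))
      (trans (cong (ℕ._* j !) (ℕ.*-comm (suc j) B)) (ℕ.*-assoc B (suc j) (j !)))))
  step (no h) = ℕ.≤-trans (ℕ.^-monoʳ-≤ (suc b) (ℕ.<⇒≤ (ℕ.≰⇒> h)))
    (ℕ.≤-trans (ℕ.≤-reflexive (sym (ℕ.*-identityʳ B))) (ℕ.*-monoʳ-≤ B (ℕ.1≤n! (suc j))))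

exp-dominated : ∀ k → Dominated expCoeff (fromℕℚ (suc k))
exp-dominated k = record
  { M     = fromℕℚ B^B
  ; u     = ½
  ; 0≤M   = 0≤fromℕℚ B^B
  ; 0<u   = 0<½
  ; u≤1   = *≤* (ℤ.+≤+ (ℕ.s≤s ℕ.z≤n))
  ; bound = bound
  }
  where
  b   = k ℕ.+ suc k
  B   = suc b
  B^B = B ℕ.^ B
  r   = fromℕℚ (suc k)
  halve : r ≡ fromℕℚ B * ½
  halve = sym (trans (cong (_* ½) (trans (cong fromℕℚ double) (fromℕℚ-* 2 (suc k))))
    (trans (*-assoc₂ (fromℕℚ 2) r) (*-identityʳ r)))
    where
    double : B ≡ 2 ℕ.* suc k
    double = cong (suc k ℕ.+_) (sym (ℕ.+-identityʳ (suc k)))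
    *-assoc₂ : ∀ p q → (p * q) * ½ ≡ q * (p * ½)
    *-assoc₂ p q = trans (cong (_* ½) (*-comm p q)) (*-assoc q p ½)
  bound : ∀ j → ∣ expCoeff j ∣ * r ^ j ≤ fromℕℚ B^B * ½ ^ j
  bound j = subst (_≤ fromℕℚ B^B * ½ ^ j) (sym lhs)
    (*-monoʳ (½ ^ j) (0≤^ (<⇒≤ 0<½) j) coeff)
    where
    e = expCoeff j
    0≤e : 0ℚ ≤ e
    0≤e = <⇒≤ (0<recip (0<! j))
    lhs : ∣ e ∣ * r ^ j ≡ (e * fromℕℚ (B ℕ.^ j)) * ½ ^ j
    lhs = trans (cong₂ _*_ (0≤p⇒∣p∣≡p 0≤e)
      (trans (cong (_^ j) halve) (trans (*-^ (fromℕℚ B) ½ j) (cong (_* ½ ^ j) (fromℕℚ-^ B j)))))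
      (sym (*-assoc e (fromℕℚ (B ℕ.^ j)) (½ ^ j)))
    coeff : e * fromℕℚ (B ℕ.^ j) ≤ fromℕℚ B^B
    coeff = subst (e * fromℕℚ (B ℕ.^ j) ≤_) eq (*-monoˡ e 0≤e (fromℕℚ-mono (^≤^*! b j)))
      where
      eq : e * fromℕℚ (B^B ℕ.* j !) ≡ fromℕℚ B^B
      eq = trans (cong (e *_) (fromℕℚ-* B^B (j !)))
        (trans (sym (*-assoc e (fromℕℚ B^B) (fromℕℚ (j !))))
        (trans (cong (_* fromℕℚ (j !)) (*-comm e (fromℕℚ B^B)))
        (trans (*-assoc (fromℕℚ B^B) e (fromℕℚ (j !)))
        (trans (cong (fromℕℚ B^B *_) (trans (*-comm e (fromℕℚ (j !))) (*-recip (0<! j))))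
          (*-identityʳ (fromℕℚ B^B))))))

Cauchy-exp : ∀ {s} → Cauchy s → Cauchy (λ n → partial expCoeff (s n) n)
Cauchy-exp cs =
  let K , _ , ev = Cauchy-bounded cs
      k , K≤k    = ∃-fromℕℚ≥ K
  in Cauchy-series (exp-dominated k) cs
       (eventually₁ (λ _ h → ≤-trans h (≤-trans K≤k (fromℕℚ-mono (ℕ.n≤1+n k)))) ev)

-- Σⱼ xʲ/j!, the n-th approximation using n terms and the n-th approximation of x.
exp : ℝ → ℝ
exp x = mkℝ (λ n → partial expCoeff (seq x n) n) (Cauchy-exp (cauchy x))

0≤square : ∀ p → 0ℚ ≤ p * p
0≤square p = nonneg (∣p∣≡p∨∣p∣≡-p p)
  where
  negneg : ∀ p → (- p) * (- p) ≡ p * p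
  negneg = solve 1 (λ p → (:- p) :* (:- p) := p :* p) refl
  nonneg : ∣ p ∣ ≡ p ⊎ ∣ p ∣ ≡ - p → 0ℚ ≤ p * p
  nonneg (inj₁ eq) = subst (λ q → 0ℚ ≤ q * q) eq (0≤* (0≤∣p∣ p) (0≤∣p∣ p))
  nonneg (inj₂ eq) = subst (0ℚ ≤_) (trans (cong (λ q → q * q) eq) (negneg p))
    (0≤* (0≤∣p∣ p) (0≤∣p∣ p))

artanhCoeff : ℕ → ℚ
artanhCoeff j = recip (fromℕℚ (suc (2 ℕ.* j)))

artanh-dominated : ∀ u → 0ℚ < u → u ≤ 1ℚ → Dominated artanhCoeff (1ℚ - u)
artanh-dominated u 0<u u≤1 = record
  { M     = 1ℚ
  ; u     = u
  ; 0≤M   = 0≤1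
  ; 0<u   = 0<u
  ; u≤1   = u≤1
  ; bound = λ j → *-monoʳ ((1ℚ - u) ^ j) (0≤^ (0≤q-p u≤1) j)
      (subst (_≤ 1ℚ) (sym (0≤p⇒∣p∣≡p (<⇒≤ (0<recip (0<fromℕℚ-suc (2 ℕ.* j))))))
        (recip-≤ {fromℕℚ (suc (2 ℕ.* j))} {1ℚ} 0<1
          (fromℕℚ-mono {1} (ℕ.s≤s ℕ.z≤n))))
  }

0<x+1 : ∀ x → 0ℝ <ℝ x → 0ℝ <ℝ x +ℝ 1ℝ
0<x+1 x 0<x = 0<+ℝ x 1ℝ 0<x (0<fromℕ 1)

-- (x-1)/(x+1)
cayley : (x : ℝ) → 0ℝ <ℝ x → ℝ
cayley x 0<x = (x -ℝ 1ℝ) *ℝ inv (x +ℝ 1ℝ) (0<x+1 x 0<x)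

cayley²<1 : ∀ x 0<x → let z = cayley x 0<x in
  ∃ λ u → 0ℚ < u × u ≤ 1ℚ × Eventually (λ n → ∣ seq z n * seq z n ∣ ≤ 1ℚ - u)
cayley²<1 x 0<x = u , 0<u , u≤1 , eventually₁ (λ n → subst (_≤ 1ℚ - u)
    (sym (0≤p⇒∣p∣≡p (0≤square (seq z n))))) ev
  where
  z = cayley x 0<x
  w = inv (x +ℝ 1ℝ) (0<x+1 x 0<x)
  4xww = (fromℕ 4 *ℝ x) *ℝ (w *ℝ w)
  0<w : 0ℝ <ℝ w
  0<w = 0<inv (x +ℝ 1ℝ) (0<x+1 x 0<x)
  0<4xww : 0ℝ <ℝ 4xww
  0<4xww = 0<*ℝ (fromℕ 4 *ℝ x) (w *ℝ w) (0<*ℝ (fromℕ 4) x (0<fromℕ 4) 0<x) (0<*ℝ w w 0<w 0<w)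
  u = proj₁ (eventually≥ 4xww 0<4xww)
  0<u : 0ℚ < u
  0<u = proj₁ (proj₂ (eventually≥ 4xww 0<4xww))
  identity : ∀ q w → (q + 1ℚ) * w ≡ 1ℚ →
    ((q - 1ℚ) * w) * ((q - 1ℚ) * w) + (fromℕℚ 4 * q) * (w * w) ≡ 1ℚ
  identity q w eq = trans (expand q w) (trans (cong (λ e → e * e) eq) (*-identityˡ 1ℚ))
    where
    expand : ∀ q w → ((q - 1ℚ) * w) * ((q - 1ℚ) * w) + (fromℕℚ 4 * q) * (w * w)
      ≡ ((q + 1ℚ) * w) * ((q + 1ℚ) * w)
    expand = solve 2 (λ q w →
      ((q :- con 1ℚ) :* w) :* ((q :- con 1ℚ) :* w) :+ (con (fromℕℚ 4) :* q) :* (w :* w)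
      := ((q :+ con 1ℚ) :* w) :* ((q :+ con 1ℚ) :* w)) refl
  ev : Eventually (λ n → seq z n * seq z n ≤ 1ℚ - u)
  ev = eventually₂ below
    (proj₂ (proj₂ (eventually≥ 4xww 0<4xww))) (proj₂ (proj₂ (eventually≥ x 0<x)))
    where
    subtract : ∀ p e → e + p ≡ 1ℚ → u ≤ p → e ≤ 1ℚ - u
    subtract p e eq u≤p = subst (_≤ 1ℚ - u) (trans (cong (_- p) (sym eq)) (undo e p))
      (+-monoʳ-≤ 1ℚ (neg-antimono-≤ u≤p))
      where
      undo : ∀ e p → (e + p) - p ≡ e
      undo = solve 2 (λ e p → (e :+ p) :- p := e) refl
    below : ∀ n → u ≤ seq 4xww n → proj₁ (eventually≥ x 0<x) ≤ seq x n →
      seq z n * seq z n ≤ 1ℚ - u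
    below n u≤ δ≤ = subtract (seq 4xww n) (seq z n * seq z n)
      (identity (seq x n) (seq w n) (*-recip 0<q+1)) u≤
      where
      0<q+1 : 0ℚ < seq x n + 1ℚ
      0<q+1 = 0<+ (<-≤-trans (proj₁ (proj₂ (eventually≥ x 0<x))) δ≤) 0<1
  u≤1 : u ≤ 1ℚ
  u≤1 = subst (_≤ 1ℚ) (+-identityʳ u) (subst (u + 0ℚ ≤_) (cancel u)
    (+-monoʳ-≤ u (≤-trans (0≤square (seq z (proj₁ ev))) (proj₂ ev (proj₁ ev) ℕ.≤-refl))))
    where
    cancel : ∀ u → u + (1ℚ - u) ≡ 1ℚ
    cancel = solve 1 (λ u → u :+ (con 1ℚ :- u) := con 1ℚ) refl

-- Σⱼ z²ʲ/(2j+1) with z = (x-1)/(x+1)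
logSeries : (x : ℝ) → 0ℝ <ℝ x → ℝ
logSeries x 0<x = mkℝ
  (λ n → partial artanhCoeff (seq z n * seq z n) n)
  (let u , 0<u , u≤1 , ev = cayley²<1 x 0<x in
   Cauchy-series (artanh-dominated u 0<u u≤1) (cauchy (z *ℝ z)) ev)
  where z = cayley x 0<x

-- log x = 2 artanh z = 2z Σⱼ z²ʲ/(2j+1) with z = (x-1)/(x+1), |z| < 1
log : (x : ℝ) → 0ℝ <ℝ x → ℝ
log x 0<x = fromℕ 2 *ℝ cayley x 0<x *ℝ logSeries x 0<x

0<log : ∀ x 0<x → 1ℝ <ℝ x → 0ℝ <ℝ log x 0<x
0<log x 0<x (ε , 0<ε , ev) =
  0<*ℝ (fromℕ 2 *ℝ z) (logSeries x 0<x) (0<*ℝ (fromℕ 2) z (0<fromℕ 2) 0<z) 0<series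
  where
  z = cayley x 0<x
  w = inv (x +ℝ 1ℝ) (0<x+1 x 0<x)
  shift : ∀ q → 1ℚ + ε ≤ q → ε ≤ q - 1ℚ
  shift q h = subst (_≤ q - 1ℚ) (drop ε) (+-monoˡ-≤ (- 1ℚ) h)
    where
    drop : ∀ e → (1ℚ + e) - 1ℚ ≡ e
    drop = solve 1 (λ e → (con 1ℚ :+ e) :- con 1ℚ := e) refl
  0<z : 0ℝ <ℝ z
  0<z = 0<*ℝ (x -ℝ 1ℝ) w
    (0<-by (x -ℝ 1ℝ) ε 0<ε (eventually₁ (λ n → shift (seq x n)) ev))
    (0<inv (x +ℝ 1ℝ) (0<x+1 x 0<x))
  1≤partial : ∀ p → 0ℚ ≤ p → ∀ n → 1ℚ ≤ partial artanhCoeff p (suc n)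
  1≤partial p 0≤p zero    = ≤-refl
  1≤partial p 0≤p (suc n) = ≤-trans (1≤partial p 0≤p n)
    (≤-by (artanhCoeff (suc n) * p ^ suc n)
      (0≤* (<⇒≤ (0<recip (0<fromℕℚ-suc (2 ℕ.* suc n)))) (0≤^ 0≤p (suc n))) refl)
  0<series : 0ℝ <ℝ logSeries x 0<x
  0<series = 0<-by (logSeries x 0<x) 1ℚ 0<1 (1 , λ { (suc n) _ →
    1≤partial (seq z (suc n) * seq z (suc n)) (0≤square (seq z (suc n))) n })

pow : (x : ℝ) → 0ℝ <ℝ x → ℝ → ℝ
pow x 0<x a = exp (a *ℝ log x 0<x)

0<fromℕ≥2 : ∀ n .{{_ : NonTrivial n}} → 0ℝ <ℝ fromℕ n
0<fromℕ≥2 n = 0<fromℕ n {{ℕ.nonTrivial⇒nonZero n}}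

infix 8 _^ℝ_

_^ℝ_ : (n : ℕ) .{{_ : NonTrivial n}} → ℝ → ℝ
n ^ℝ a = pow (fromℕ n) (0<fromℕ≥2 n) a

ln : (n : ℕ) .{{_ : NonTrivial n}} → ℝ
ln n = log (fromℕ n) (0<fromℕ≥2 n)

0<ln : ∀ n .{{_ : NonTrivial n}} → 0ℝ <ℝ ln n
0<ln n = 0<log (fromℕ n) (0<fromℕ≥2 n)
  (1ℚ , 0<1 , always λ _ → fromℕℚ-mono {2} (ℕ.nonTrivial⇒n>1 n))

-- (log n)ᵃ; n ≥ 2 makes log n positive, so that its real powers are defined.
ln^ : (n : ℕ) .{{_ : NonTrivial n}} → ℝ → ℝ
ln^ n a = pow (ln n) (0<ln n) a

-- Outcomes with their weights; an outcome may be listed several times.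
Dist : Set → Set
Dist A = List (A × ℚ)

return : ∀ {A} → A → Dist A
return a = List.[ (a , 1ℚ) ]

infixl 1 _>>=_

_>>=_ : ∀ {A B} → Dist A → (A → Dist B) → Dist B
d >>= f = List.concatMap (λ (a , p) → List.map (λ (b , q) → (b , p * q)) (f a)) d

uniform : ∀ n → Dist (Fin n)
uniform n = List.map (λ i → (i , recip (fromℕℚ n))) (List.allFin n)

independently : ∀ {A n} → Vec (Dist A) n → Dist (Vec A n)
independently []       = return []
independently (d ∷ ds) = do
  a  ← d
  as ← independently ds
  return (a ∷ as)

Pr : ∀ {A} {P : A → Set} → Decidable P → Dist A → ℚ
Pr P? = List.foldr (λ (a , p) s → if does (P? a) then p + s else s) 0ℚ

record Configuration (k n : ℕ) : Set where
  field
    counts : Vec ℕ k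
    total  : Vec.sum counts ≡ n

open Configuration public

-- c₁ ≥ c₂ ≥ … ≥ c_k
Ordered : ∀ {k n} → Configuration k n → Set
Ordered c = Linked ℕ._≥_ (counts c)

c₁ : ∀ {k n} → Configuration (suc k) n → ℕ
c₁ c = Vec.head (counts c)

-- With a single colour there is no c₂, and it is read as 0.
c₂ : ∀ {k n} → Configuration (suc k) n → ℕ
c₂ c = second (counts c)
  where
  second : ∀ {k} → Vec ℕ (suc k) → ℕ
  second (_ ∷ [])     = 0
  second (_ ∷ b ∷ _) = b

-- Truncation is harmless: the bias is used for ordered configurations only.
bias : ∀ {k n} → Configuration (suc k) n → ℕ
bias c = c₁ c ℕ.∸ c₂ c

-- The colour of each node; colour j ∈ {1,…,k} is the element j-1 of Fin k.
Colouring : ℕ → ℕ → Set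
Colouring k n = Vec (Fin k) n

colourCounts : ∀ {k n} → Colouring k n → Vec ℕ k
colourCounts x = Vec.tabulate λ j → Vec.count (Fin._≟ j) x

_HasConfiguration_ : ∀ {k n} → Colouring k n → Configuration k n → Set
x HasConfiguration c = colourCounts x ≡ counts c

-- Three different colours: the first one wins.
majority : ∀ {k} → Fin k → Fin k → Fin k → Fin k
majority a b c =
  if does (a Fin.≟ b) then a else
  if does (a Fin.≟ c) then a else
  if does (b Fin.≟ c) then b else
  a

recolour : ∀ {k n} → Colouring k n → Dist (Fin k)
recolour {n = n} x = do
  u ← uniform n
  v ← uniform n
  w ← uniform n
  return (majority (Vec.lookup x u) (Vec.lookup x v) (Vec.lookup x w))

-- The law of the new colour does not depend on the node.
majorityRound : ∀ {k n} → Colouring k n → Dist (Colouring k n)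
majorityRound {n = n} x = independently (Vec.replicate n (recolour x))

-- The colourings at times 0, 1, …, T.
trajectory : ∀ {k n} T → Colouring k n → Dist (Vec (Colouring k n) (suc T))
trajectory zero    x = return (x ∷ [])
trajectory (suc T) x = do
  y  ← majorityRound x
  ys ← trajectory T y
  return (x ∷ ys)

PluralityConsensus : ∀ {k n} → Colouring (suc k) n → Set
PluralityConsensus = All (_≡ Fin.zero)

pluralityConsensus? : ∀ {k n} → Decidable (PluralityConsensus {k} {n})
pluralityConsensus? = All.all? (Fin._≟ Fin.zero)

Pr-consensus-within : ∀ {k n} → ℕ → Colouring (suc k) n → ℚ
Pr-consensus-within T x = Pr (Any.any? pluralityConsensus?) (trajectory T x)

-- Write f for the fraction of nodes with the plurality colour 0 and σ for its lead over every other
-- colour.  A node takes colour j in the next round with probability f_j(1 + f_j - S), S = Σ f_h², so while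
-- f ≤ 2/3 the expected lead is at least σ(1 + f/3), and f is expected to grow too.  The exponential
-- moment E[Π g(y_i)], with g = 1/(1+t) on colour 0, 1+t on a rival colour and t = σ/16, shows that the lead
-- grows by the factor 1 + α/12 (α = c₁/n) and that f stays above α, except with probability about
-- n·2^(-3L) with 4^L ≈ n: this is where σ²α ≥ 384 L/n, the product of the two hypotheses, is used.
-- Hence f > 2/3 after O(L/α) rounds, from where the expected minority shrinks by 7/9 in every round.
--
-- All probabilities are rational, so real numbers enter only through (log n)^(-ℓ) · (log n)^(ℓ+1) = log n:
-- exp turns sums into products up to an error that tends to 0, and the increments of log on a grid are
-- compared with (y-x)/y and (y-x)/x.
module Submission where

open import Data.Bool.Base using (true; false; if_then_else_; T)
open import Data.Empty using (⊥-elim)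
open import Data.Fin.Base using (Fin; zero; suc)
import Data.Fin.Properties as Fin
open import Data.Integer.Base using (+_)
open import Data.List.Base as List using ([]; _∷_; _++_)
open import Data.List.Relation.Unary.All as ListAll using ([]; _∷_)
import Data.List.Relation.Unary.All.Properties as ListAll
open import Data.Nat.Base as ℕ using (ℕ; zero; suc; NonTrivial)
import Data.Nat.Properties as ℕ
open import Data.Product.Base using (Σ; ∃; _×_; _,_; proj₁; proj₂)
open import Data.Rational.Base
open import Data.Rational.Properties
import Data.Rational.Solver as ℚ-Solver
open import Data.Sum.Base using (_⊎_; inj₁; inj₂)
open import Data.Unit.Base using (⊤; tt)
open import Data.Vec.Base as Vec using (Vec; []; _∷_; lookup)
import Data.Vec.Properties as Vec
open import Data.Vec.Relation.Unary.All using (All; []; _∷_)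
import Data.Vec.Relation.Unary.All.Properties as VecAll
open import Data.Vec.Relation.Unary.Any as Any using (Any; here; there)
open import Data.Vec.Relation.Unary.Linked using (Linked; []; [-]; _∷_)
open import Defs
open import Function.Base using (_∘_)
open import Relation.Binary.PropositionalEquality
  using (_≡_; _≢_; refl; sym; trans; cong; cong₂; subst; subst₂)
open import Relation.Nullary using (Dec; yes; no; does; ¬_)
open import Relation.Nullary.Decidable using (_⊎-dec_)

open ℚ-Solver.+-*-Solver using (solve; _:=_; _:+_; _:*_; _:-_; :-_; con)

-- Expectations

-- The failure budget shapes the constants. A union over fewer than 4^(L+1) nodes turns the tail
-- 2^(-3L) into O(2^(-L)) per round, so the O(L/α) rounds have to stay well below 2^L in number. The
-- exponent ℓ is an arbitrary real, and nothing is assumed about the size of (log n)^ℓ: the two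
-- hypotheses themselves force nα³ ≥ 1, hence L/α = O(L (8/5)^L). The total failure is then O(L
-- (4/5)^L), a negative power of n, and the constants come out independent of ℓ. The exponent 3L
-- asks for σ²α/128 ≥ 3L/n; this is the origin of 384 = 3 · 128. Two phases are needed because the
-- guaranteed drift fσ(1-f) of f vanishes as f tends to 1, where the expected number of minority
-- nodes takes over as the measure of progress. Inequalities between reals hold only eventually and
-- up to ε. The slack that absorbs this error is the difference between (4L+1)/5, which the
-- logarithm estimate yields, and the 4L/5 that is used.

E : {A : Set} → Dist A → (A → ℚ) → ℚ
E []            f = 0ℚ
E ((a , p) ∷ d) f = p * f a + E d f

NonNeg : {A : Set} → Dist A → Set
NonNeg = ListAll.All (λ (a , p) → 0ℚ ≤ p)

Support : {A : Set} → (A → Set) → Dist A → Set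
Support Q = ListAll.All (λ (a , p) → Q a)

module _ {A : Set} where

  E-cong : {f g : A → ℚ} (d : Dist A) → (∀ a → f a ≡ g a) → E d f ≡ E d g
  E-cong []            eq = refl
  E-cong ((a , p) ∷ d) eq = cong₂ _+_ (cong (p *_) (eq a)) (E-cong d eq)

  E-mono-support : {f g : A → ℚ} {d : Dist A} → NonNeg d →
    Support (λ a → f a ≤ g a) d → E d f ≤ E d g
  E-mono-support []        []        = ≤-refl
  E-mono-support (0≤p ∷ n) (f≤g ∷ h) = +-mono-≤ (*-monoˡ _ 0≤p f≤g) (E-mono-support n h)

  E-mono : {f g : A → ℚ} {d : Dist A} → NonNeg d → (∀ a → f a ≤ g a) → E d f ≤ E d g
  E-mono n h = E-mono-support n (ListAll.universal (λ (a , _) → h a) _)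

  E-+ : ∀ (f g : A → ℚ) d → E d (λ a → f a + g a) ≡ E d f + E d g
  E-+ f g []            = refl
  E-+ f g ((a , p) ∷ d) = trans (cong (λ s → p * (f a + g a) + s) (E-+ f g d))
    (solve 5 (λ p x y u v → p :* (x :+ y) :+ (u :+ v) := (p :* x :+ u) :+ (p :* y :+ v))
      refl p (f a) (g a) (E d f) (E d g))

  E-* : ∀ c (f : A → ℚ) d → E d (λ a → c * f a) ≡ c * E d f
  E-* c f []            = sym (*-zeroʳ c)
  E-* c f ((a , p) ∷ d) = trans (cong (λ s → p * (c * f a) + s) (E-* c f d))
    (solve 4 (λ p c x u → p :* (c :* x) :+ c :* u := c :* (p :* x :+ u)) refl p c (f a) (E d f))

  E-++ : ∀ (f : A → ℚ) d e → E (d ++ e) f ≡ E d f + E e f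
  E-++ f []            e = sym (+-identityˡ (E e f))
  E-++ f ((a , p) ∷ d) e = trans (cong (λ s → p * f a + s) (E-++ f d e)) (sym (+-assoc (p * f a) _ _))

  E-scale : ∀ c (f : A → ℚ) d → E (List.map (λ (b , q) → (b , c * q)) d) f ≡ c * E d f
  E-scale c f []            = sym (*-zeroʳ c)
  E-scale c f ((a , p) ∷ d) = trans (cong (λ s → c * p * f a + s) (E-scale c f d))
    (solve 4 (λ p c x u → (c :* p) :* x :+ c :* u := c :* (p :* x :+ u)) refl p c (f a) (E d f))

E->>= : {A B : Set} (d : Dist A) (k : A → Dist B) (f : B → ℚ) →
  E (d >>= k) f ≡ E d (λ a → E (k a) f)
E->>= []            k f = refl
E->>= ((a , p) ∷ d) k f = trans (E-++ f (List.map _ (k a)) (d >>= k))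
  (cong₂ _+_ (E-scale p f (k a)) (E->>= d k f))

E-return : {A : Set} (a : A) (f : A → ℚ) → E (return a) f ≡ f a
E-return a f = trans (+-identityʳ (1ℚ * f a)) (*-identityˡ (f a))

record IsProbability {A : Set} (d : Dist A) : Set where
  field
    nonneg : NonNeg d
    mass   : E d (λ _ → 1ℚ) ≡ 1ℚ

open IsProbability

E-const : {A : Set} {d : Dist A} → IsProbability d → ∀ c → E d (λ _ → c) ≡ c
E-const {d = d} pd c = trans (E-cong d (λ _ → sym (*-identityʳ c)))
  (trans (E-* c (λ _ → 1ℚ) d) (trans (cong (c *_) (mass pd)) (*-identityʳ c)))

NonNeg->>= : {A B : Set} {d : Dist A} {k : A → Dist B} →
  NonNeg d → (∀ a → NonNeg (k a)) → NonNeg (d >>= k)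
NonNeg->>= []        nk = []
NonNeg->>= (0≤p ∷ n) nk = ListAll.++⁺
  (ListAll.map⁺ (ListAll.map (0≤* 0≤p) (nk _))) (NonNeg->>= n nk)

Support->>= : {A B : Set} {P : A → Set} {Q : B → Set} {d : Dist A} {k : A → Dist B} →
  Support P d → (∀ a → P a → Support Q (k a)) → Support Q (d >>= k)
Support->>= []      sk = []
Support->>= (h ∷ s) sk = ListAll.++⁺ (ListAll.map⁺ (sk _ h)) (Support->>= s sk)

isProbability-return : {A : Set} (a : A) → IsProbability (return a)
isProbability-return a = record { nonneg = 0≤1 ∷ [] ; mass = E-return a (λ _ → 1ℚ) }

isProbability->>= : {A B : Set} {d : Dist A} {k : A → Dist B} →
  IsProbability d → (∀ a → IsProbability (k a)) → IsProbability (d >>= k)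
isProbability->>= {d = d} {k} pd pk = record
  { nonneg = NonNeg->>= (nonneg pd) (λ a → nonneg (pk a))
  ; mass   = trans (E->>= d k (λ _ → 1ℚ)) (trans (E-cong d (λ a → mass (pk a))) (mass pd))
  }

sumV prodV : {A : Set} {n : ℕ} → (A → ℚ) → Vec A n → ℚ
sumV  g []      = 0ℚ
sumV  g (a ∷ x) = g a + sumV g x
prodV g []      = 1ℚ
prodV g (a ∷ x) = g a * prodV g x

sumV-1 : {A : Set} {n : ℕ} (x : Vec A n) → sumV (λ _ → 1ℚ) x ≡ fromℕℚ n
sumV-1 []              = refl
sumV-1 {n = suc n} (a ∷ x) = trans (cong (λ s → 1ℚ + s) (sumV-1 x)) (sym (fromℕℚ-suc n))

E-uniform : {A : Set} (n : ℕ) (x : Vec A n) (g : A → ℚ) →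
  E (uniform n) (λ i → g (lookup x i)) ≡ recip (fromℕℚ n) * sumV g x
E-uniform n x g = go n x (λ i → i) (λ i → refl)
  where
  c = recip (fromℕℚ n)
  go : ∀ m (y : Vec _ m) (t : Fin m → Fin n) → (∀ i → g (lookup x (t i)) ≡ g (lookup y i)) →
    E (List.map (λ i → (i , c)) (List.tabulate t)) (λ i → g (lookup x i)) ≡ c * sumV g y
  go zero    []      t eq = sym (*-zeroʳ c)
  go (suc m) (a ∷ y) t eq = trans
    (cong₂ _+_ (cong (c *_) (eq zero)) (go m y (t ∘ suc) (λ i → eq (suc i))))
    (sym (*-distribˡ-+ c (g a) (sumV g y)))

recip-* : ∀ n → recip (fromℕℚ (suc n)) * fromℕℚ (suc n) ≡ 1ℚ
recip-* n = trans (*-comm (recip (fromℕℚ (suc n))) (fromℕℚ (suc n))) (*-recip (0<fromℕℚ-suc n))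

isProbability-uniform : ∀ n → IsProbability (uniform (suc n))
isProbability-uniform n = record
  { nonneg = ListAll.map⁺ (ListAll.universal (λ _ → <⇒≤ (0<recip (0<fromℕℚ-suc n))) (List.allFin (suc n)))
  ; mass   = trans (E-uniform (suc n) (Vec.allFin (suc n)) (λ _ → 1ℚ))
      (trans (cong (recip (fromℕℚ (suc n)) *_) (sumV-1 (Vec.allFin (suc n)))) (recip-* n))
  }

isProbability-independently : {A : Set} {d : Dist A} → IsProbability d → ∀ n →
  IsProbability (independently (Vec.replicate n d))
isProbability-independently pd zero    = isProbability-return []
isProbability-independently pd (suc n) = isProbability->>= pd λ a →
  isProbability->>= (isProbability-independently pd n) λ as → isProbability-return (a ∷ as)

module _ {A : Set} (d : Dist A) where
  private
    ds : ∀ n → Dist (Vec A n)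
    ds n = independently (Vec.replicate n d)

  E-independently-∷ : ∀ n (f : Vec A (suc n) → ℚ) →
    E (ds (suc n)) f ≡ E d (λ a → E (ds n) (λ as → f (a ∷ as)))
  E-independently-∷ n f = trans (E->>= d _ f) (E-cong d λ a →
    trans (E->>= (ds n) (λ as → return (a ∷ as)) f) (E-cong (ds n) λ as → E-return (a ∷ as) f))

  -- Independence of the nodes: the exponential moment of a round is a power of the moment at one
  -- node.
  E-prod : (g : A → ℚ) → ∀ n → E (ds n) (prodV g) ≡ E d g ^ n
  E-prod g zero    = E-return [] (prodV g)
  E-prod g (suc n) = trans (E-independently-∷ n (prodV g))
    (trans (E-cong d λ a → trans (E-* (g a) (prodV g) (ds n))
        (trans (cong (g a *_) (E-prod g n)) (*-comm (g a) (E d g ^ n))))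
      (trans (E-* (E d g ^ n) g d) (*-comm (E d g ^ n) (E d g))))

  E-sum : IsProbability d → (g : A → ℚ) → ∀ n → E (ds n) (sumV g) ≡ fromℕℚ n * E d g
  E-sum pd g zero    = trans (E-return [] (sumV g)) (sym (*-zeroˡ (E d g)))
  E-sum pd g (suc n) = trans (E-independently-∷ n (sumV g))
    (trans (E-cong d λ a → trans (E-+ (λ _ → g a) (sumV g) (ds n))
        (cong₂ _+_ (E-const (isProbability-independently pd n) (g a)) (E-sum pd g n)))
      (trans (E-+ g (λ _ → fromℕℚ n * E d g) d)
        (trans (cong (λ s → E d g + s) (E-const pd (fromℕℚ n * E d g)))
          (trans (solve 2 (λ e n → e :+ n :* e := (con 1ℚ :+ n) :* e) refl (E d g) (fromℕℚ n))
            (cong (_* E d g) (sym (fromℕℚ-suc n)))))))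

  Support-independently : {Q : A → Set} → Support Q d → ∀ n → Support (All Q) (ds n)
  Support-independently s zero    = [] ∷ []
  Support-independently s (suc n) = Support->>= s λ a qa →
    Support->>= (Support-independently s n) λ as qas → (qa ∷ qas) ∷ []

-- Powers and Bernoulli's inequality

^-mono : ∀ {p q} → 0ℚ ≤ p → p ≤ q → ∀ n → p ^ n ≤ q ^ n
^-mono         0≤p p≤q zero    = ≤-refl
^-mono {p} {q} 0≤p p≤q (suc n) =
  *-mono 0≤p (0≤^ (≤-trans 0≤p p≤q) n) p≤q (^-mono 0≤p p≤q n)

^-+ : ∀ p m n → p ^ (m ℕ.+ n) ≡ p ^ m * p ^ n
^-+ p zero    n = sym (*-identityˡ (p ^ n))
^-+ p (suc m) n = trans (cong (p *_) (^-+ p m n)) (sym (*-assoc p (p ^ m) (p ^ n)))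

^-* : ∀ p m n → p ^ (m ℕ.* n) ≡ (p ^ n) ^ m
^-* p zero    n = refl
^-* p (suc m) n = trans (^-+ p n (m ℕ.* n)) (cong (p ^ n *_) (^-* p m n))

1^ : ∀ n → 1ℚ ^ n ≡ 1ℚ
1^ zero    = refl
1^ (suc n) = trans (*-identityˡ (1ℚ ^ n)) (1^ n)

1≤^ : ∀ {p} → 1ℚ ≤ p → ∀ n → 1ℚ ≤ p ^ n
1≤^ {p} 1≤p n = subst (_≤ p ^ n) (1^ n) (^-mono 0≤1 1≤p n)

^≤1 : ∀ {p} → 0ℚ ≤ p → p ≤ 1ℚ → ∀ n → p ^ n ≤ 1ℚ
^≤1 {p} 0≤p p≤1 n = subst (p ^ n ≤_) (1^ n) (^-mono 0≤p p≤1 n)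

bernoulli : ∀ {h} → 0ℚ ≤ h → ∀ n → 1ℚ + fromℕℚ n * h ≤ (1ℚ + h) ^ n
bernoulli {h} 0≤h zero    = ≤-reflexive (trans (cong (λ q → 1ℚ + q) (*-zeroˡ h)) (+-identityʳ 1ℚ))
bernoulli {h} 0≤h (suc n) = ≤-trans
  (≤-by (fromℕℚ n * (h * h)) (0≤* (0≤fromℕℚ n) (0≤* 0≤h 0≤h))
    (trans (cong (λ m → 1ℚ + m * h + fromℕℚ n * (h * h)) (fromℕℚ-suc n))
      (solve 2 (λ n h → con 1ℚ :+ (con 1ℚ :+ n) :* h :+ n :* (h :* h) := (con 1ℚ :+ h) :* (con 1ℚ :+ n :* h))
        refl (fromℕℚ n) h)))
  (*-monoˡ (1ℚ + h) (0≤+ 0≤1 0≤h) (bernoulli 0≤h n))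

bernoulli⁻ : ∀ {h} → 0ℚ ≤ h → h ≤ 1ℚ → ∀ n → 1ℚ - fromℕℚ n * h ≤ (1ℚ - h) ^ n
bernoulli⁻ {h} 0≤h h≤1 zero    = ≤-reflexive (trans (cong (λ q → 1ℚ - q) (*-zeroˡ h)) (+-identityʳ 1ℚ))
bernoulli⁻ {h} 0≤h h≤1 (suc n) = ≤-trans
  (≤-by (fromℕℚ n * (h * h)) (0≤* (0≤fromℕℚ n) (0≤* 0≤h 0≤h))
    (trans (cong (λ m → 1ℚ - m * h + fromℕℚ n * (h * h)) (fromℕℚ-suc n))
      (solve 2 (λ n h → con 1ℚ :- (con 1ℚ :+ n) :* h :+ n :* (h :* h) := (con 1ℚ :- h) :* (con 1ℚ :- n :* h))
        refl (fromℕℚ n) h)))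
  (*-monoˡ (1ℚ - h) (0≤q-p h≤1) (bernoulli⁻ 0≤h h≤1 n))

recip≤1 : ∀ {p} → 1ℚ ≤ p → recip p ≤ 1ℚ
recip≤1 = recip-≤ {r = 1ℚ} 0<1

-- The classical argument by Bernoulli: the quotient of the two bases is 1 - `w` with `k` * `w` = 1
-- - 1/`X`, so its `k`-th power is at least 1/`X`, which is the factor to be made up.
1+a/n≤ : ∀ {a} → 0ℚ ≤ a → ∀ n →
  (1ℚ + a * recip (fromℕℚ (suc n))) ^ suc n ≤ (1ℚ + a * recip (fromℕℚ (suc (suc n)))) ^ suc (suc n)
1+a/n≤ {a} 0≤a n = subst₂ _≤_ eq₁ eq₂
  (*-monoˡ (X ^ suc (suc n)) (0≤^ 0≤X (suc (suc n))) (bernoulli⁻ 0≤w w≤1 (suc (suc n))))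
  where
  m = fromℕℚ (suc n)
  k = fromℕℚ (suc (suc n))
  h = recip m
  l = recip k
  X = 1ℚ + a * h
  Y = 1ℚ + a * l
  r = recip X
  w = (1ℚ - r) * l
  0≤h : 0ℚ ≤ h
  0≤h = <⇒≤ (0<recip (0<fromℕℚ-suc n))
  0≤l : 0ℚ ≤ l
  0≤l = <⇒≤ (0<recip (0<fromℕℚ-suc (suc n)))
  1≤X : 1ℚ ≤ X
  1≤X = ≤-by (a * h) (0≤* 0≤a 0≤h) refl
  0<X = <-≤-trans 0<1 1≤X
  0≤X = <⇒≤ 0<X
  l≤1 : l ≤ 1ℚ
  l≤1 = recip≤1 (fromℕℚ-mono {1} {suc (suc n)} (ℕ.s≤s ℕ.z≤n))
  0≤w : 0ℚ ≤ w
  0≤w = 0≤* (0≤q-p (recip≤1 1≤X)) 0≤l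
  w≤1 : w ≤ 1ℚ
  w≤1 = *-mono {1ℚ - r} {1ℚ} (0≤q-p (recip≤1 1≤X)) 0≤1
    (≤-by r (<⇒≤ (0<recip 0<X)) (solve 1 (λ r → (con 1ℚ :- r) :+ r := con 1ℚ) refl r)) l≤1
  mh : m * h ≡ 1ℚ
  mh = *-recip (0<fromℕℚ-suc n)
  kl : k * l ≡ 1ℚ
  kl = *-recip (0<fromℕℚ-suc (suc n))
  Xr : X * r ≡ 1ℚ
  Xr = *-recip 0<X
  km : k ≡ 1ℚ + m
  km = fromℕℚ-suc (suc n)
  eq₁ : X ^ suc (suc n) * (1ℚ - k * w) ≡ X ^ suc n
  eq₁ = trans (solve 5 (λ X P k r l → (X :* P) :* (con 1ℚ :- k :* ((con 1ℚ :- r) :* l))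
        := P :* (X :- (k :* l) :* (X :- X :* r))) refl X (X ^ suc n) k r l)
    (trans (cong₂ (λ u v → X ^ suc n * (X - u * (X - v))) kl Xr)
      (solve 2 (λ X P → P :* (X :- con 1ℚ :* (X :- con 1ℚ)) := P) refl X (X ^ suc n)))
  XY : X * (1ℚ - w) ≡ Y
  XY = trans (solve 3 (λ X r l → X :* (con 1ℚ :- (con 1ℚ :- r) :* l) := X :- (X :- X :* r) :* l) refl X r l)
    (trans (cong (λ v → X - (X - v) * l) Xr)
    (trans (solve 3 (λ a h l → (con 1ℚ :+ a :* h) :- ((con 1ℚ :+ a :* h) :- con 1ℚ) :* l
        := con 1ℚ :+ a :* (h :* (con 1ℚ :- l))) refl a h l)
      (cong (λ v → 1ℚ + a * v) (trans (cong (λ u → h * (u - l)) (sym kl))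
        (trans (cong (λ u → h * (u * l - l)) km)
          (trans (solve 3 (λ h m l → h :* ((con 1ℚ :+ m) :* l :- l) := (m :* h) :* l) refl h m l)
            (trans (cong (_* l) mh) (*-identityˡ l))))))))
  eq₂ : X ^ suc (suc n) * (1ℚ - w) ^ suc (suc n) ≡ Y ^ suc (suc n)
  eq₂ = trans (sym (*-^ X (1ℚ - w) (suc (suc n)))) (cong (_^ suc (suc n)) XY)

-- With a = tD the two sides agree at `e` = 0, and every step of `e` moves along the increasing
-- sequence (1 + a/m)^m.
^≤1+a/n : ∀ {t} → 0ℚ ≤ t → ∀ D e →
  (1ℚ + t) ^ D ≤ (1ℚ + t * fromℕℚ D * recip (fromℕℚ (e ℕ.+ D))) ^ (e ℕ.+ D)
^≤1+a/n {t} 0≤t zero    e       = 1≤^ (≤-by (t * 0ℚ * r) (≤-reflexive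
    (solve 2 (λ t r → con 0ℚ := t :* con 0ℚ :* r) refl t r)) refl) (e ℕ.+ 0)
  where r = recip (fromℕℚ (e ℕ.+ 0))
^≤1+a/n {t} 0≤t (suc D) zero    = ≤-reflexive (cong (λ q → (1ℚ + q) ^ suc D)
  (sym (trans (*-assoc t (fromℕℚ (suc D)) _) (trans (cong (t *_) (*-recip (0<fromℕℚ-suc D))) (*-identityʳ t)))))
^≤1+a/n {t} 0≤t (suc D) (suc e) = ≤-trans (^≤1+a/n 0≤t (suc D) e)
  (subst (λ m → (1ℚ + a * recip (fromℕℚ m)) ^ m ≤ (1ℚ + a * recip (fromℕℚ (suc m))) ^ suc m)
    (sym (ℕ.+-suc e D)) (1+a/n≤ (0≤* 0≤t (0≤fromℕℚ (suc D))) (e ℕ.+ D)))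
  where a = t * fromℕℚ (suc D)

-- Weighted AM-GM for D copies of 1+t and n-D copies of 1.
^-amgm : ∀ {t τ n D} → 0ℚ ≤ t → D ℕ.≤ suc n → fromℕℚ D ≤ fromℕℚ (suc n) * τ →
  (1ℚ + t) ^ D ≤ (1ℚ + t * τ) ^ suc n
^-amgm {t} {τ} {n} {D} 0≤t D≤n D≤nτ = ≤-trans
  (subst (λ m → (1ℚ + t) ^ D ≤ (1ℚ + t * fromℕℚ D * recip (fromℕℚ m)) ^ m)
    (ℕ.m∸n+n≡m D≤n) (^≤1+a/n 0≤t D (suc n ℕ.∸ D)))
  (^-mono (0≤+ 0≤1 (0≤* (0≤* 0≤t (0≤fromℕℚ D)) 0≤r))
    (+-monoʳ-≤ 1ℚ (subst₂ _≤_ (sym (*-assoc t (fromℕℚ D) r)) (cong (t *_) eq)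
      (*-monoˡ t 0≤t (*-monoʳ r 0≤r D≤nτ)))) (suc n))
  where
  r = recip (fromℕℚ (suc n))
  0≤r = <⇒≤ (0<recip (0<fromℕℚ-suc n))
  eq : fromℕℚ (suc n) * τ * r ≡ τ
  eq = trans (solve 3 (λ n τ r → n :* τ :* r := (n :* r) :* τ) refl (fromℕℚ (suc n)) τ r)
    (trans (cong (_* τ) (*-recip (0<fromℕℚ-suc n))) (*-identityˡ τ))

+-cancelˡ-≤ : ∀ p {q r} → p + q ≤ p + r → q ≤ r
+-cancelˡ-≤ p {q} {r} h = ≤-by ((p + r) - (p + q)) (0≤q-p h)
  (solve 3 (λ p q r → q :+ ((p :+ r) :- (p :+ q)) := r) refl p q r)

-- The law of one round

δ : {k : ℕ} → Fin k → Fin k → ℚ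
δ j i = if does (i Fin.≟ j) then 1ℚ else 0ℚ

δ-same : {k : ℕ} (j : Fin k) → δ j j ≡ 1ℚ
δ-same j with j Fin.≟ j
... | yes _   = refl
... | no  j≢j = ⊥-elim (j≢j refl)

δ-diff : {k : ℕ} {i j : Fin k} → i ≢ j → δ j i ≡ 0ℚ
δ-diff {i = i} {j} i≢j with i Fin.≟ j
... | yes i≡j = ⊥-elim (i≢j i≡j)
... | no  _   = refl

0≤δ : {k : ℕ} (j i : Fin k) → 0ℚ ≤ δ j i
0≤δ j i with i Fin.≟ j
... | yes _ = 0≤1
... | no  _ = ≤-refl

δ≤1 : {k : ℕ} (j i : Fin k) → δ j i ≤ 1ℚ
δ≤1 j i with i Fin.≟ j
... | yes _ = ≤-refl
... | no  _ = 0≤1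

-- The first sample is the default: a pair that contains it elects it, and so does a three-way tie.
-- Only agreement of the other two can override it. This makes every function of the majority affine
-- in `δ b c`.
majority-if : {k : ℕ} (a b c : Fin k) → majority a b c ≡ (if does (b Fin.≟ c) then b else a)
majority-if a b c with a Fin.≟ b | a Fin.≟ c | b Fin.≟ c
... | yes refl | yes refl | yes _   = refl
... | yes refl | yes refl | no  _   = refl
... | yes refl | no _     | yes _   = refl
... | yes refl | no _     | no  _   = refl
... | no _     | yes refl | yes b≡a = sym b≡a
... | no _     | yes refl | no  _   = refl
... | no _     | no _     | yes _   = refl
... | no _     | no _     | no  _   = refl

majority-split : {k : ℕ} (g : Fin k → ℚ) (a b c : Fin k) →
  g (majority a b c) ≡ g a + (g b - g a) * δ b c
majority-split g a b c = trans (cong g (majority-if a b c)) split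
  where
  split : g (if does (b Fin.≟ c) then b else a) ≡ g a + (g b - g a) * δ b c
  split with b Fin.≟ c
  ... | yes refl = trans (solve 2 (λ u v → v := u :+ (v :- u) :* con 1ℚ) refl (g a) (g b))
    (cong (λ e → g a + (g b - g a) * e) (sym (δ-same b)))
  ... | no b≢c = trans (solve 2 (λ u v → u := u :+ (v :- u) :* con 0ℚ) refl (g a) (g b))
    (cong (λ e → g a + (g b - g a) * e) (sym (δ-diff (λ c≡b → b≢c (sym c≡b)))))

module _ {k n : ℕ} (x : Colouring k (suc n)) where

  avg : (Fin k → ℚ) → ℚ
  avg g = E (uniform (suc n)) (λ i → g (lookup x i))

  freq : Fin k → ℚ
  freq j = avg (δ j)

  -- This is Σ f_h²: averaging the frequency over nodes weights each colour by its own frequency and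
  -- avoids sums over colours.
  collision : ℚ
  collision = avg freq

  private
    U = uniform (suc n)
    pU = isProbability-uniform n

  avg-cong : {f g : Fin k → ℚ} → (∀ a → f a ≡ g a) → avg f ≡ avg g
  avg-cong eq = E-cong U (λ i → eq (lookup x i))

  avg-mono : (f g : Fin k → ℚ) → (∀ i → f (lookup x i) ≤ g (lookup x i)) → avg f ≤ avg g
  avg-mono f g h = E-mono (nonneg pU) h

  avg-const : ∀ c → avg (λ _ → c) ≡ c
  avg-const = E-const pU

  avg-affine : ∀ c d (f g : Fin k → ℚ) → avg (λ a → c * f a + d * g a) ≡ c * avg f + d * avg g
  avg-affine c d f g = trans
    (E-+ (λ i → c * f (lookup x i)) (λ i → d * g (lookup x i)) U)
    (cong₂ _+_ (E-* c (λ i → f (lookup x i)) U) (E-* d (λ i → g (lookup x i)) U))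

  0≤freq : ∀ j → 0ℚ ≤ freq j
  0≤freq j = subst (_≤ freq j) (avg-const 0ℚ) (avg-mono (λ _ → 0ℚ) (δ j) (λ i → 0≤δ j (lookup x i)))

  freq≤1 : ∀ j → freq j ≤ 1ℚ
  freq≤1 j = subst (freq j ≤_) (avg-const 1ℚ) (avg-mono (δ j) (λ _ → 1ℚ) (λ i → δ≤1 j (lookup x i)))

  0≤collision : 0ℚ ≤ collision
  0≤collision = subst (_≤ collision) (avg-const 0ℚ) (avg-mono (λ _ → 0ℚ) freq (λ i → 0≤freq (lookup x i)))

  collision≤1 : collision ≤ 1ℚ
  collision≤1 = subst (collision ≤_) (avg-const 1ℚ) (avg-mono freq (λ _ → 1ℚ) (λ i → freq≤1 (lookup x i)))

  -- For each colour b the two later samples are both b with probability f_b². So the first sample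
  -- is overridden with total probability `collision x`, and the remaining average is Σ f_b² g(b).
  E-recolour : ∀ g → E (recolour x) g ≡ avg g + (avg (λ b → freq b * g b) - collision * avg g)
  E-recolour g = trans (E->>= U (λ u → U >>= λ v → U >>= λ w → return (majority (lookup x u) (lookup x v) (lookup x w))) g) (trans (E-cong U λ u → inner₁ (lookup x u)) outer)
    where
    inner₂ : ∀ a b → E U (λ w → g (majority a b (lookup x w))) ≡ g a + (g b - g a) * freq b
    inner₂ a b = trans (E-cong U λ w → majority-split g a b (lookup x w))
      (trans (E-+ (λ _ → g a) (λ w → (g b - g a) * δ b (lookup x w)) U)
        (cong₂ _+_ (avg-const (g a)) (E-* (g b - g a) (λ w → δ b (lookup x w)) U)))
    inner₁ : ∀ a → E (U >>= λ v → U >>= λ w → return (majority a (lookup x v) (lookup x w))) g ≡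
      g a + (avg (λ b → freq b * g b) - collision * g a)
    inner₁ a = trans (E->>= U (λ v → U >>= λ w → return (majority a (lookup x v) (lookup x w))) g)
      (trans (E-cong U λ v → trans (E->>= U (λ w → return (majority a (lookup x v) (lookup x w))) g)
          (trans (E-cong U λ w → E-return (majority a (lookup x v) (lookup x w)) g)
            (trans (inner₂ a (lookup x v))
              (solve 3 (λ u v f → u :+ (v :- u) :* f := u :+ (con 1ℚ :* (f :* v) :+ (:- u) :* f))
                refl (g a) (g (lookup x v)) (freq (lookup x v))))))
        (trans (E-+ (λ _ → g a) (λ v → 1ℚ * (freq (lookup x v) * g (lookup x v)) + (- g a) * freq (lookup x v)) U)
          (trans (cong₂ _+_ (avg-const (g a)) (avg-affine 1ℚ (- g a) (λ b → freq b * g b) freq))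
            (solve 3 (λ u q s → u :+ (con 1ℚ :* q :+ (:- u) :* s) := u :+ (q :- s :* u))
              refl (g a) (avg (λ b → freq b * g b)) collision))))
    Q = avg (λ b → freq b * g b)
    outer : E U (λ u → g (lookup x u) + (Q - collision * g (lookup x u))) ≡ avg g + (Q - collision * avg g)
    outer = trans (avg-cong (λ a → solve 3 (λ u q s → u :+ (q :- s :* u) := (con 1ℚ :- s) :* u :+ q :* con 1ℚ)
        refl (g a) Q collision))
      (trans (avg-affine (1ℚ - collision) Q g (λ _ → 1ℚ))
        (trans (cong (λ e → (1ℚ - collision) * avg g + Q * e) (avg-const 1ℚ))
          (solve 3 (λ u q s → (con 1ℚ :- s) :* u :+ q :* con 1ℚ := u :+ (q :- s :* u))
            refl (avg g) Q collision)))

  freq*δ : ∀ j b → freq b * δ j b ≡ freq j * δ j b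
  freq*δ j b with b Fin.≟ j
  ... | yes refl = refl
  ... | no  _    = trans (*-zeroʳ (freq b)) (sym (*-zeroʳ (freq j)))

  E-recolour-δ : ∀ j → E (recolour x) (δ j) ≡ freq j * (1ℚ + freq j - collision)
  E-recolour-δ j = trans (E-recolour (δ j))
    (trans (cong (λ e → freq j + (e - collision * freq j))
        (trans (avg-cong (freq*δ j)) (E-* (freq j) (λ i → δ j (lookup x i)) U)))
      (solve 2 (λ f s → f :+ (f :* f :- s :* f) := f :* (con 1ℚ :+ f :- s)) refl (freq j) collision))

  freq-sumV : ∀ j → fromℕℚ (suc n) * freq j ≡ sumV (δ j) x
  freq-sumV j = trans (cong (fromℕℚ (suc n) *_) (E-uniform (suc n) x (δ j)))
    (trans (sym (*-assoc (fromℕℚ (suc n)) (recip (fromℕℚ (suc n))) (sumV (δ j) x)))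
      (trans (cong (_* sumV (δ j) x) (*-recip (0<fromℕℚ-suc n))) (*-identityˡ (sumV (δ j) x))))

  Present : Fin k → Set
  Present a = ∃ λ i → lookup x i ≡ a

  -- Extinct colours never return; hence the nodes of the current round index all rivals of the next
  -- one.
  Support-recolour : Support Present (recolour x)
  Support-recolour =
    Support->>= (always-support U) λ u _ →
    Support->>= (always-support U) λ v _ →
    Support->>= (always-support U) λ w _ →
    subst Present (sym (majority-if (lookup x u) (lookup x v) (lookup x w)))
      (present u v (does (lookup x v Fin.≟ lookup x w))) ∷ []
    where
    always-support : ∀ {A : Set} (d : Dist A) → Support (λ _ → ⊤) d
    always-support = ListAll.universal (λ _ → tt)
    present : ∀ u v b → Present (if b then lookup x v else lookup x u)
    present u v true  = v , refl
    present u v false = u , refl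

  isProbability-recolour : IsProbability (recolour x)
  isProbability-recolour = isProbability->>= pU λ u → isProbability->>= pU λ v →
    isProbability->>= pU λ w → isProbability-return _

  isProbability-majorityRound : IsProbability (majorityRound x)
  isProbability-majorityRound = isProbability-independently isProbability-recolour (suc n)

  E-freq : ∀ j → E (majorityRound x) (sumV (δ j)) ≡ fromℕℚ (suc n) * (freq j * (1ℚ + freq j - collision))
  E-freq j = trans (E-sum (recolour x) isProbability-recolour (δ j) (suc n))
    (cong (fromℕℚ (suc n) *_) (E-recolour-δ j))

-- Exponential moments

fromℕℚ-+ : ∀ m n → fromℕℚ (m ℕ.+ n) ≡ fromℕℚ m + fromℕℚ n
fromℕℚ-+ zero    n = sym (+-identityˡ (fromℕℚ n))
fromℕℚ-+ (suc m) n = trans (fromℕℚ-suc (m ℕ.+ n)) (trans (cong (λ q → 1ℚ + q) (fromℕℚ-+ m n))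
  (trans (sym (+-assoc 1ℚ (fromℕℚ m) (fromℕℚ n))) (cong (_+ fromℕℚ n) (sym (fromℕℚ-suc m)))))

½^*2^ : ∀ D → ½ ^ D * fromℕℚ 2 ^ D ≡ 1ℚ
½^*2^ D = trans (sym (*-^ ½ (fromℕℚ 2) D)) (1^ D)

-- A rational substitute for (1-h)^m ≤ e^(-mh): the powers of 1-h and 1+h multiply to at most 1, and
-- `^-amgm` with t = 1 bounds the latter from below by 2^D.
1-h^≤½^ : ∀ {h n D} → 0ℚ ≤ h → h ≤ 1ℚ → D ℕ.≤ suc n → fromℕℚ D ≤ fromℕℚ (suc n) * h →
  (1ℚ - h) ^ suc n ≤ ½ ^ D
1-h^≤½^ {h} {n} {D} 0≤h h≤1 D≤n D≤nh = subst₂ _≤_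
  (trans (*-assoc a (½ ^ D) (fromℕℚ 2 ^ D)) (trans (cong (a *_) (½^*2^ D)) (*-identityʳ a)))
  (*-identityˡ (½ ^ D))
  (≤-trans (subst₂ _≤_ refl (solve 3 (λ a b c → (a :* c) :* b := (a :* b) :* c) refl a b (½ ^ D))
      (*-monoˡ (a * ½ ^ D) (0≤* 0≤a 0≤½) 2≤b))
    (*-monoʳ (½ ^ D) 0≤½ ab≤1))
  where
  a = (1ℚ - h) ^ suc n
  b = (1ℚ + h) ^ suc n
  0≤½ : 0ℚ ≤ ½ ^ D
  0≤½ = 0≤^ (<⇒≤ 0<½) D
  0≤a : 0ℚ ≤ a
  0≤a = 0≤^ (0≤q-p h≤1) (suc n)
  2≤b : fromℕℚ 2 ^ D ≤ b
  2≤b = subst (λ q → fromℕℚ 2 ^ D ≤ (1ℚ + q) ^ suc n) (*-identityˡ h)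
    (^-amgm {1ℚ} {h} {n} {D} 0≤1 D≤n D≤nh)
  ab≤1 : a * b ≤ 1ℚ
  ab≤1 = subst (_≤ 1ℚ) (*-^ (1ℚ - h) (1ℚ + h) (suc n))
    (^≤1 (0≤* (0≤q-p h≤1) (0≤+ 0≤1 0≤h))
      (≤-by (h * h) (0≤* 0≤h 0≤h)
        (solve 1 (λ h → (con 1ℚ :- h) :* (con 1ℚ :+ h) :+ h :* h := con 1ℚ) refl h)) (suc n))

-- Since 1/(1+t) ≤ 1 - t + t², the mean tilt is at most 1 - t(γ+τ) + t²P. The factor 1+tτ cancels tτ
-- to first order, and the products that remain are nonpositive because tP ≤ γ.
tilt-bound : ∀ {t r P Q τ γ} → 0ℚ ≤ t → r * (1ℚ + t) ≡ 1ℚ → 0ℚ ≤ P → 0ℚ ≤ τ →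
  γ ≤ P - Q - τ → t * P ≤ γ →
  (1ℚ + t * τ) * (1ℚ + ((r - 1ℚ) * P + t * Q)) ≤ 1ℚ - (t * γ - t * t * P)
tilt-bound {t} {r} {P} {Q} {τ} {γ} 0≤t rt 0≤P 0≤τ γ≤ tP≤γ = ≤-trans
  (*-monoˡ (1ℚ + t * τ) (0≤+ 0≤1 0≤tτ) (+-monoʳ-≤ 1ℚ step₁))
  (≤-by ((t * τ) * (t * τ) + t * (γ - t * P) * (t * τ))
    (0≤+ (0≤* 0≤tτ 0≤tτ) (0≤* (0≤* 0≤t (0≤q-p tP≤γ)) 0≤tτ))
    (solve 4 (λ t τ γ P → (con 1ℚ :+ t :* τ) :* (con 1ℚ :+ (t :* t :* P :- t :* (γ :+ τ)))
        :+ ((t :* τ) :* (t :* τ) :+ t :* (γ :- t :* P) :* (t :* τ))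
        := con 1ℚ :- (t :* γ :- t :* t :* P)) refl t τ γ P))
  where
  0≤tτ = 0≤* 0≤t 0≤τ
  0≤1+t = 0≤+ 0≤1 0≤t
  0<1+t : 0ℚ < 1ℚ + t
  0<1+t = <-≤-trans 0<1 (≤-by t 0≤t refl)
  r≤ : r ≤ 1ℚ - t + t * t
  r≤ = *-cancelˡ-≤ (1ℚ + t) 0<1+t (subst (_≤ (1ℚ + t) * (1ℚ - t + t * t))
    (sym (trans (*-comm (1ℚ + t) r) rt))
    (≤-by (t * (t * t)) (0≤* 0≤t (0≤* 0≤t 0≤t))
      (solve 1 (λ t → con 1ℚ :+ t :* (t :* t) := (con 1ℚ :+ t) :* (con 1ℚ :- t :+ t :* t)) refl t)))
  step₁ : (r - 1ℚ) * P + t * Q ≤ t * t * P - t * (γ + τ)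
  step₁ = ≤-by ((1ℚ - t + t * t - r) * P + t * (P - Q - τ - γ))
    (0≤+ (0≤* (0≤q-p r≤) 0≤P) (0≤* 0≤t (0≤q-p γ≤)))
    (solve 6 (λ t r P Q τ γ → (r :- con 1ℚ) :* P :+ t :* Q :+
        ((con 1ℚ :- t :+ t :* t :- r) :* P :+ t :* (P :- Q :- τ :- γ))
        := t :* t :* P :- t :* (γ :+ τ)) refl t r P Q τ γ)

data Disjoint (p q : ℚ) : Set where
  left  : p ≡ 1ℚ → q ≡ 0ℚ → Disjoint p q
  right : p ≡ 0ℚ → q ≡ 1ℚ → Disjoint p q
  none  : p ≡ 0ℚ → q ≡ 0ℚ → Disjoint p q

module Chernoff {A : Set} {w v : A → ℚ} (disjoint : ∀ a → Disjoint (w a) (v a))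
  {t τ : ℚ} (0≤t : 0ℚ ≤ t) (0≤τ : 0ℚ ≤ τ) (n : ℕ) where

  r : ℚ
  r = recip (1ℚ + t)

  -- On the values that `disjoint` admits this is (1+t)^(v-w), the rational counterpart of
  -- e^(t(v-w)). Written as an affine function, its mean depends only on the means of `w` and `v`.
  tilt : A → ℚ
  tilt a = 1ℚ + ((r - 1ℚ) * w a + t * v a)

  -- The prefactor stands for e^(tτm) over the m nodes in Markov's inequality for the exponential
  -- moment.
  potential : Vec A (suc n) → ℚ
  potential y = (1ℚ + t * τ) ^ suc n * prodV tilt y

  private
    0<1+t : 0ℚ < 1ℚ + t
    0<1+t = <-≤-trans 0<1 (≤-by t 0≤t refl)
    0≤1+t = <⇒≤ 0<1+t
    0<r : 0ℚ < r
    0<r = 0<recip 0<1+t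
    0≤r = <⇒≤ 0<r
    rt : r * (1ℚ + t) ≡ 1ℚ
    rt = trans (*-comm r (1ℚ + t)) (*-recip 0<1+t)
    0≤1+tτ : 0ℚ ≤ 1ℚ + t * τ
    0≤1+tτ = 0≤+ 0≤1 (0≤* 0≤t 0≤τ)

    tilt-left : ∀ a → w a ≡ 1ℚ → v a ≡ 0ℚ → tilt a ≡ r
    tilt-left a p q = trans (cong₂ (λ p q → 1ℚ + ((r - 1ℚ) * p + t * q)) p q)
      (solve 2 (λ r t → con 1ℚ :+ ((r :- con 1ℚ) :* con 1ℚ :+ t :* con 0ℚ) := r) refl r t)
    tilt-right : ∀ a → w a ≡ 0ℚ → v a ≡ 1ℚ → tilt a ≡ 1ℚ + t
    tilt-right a p q = trans (cong₂ (λ p q → 1ℚ + ((r - 1ℚ) * p + t * q)) p q)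
      (solve 2 (λ r t → con 1ℚ :+ ((r :- con 1ℚ) :* con 0ℚ :+ t :* con 1ℚ) := con 1ℚ :+ t) refl r t)
    tilt-none : ∀ a → w a ≡ 0ℚ → v a ≡ 0ℚ → tilt a ≡ 1ℚ
    tilt-none a p q = trans (cong₂ (λ p q → 1ℚ + ((r - 1ℚ) * p + t * q)) p q)
      (solve 2 (λ r t → con 1ℚ :+ ((r :- con 1ℚ) :* con 0ℚ :+ t :* con 0ℚ) := con 1ℚ) refl r t)

    0≤tilt : ∀ a → 0ℚ ≤ tilt a
    0≤tilt a with disjoint a
    ... | left  p q = subst (0ℚ ≤_) (sym (tilt-left a p q)) 0≤r
    ... | right p q = subst (0ℚ ≤_) (sym (tilt-right a p q)) 0≤1+t
    ... | none  p q = subst (0ℚ ≤_) (sym (tilt-none a p q)) 0≤1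

    record Counts {m} (y : Vec A m) : Set where
      field
        a b   : ℕ
        sum-w : sumV w y ≡ fromℕℚ a
        sum-v : sumV v y ≡ fromℕℚ b
        a≤m   : a ℕ.≤ m
        prod  : prodV tilt y ≡ r ^ a * (1ℚ + t) ^ b

    counts-of : ∀ {m} (y : Vec A m) → Counts y
    counts-of []      = record { a = 0 ; b = 0 ; sum-w = refl ; sum-v = refl ; a≤m = ℕ.z≤n ; prod = refl }
    counts-of (c ∷ y) with counts-of y | disjoint c
    ... | record { a = a ; b = b ; sum-w = sw ; sum-v = sv ; a≤m = a≤m ; prod = pr } | left p q = record
      { a = suc a ; b = b
      ; sum-w = trans (cong₂ _+_ p sw) (sym (fromℕℚ-suc a))
      ; sum-v = trans (cong₂ _+_ q sv) (+-identityˡ (fromℕℚ b))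
      ; a≤m = ℕ.s≤s a≤m
      ; prod = trans (cong₂ _*_ (tilt-left c p q) pr) (sym (*-assoc r (r ^ a) ((1ℚ + t) ^ b))) }
    ... | record { a = a ; b = b ; sum-w = sw ; sum-v = sv ; a≤m = a≤m ; prod = pr } | right p q = record
      { a = a ; b = suc b
      ; sum-w = trans (cong₂ _+_ p sw) (+-identityˡ (fromℕℚ a))
      ; sum-v = trans (cong₂ _+_ q sv) (sym (fromℕℚ-suc b))
      ; a≤m = ℕ.m≤n⇒m≤1+n a≤m
      ; prod = trans (cong₂ _*_ (tilt-right c p q) pr)
          (solve 3 (λ u x y → u :* (x :* y) := x :* (u :* y)) refl (1ℚ + t) (r ^ a) ((1ℚ + t) ^ b)) }
    ... | record { a = a ; b = b ; sum-w = sw ; sum-v = sv ; a≤m = a≤m ; prod = pr } | none p q = record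
      { a = a ; b = b
      ; sum-w = trans (cong₂ _+_ p sw) (+-identityˡ (fromℕℚ a))
      ; sum-v = trans (cong₂ _+_ q sv) (+-identityˡ (fromℕℚ b))
      ; a≤m = ℕ.m≤n⇒m≤1+n a≤m
      ; prod = trans (cong₂ _*_ (tilt-none c p q) pr) (*-identityˡ (r ^ a * (1ℚ + t) ^ b)) }

    cancel : ∀ a → r ^ a * (1ℚ + t) ^ a ≡ 1ℚ
    cancel a = trans (sym (*-^ r (1ℚ + t) a)) (trans (cong (_^ a) rt) (1^ a))

  0≤potential : ∀ y → 0ℚ ≤ potential y
  0≤potential y = 0≤* (0≤^ 0≤1+tτ (suc n)) (subst (0ℚ ≤_) (sym (Counts.prod c))
    (0≤* (0≤^ 0≤r (Counts.a c)) (0≤^ 0≤1+t (Counts.b c))))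
    where c = counts-of y

  -- With `a` and `b` the two counts, the product of the tilts is (1+t)^(b-a). This can fall below 1
  -- only for a > b, and then the deficit a-b is at most τ times the number of nodes, so `^-amgm`
  -- lets the prefactor compensate it.
  1≤potential : ∀ y → sumV w y ≤ sumV v y + fromℕℚ (suc n) * τ → 1ℚ ≤ potential y
  1≤potential y h = subst (λ z → 1ℚ ≤ (1ℚ + t * τ) ^ suc n * z) (sym prod) (bound (ℕ.≤-total a b))
    where
    open Counts (counts-of y)
    1≤K : 1ℚ ≤ (1ℚ + t * τ) ^ suc n
    1≤K = 1≤^ (≤-by (t * τ) (0≤* 0≤t 0≤τ) refl) (suc n)
    bound : a ℕ.≤ b ⊎ b ℕ.≤ a → 1ℚ ≤ (1ℚ + t * τ) ^ suc n * (r ^ a * (1ℚ + t) ^ b)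
    bound (inj₁ a≤b) = *-mono {1ℚ} {_} {1ℚ} 0≤1 (0≤* (0≤^ 0≤r a) (0≤^ 0≤1+t b)) 1≤K
      (subst (1ℚ ≤_) (sym eq) (1≤^ (≤-by t 0≤t refl) (b ℕ.∸ a)))
      where
      eq : r ^ a * (1ℚ + t) ^ b ≡ (1ℚ + t) ^ (b ℕ.∸ a)
      eq = trans (cong (λ m → r ^ a * (1ℚ + t) ^ m) (sym (ℕ.m+[n∸m]≡n a≤b)))
        (trans (cong (r ^ a *_) (^-+ (1ℚ + t) a (b ℕ.∸ a)))
        (trans (sym (*-assoc (r ^ a) ((1ℚ + t) ^ a) _))
        (trans (cong (_* (1ℚ + t) ^ (b ℕ.∸ a)) (cancel a)) (*-identityˡ ((1ℚ + t) ^ (b ℕ.∸ a))))))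
    bound (inj₂ b≤a) = subst (_≤ (1ℚ + t * τ) ^ suc n * (r ^ a * (1ℚ + t) ^ b)) eq
      (*-monoʳ (r ^ a * (1ℚ + t) ^ b) (0≤* (0≤^ 0≤r a) (0≤^ 0≤1+t b))
        (^-amgm 0≤t (ℕ.≤-trans (ℕ.m∸n≤m a b) a≤m) D≤))
      where
      D = a ℕ.∸ b
      b+D : b ℕ.+ D ≡ a
      b+D = ℕ.m+[n∸m]≡n b≤a
      D≤ : fromℕℚ D ≤ fromℕℚ (suc n) * τ
      D≤ = +-cancelˡ-≤ (fromℕℚ b) (subst₂ _≤_
        (trans sum-w (trans (cong fromℕℚ (sym b+D)) (fromℕℚ-+ b D)))
        (cong (_+ fromℕℚ (suc n) * τ) sum-v) h)
      eq : (1ℚ + t) ^ D * (r ^ a * (1ℚ + t) ^ b) ≡ 1ℚ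
      eq = trans (solve 3 (λ x y z → x :* (y :* z) := y :* (z :* x)) refl ((1ℚ + t) ^ D) (r ^ a) ((1ℚ + t) ^ b))
        (trans (cong (r ^ a *_) (trans (sym (^-+ (1ℚ + t) b D)) (cong ((1ℚ + t) ^_) b+D))) (cancel a))

  -- The expectation is a power of the one-node factor, which `tilt-bound` puts below 1 - h; `D` is
  -- the number of halvings that this pays for.
  E-potential : ∀ {d : Dist A} {γ h D} → IsProbability d →
    γ ≤ E d w - E d v - τ → t * E d w ≤ γ → h ≤ t * γ - t * t * E d w →
    0ℚ ≤ h → h ≤ 1ℚ → D ℕ.≤ suc n → fromℕℚ D ≤ fromℕℚ (suc n) * h →
    E (independently (Vec.replicate (suc n) d)) potential ≤ ½ ^ D
  E-potential {d} {γ} {h} {D} pd γ≤ tP≤γ h≤ 0≤h h≤1 D≤n D≤nh =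
    subst (_≤ ½ ^ D) (sym eq)
      (≤-trans (^-mono (0≤* 0≤1+tτ 0≤Etilt) (≤-trans factor
          (+-monoʳ-≤ 1ℚ (neg-antimono-≤ h≤))) (suc n))
        (1-h^≤½^ {h} {n} {D} 0≤h h≤1 D≤n D≤nh))
    where
    K = 1ℚ + t * τ
    eq : E (independently (Vec.replicate (suc n) d)) potential ≡ (K * E d tilt) ^ suc n
    eq = trans (E-* (K ^ suc n) (prodV tilt) (independently (Vec.replicate (suc n) d)))
      (trans (cong (K ^ suc n *_) (E-prod d tilt (suc n))) (sym (*-^ K (E d tilt) (suc n))))
    Etilt : E d tilt ≡ 1ℚ + ((r - 1ℚ) * E d w + t * E d v)
    Etilt = trans (E-+ (λ _ → 1ℚ) (λ a → (r - 1ℚ) * w a + t * v a) d) (cong₂ _+_ (mass pd)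
      (trans (E-+ (λ a → (r - 1ℚ) * w a) (λ a → t * v a) d)
        (cong₂ _+_ (E-* (r - 1ℚ) w d) (E-* t v d))))
    0≤Etilt : 0ℚ ≤ E d tilt
    0≤Etilt = subst (_≤ E d tilt) (E-const pd 0ℚ) (E-mono (nonneg pd) 0≤tilt)
    0≤w : ∀ a → 0ℚ ≤ w a
    0≤w a with disjoint a
    ... | left  p _ = subst (0ℚ ≤_) (sym p) 0≤1
    ... | right p _ = ≤-reflexive (sym p)
    ... | none  p _ = ≤-reflexive (sym p)
    0≤P : 0ℚ ≤ E d w
    0≤P = subst (_≤ E d w) (E-const pd 0ℚ) (E-mono (nonneg pd) 0≤w)
    factor : K * E d tilt ≤ 1ℚ - (t * γ - t * t * E d w)
    factor = subst (λ z → K * z ≤ 1ℚ - (t * γ - t * t * E d w)) (sym Etilt)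
      (tilt-bound {r = r} 0≤t rt 0≤P 0≤τ γ≤ tP≤γ)

-- Failure probability

sumF : (m : ℕ) → (Fin m → ℚ) → ℚ
sumF zero    f = 0ℚ
sumF (suc m) f = f zero + sumF m (f ∘ suc)

0≤sumF : ∀ m {f} → (∀ i → 0ℚ ≤ f i) → 0ℚ ≤ sumF m f
0≤sumF zero    h = ≤-refl
0≤sumF (suc m) h = 0≤+ (h zero) (0≤sumF m (h ∘ suc))

≤sumF : ∀ m {f} → (∀ i → 0ℚ ≤ f i) → ∀ i → f i ≤ sumF m f
≤sumF (suc m) {f} h zero    = ≤-by (sumF m (f ∘ suc)) (0≤sumF m (h ∘ suc)) refl
≤sumF (suc m) {f} h (suc i) = ≤-trans (≤sumF m (h ∘ suc) i)
  (≤-by (f zero) (h zero) (+-comm (sumF m (f ∘ suc)) (f zero)))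

-- A certificate for Pr(Bad) ≤ β: a nonnegative function that is at least 1 on Bad, of expectation ≤ β.
record TailBound {B : Set} (d : Dist B) (Bad : B → Set) (β : ℚ) : Set where
  field
    ζ    : B → ℚ
    0≤ζ  : ∀ y → 0ℚ ≤ ζ y
    1≤ζ  : ∀ y → Bad y → 1ℚ ≤ ζ y
    Eζ≤  : E d ζ ≤ β

open TailBound

module _ {B : Set} {d : Dist B} where

  tail-∃ : ∀ m {Bad : Fin m → B → Set} {β} → (∀ i → TailBound d (Bad i) β) →
    TailBound d (λ y → ∃ λ i → Bad i y) (fromℕℚ m * β)
  tail-∃ m {Bad} {β} tb = record
    { ζ   = λ y → sumF m (λ i → ζ (tb i) y)
    ; 0≤ζ = λ y → 0≤sumF m (λ i → 0≤ζ (tb i) y)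
    ; 1≤ζ = λ y (i , bad) → ≤-trans (1≤ζ (tb i) y bad) (≤sumF m (λ i → 0≤ζ (tb i) y) i)
    ; Eζ≤ = bound m (λ i → ζ (tb i)) (λ i → Eζ≤ (tb i))
    }
    where
    bound : ∀ m (z : Fin m → B → ℚ) → (∀ i → E d (z i) ≤ β) →
      E d (λ y → sumF m (λ i → z i y)) ≤ fromℕℚ m * β
    bound zero    z h = ≤-reflexive (trans (E-cong d (λ _ → sym (*-zeroʳ 0ℚ)))
      (trans (E-* 0ℚ (λ _ → 0ℚ) d) (trans (*-zeroˡ (E d (λ _ → 0ℚ))) (sym (*-zeroˡ β)))))
    bound (suc m) z h = subst₂ _≤_ (sym (E-+ (z zero) (λ y → sumF m (λ i → z (suc i) y)) d))
      (trans (solve 2 (λ m b → b :+ m :* b := (con 1ℚ :+ m) :* b) refl (fromℕℚ m) β)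
        (cong (_* β) (sym (fromℕℚ-suc m))))
      (+-mono-≤ (h zero) (bound m (λ i → z (suc i)) (λ i → h (suc i))))

  tail-⊎ : ∀ {P Q : B → Set} {β γ} → TailBound d P β → TailBound d Q γ →
    TailBound d (λ y → P y ⊎ Q y) (β + γ)
  tail-⊎ {P} {Q} {β} {γ} p q = record
    { ζ   = λ y → ζ p y + ζ q y
    ; 0≤ζ = λ y → 0≤+ (0≤ζ p y) (0≤ζ q y)
    ; 1≤ζ = λ { y (inj₁ bad) → ≤-trans (1≤ζ p y bad) (≤-by (ζ q y) (0≤ζ q y) refl)
              ; y (inj₂ bad) → ≤-trans (1≤ζ q y bad) (≤-by (ζ p y) (0≤ζ p y) (+-comm (ζ q y) (ζ p y))) }
    ; Eζ≤ = subst (_≤ β + γ) (sym (E-+ (ζ p) (ζ q) d)) (+-mono-≤ (Eζ≤ p) (Eζ≤ q))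
    }

  tail-never : ∀ {P : B → Set} {β} → IsProbability d → 0ℚ ≤ β → (∀ y → ¬ P y) → TailBound d P β
  tail-never {P} {β} pd 0≤β never = record
    { ζ   = λ _ → 0ℚ
    ; 0≤ζ = λ _ → ≤-refl
    ; 1≤ζ = λ y bad → ⊥-elim (never y bad)
    ; Eζ≤ = subst (_≤ β) (sym (E-const pd 0ℚ)) 0≤β
    }

  E-tail : ∀ {Bad : B → Set} {β} {f g : B → ℚ} → IsProbability d → TailBound d Bad β →
    (∀ y → 0ℚ ≤ g y) → (∀ y → f y ≤ 1ℚ) → Support (λ y → f y ≤ g y ⊎ Bad y) d →
    E d f ≤ E d g + β
  E-tail {Bad} {β} {f} {g} pd tb 0≤g f≤1 s = ≤-trans
    (E-mono-support {f = f} {g = λ y → g y + ζ tb y} (nonneg pd) (ListAll.map (λ {ap} → pointwise (proj₁ ap)) s))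
    (subst (_≤ E d g + β) (sym (E-+ g (ζ tb) d)) (+-monoʳ-≤ (E d g) (Eζ≤ tb)))
    where
    pointwise : ∀ y → f y ≤ g y ⊎ Bad y → f y ≤ g y + ζ tb y
    pointwise y (inj₁ h)   = ≤-trans h (≤-by (ζ tb y) (0≤ζ tb y) refl)
    pointwise y (inj₂ bad) = ≤-trans (f≤1 y) (≤-trans (1≤ζ tb y bad)
      (≤-by (g y) (0≤g y) (+-comm (ζ tb y) (g y))))

module _ {k n : ℕ} where
  private
    State = Colouring (suc k) (suc n)
    N = fromℕℚ (suc n)

  noConsensus : ∀ {m} → Vec State m → ℚ
  noConsensus v = if does (Any.any? pluralityConsensus? v) then 0ℚ else 1ℚ

  fail : ℕ → State → ℚ
  fail T x = E (trajectory T x) noConsensus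

  isProbability-trajectory : ∀ T x → IsProbability (trajectory {suc k} {suc n} T x)
  isProbability-trajectory zero    x = isProbability-return _
  isProbability-trajectory (suc T) x = isProbability->>= (isProbability-majorityRound x) λ y →
    isProbability->>= (isProbability-trajectory T y) λ ys → isProbability-return _

  noConsensus≤1 : ∀ {m} (v : Vec State m) → noConsensus v ≤ 1ℚ
  noConsensus≤1 v with Any.any? pluralityConsensus? v
  ... | yes _ = 0≤1
  ... | no  _ = ≤-refl

  noConsensus-∷ : ∀ {m} x (v : Vec State m) → noConsensus (x ∷ v) ≤ noConsensus v
  noConsensus-∷ x v = helper (Any.any? pluralityConsensus? (x ∷ v)) (Any.any? pluralityConsensus? v)
    where
    helper : (d : Dec (Any PluralityConsensus (x ∷ v))) (e : Dec (Any PluralityConsensus v)) →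
      (if does d then 0ℚ else 1ℚ) ≤ (if does e then 0ℚ else 1ℚ)
    helper (yes _) (yes _) = ≤-refl
    helper (yes _) (no _)  = 0≤1
    helper (no h)  (yes p) = ⊥-elim (h (there p))
    helper (no _)  (no _)  = ≤-refl

  fail≤1 : ∀ T x → fail T x ≤ 1ℚ
  fail≤1 T x = subst (fail T x ≤_) (mass p) (E-mono (nonneg p) noConsensus≤1)
    where p = isProbability-trajectory T x

  -- The Markov property. It is an inequality because a consensus in `x` itself is disregarded.
  fail-suc : ∀ T x → fail (suc T) x ≤ E (majorityRound x) (fail T)
  fail-suc T x = subst (_≤ E (majorityRound x) (fail T)) (sym eq)
    (E-mono (nonneg (isProbability-majorityRound x)) λ y →
      E-mono (nonneg (isProbability-trajectory T y)) (noConsensus-∷ x))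
    where
    eq : fail (suc T) x ≡ E (majorityRound x) (λ y → E (trajectory T y) (λ ys → noConsensus (x ∷ ys)))
    eq = trans (E->>= (majorityRound x) (λ y → trajectory T y >>= λ ys → return (x ∷ ys)) noConsensus)
      (E-cong (majorityRound x) λ y →
        trans (E->>= (trajectory T y) (λ ys → return (x ∷ ys)) noConsensus)
          (E-cong (trajectory T y) λ ys → E-return (x ∷ ys) noConsensus))

  Pr≡1-fail : ∀ T x → Pr-consensus-within T x ≡ 1ℚ - fail T x
  Pr≡1-fail T x = trans (solve 2 (λ p q → p := p :+ q :- q) refl (Pr-consensus-within T x) (fail T x))
    (cong (_- fail T x) (trans (sum (trajectory T x)) (mass (isProbability-trajectory T x))))
    where
    sum : (d : Dist (Vec State (suc T))) →
      Pr (Any.any? pluralityConsensus?) d + E d noConsensus ≡ E d (λ _ → 1ℚ)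
    sum []            = refl
    sum ((v , p) ∷ d) with Any.any? pluralityConsensus? v
    ... | yes _ = trans (solve 3 (λ p u w → (p :+ u) :+ (p :* con 0ℚ :+ w) := p :* con 1ℚ :+ (u :+ w))
      refl p (Pr (Any.any? pluralityConsensus?) d) (E d noConsensus)) (cong (λ q → p * 1ℚ + q) (sum d))
    ... | no _  = trans (solve 3 (λ p u w → u :+ (p :* con 1ℚ :+ w) := p :* con 1ℚ :+ (u :+ w))
      refl p (Pr (Any.any? pluralityConsensus?) d) (E d noConsensus)) (cong (λ q → p * 1ℚ + q) (sum d))

  sumV≤ : ∀ {m} (y : Vec (Fin (suc k)) m) → sumV (δ zero) y ≤ fromℕℚ m
  sumV≤ []      = ≤-refl
  sumV≤ {suc m} (c ∷ y) = subst (sumV (δ zero) (c ∷ y) ≤_) (sym (fromℕℚ-suc m))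
    (+-mono-≤ (δ≤1 zero c) (sumV≤ y))

  sumV<⊎All : ∀ {m} (y : Vec (Fin (suc k)) m) → 1ℚ + sumV (δ zero) y ≤ fromℕℚ m ⊎ PluralityConsensus y
  sumV<⊎All []      = inj₂ []
  sumV<⊎All {suc m} (suc c ∷ y) = inj₁ (subst (1ℚ + (0ℚ + sumV (δ zero) y) ≤_) (sym (fromℕℚ-suc m))
    (+-monoʳ-≤ 1ℚ (subst (_≤ fromℕℚ m) (sym (+-identityˡ (sumV (δ zero) y))) (sumV≤ y))))
  sumV<⊎All {suc m} (zero ∷ y) with sumV<⊎All y
  ... | inj₁ h = inj₁ (subst (1ℚ + (1ℚ + sumV (δ zero) y) ≤_) (sym (fromℕℚ-suc m)) (+-monoʳ-≤ 1ℚ h))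
  ... | inj₂ h = inj₂ (refl ∷ h)

  -- First moment: the right side is the number of minority nodes, an integer that is at least 1
  -- unless there is consensus.
  fail-zero : ∀ x → fail 0 x ≤ N * (1ℚ - freq x zero)
  fail-zero x = subst (_≤ N * (1ℚ - freq x zero)) (sym (E-return (x ∷ []) noConsensus))
    (helper (Any.any? pluralityConsensus? (x ∷ [])) (sumV<⊎All x))
    where
    0≤rest : 0ℚ ≤ N * (1ℚ - freq x zero)
    0≤rest = 0≤* (0≤fromℕℚ (suc n)) (0≤q-p (freq≤1 x zero))
    helper : (d : Dec (Any PluralityConsensus (x ∷ []))) →
      1ℚ + sumV (δ zero) x ≤ N ⊎ PluralityConsensus x →
      (if does d then 0ℚ else 1ℚ) ≤ N * (1ℚ - freq x zero)
    helper (yes _) _        = 0≤rest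
    helper (no h)  (inj₂ p) = ⊥-elim (h (here p))
    helper (no _)  (inj₁ h) = subst (1ℚ ≤_)
      (trans (cong (λ q → N - q) (sym (freq-sumV x zero)))
        (solve 2 (λ N f → N :- N :* f := N :* (con 1ℚ :- f)) refl N (freq x zero)))
      (≤-by (N - (1ℚ + sumV (δ zero) x)) (0≤q-p h)
        (solve 2 (λ N s → con 1ℚ :+ (N :- (con 1ℚ :+ s)) := N :- s) refl N (sumV (δ zero) x)))

  -- The minority has mass 1-f in all, and each of its nodes contributes at most ν to the average of
  -- frequencies.
  collision≤ : (x : State) → ∀ {ν} → (∀ i → lookup x i ≢ zero → freq x (lookup x i) ≤ ν) →
    collision x ≤ freq x zero * freq x zero + (1ℚ - freq x zero) * ν
  collision≤ x {ν} h = subst (collision x ≤_) eq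
    (avg-mono x (freq x) (λ c → (f - ν) * δ zero c + ν * 1ℚ) pointwise)
    where
    f = freq x zero
    pointwise : ∀ i → freq x (lookup x i) ≤ (f - ν) * δ zero (lookup x i) + ν * 1ℚ
    pointwise i with lookup x i in eq
    ... | zero  = ≤-reflexive (solve 2 (λ f ν → f := (f :- ν) :* con 1ℚ :+ ν :* con 1ℚ) refl f ν)
    ... | suc c = subst (freq x (suc c) ≤_)
      (solve 2 (λ f ν → ν := (f :- ν) :* con 0ℚ :+ ν :* con 1ℚ) refl f ν)
      (subst (λ a → freq x a ≤ ν) eq (h i λ e → 1+≢0 (trans (sym eq) e)))
      where
      1+≢0 : suc c ≢ zero
      1+≢0 ()
    eq : avg x (λ c → (f - ν) * δ zero c + ν * 1ℚ) ≡ f * f + (1ℚ - f) * ν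
    eq = trans (avg-affine x (f - ν) ν (δ zero) (λ _ → 1ℚ))
      (trans (cong (λ e → (f - ν) * f + ν * e) (avg-const x 1ℚ))
        (solve 2 (λ f ν → (f :- ν) :* f :+ ν :* con 1ℚ := f :* f :+ (con 1ℚ :- f) :* ν) refl f ν))

  freq+freq≤1 : (x : State) → ∀ {j} → j ≢ zero → freq x j ≤ 1ℚ - freq x zero
  freq+freq≤1 x {j} j≢0 = ≤-by (1ℚ - (1ℚ * freq x j + 1ℚ * freq x zero)) (0≤q-p sum≤1)
    (solve 2 (λ u v → u :+ (con 1ℚ :- (con 1ℚ :* u :+ con 1ℚ :* v)) := con 1ℚ :- v)
      refl (freq x j) (freq x zero))
    where
    pointwise : ∀ c → 1ℚ * δ j c + 1ℚ * δ zero c ≤ 1ℚ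
    pointwise c with c Fin.≟ zero
    ... | yes refl = subst (λ e → 1ℚ * e + 1ℚ ≤ 1ℚ) (sym (δ-diff (λ e → j≢0 (sym e)))) ≤-refl
    ... | no  _    = subst (_≤ 1ℚ) (solve 1 (λ u → u := con 1ℚ :* u :+ con 0ℚ) refl (δ j c)) (δ≤1 j c)
    sum≤1 : 1ℚ * freq x j + 1ℚ * freq x zero ≤ 1ℚ
    sum≤1 = subst₂ _≤_ (avg-affine x 1ℚ 1ℚ (δ j) (δ zero)) (avg-const x 1ℚ)
      (avg-mono x (λ c → 1ℚ * δ j c + 1ℚ * δ zero c) (λ _ → 1ℚ) (λ i → pointwise (lookup x i)))

  -- The probability that a node takes colour j in the next round, by E-recolour-δ.
  next : State → Fin (suc k) → ℚ
  next x j = freq x j * (1ℚ + freq x j - collision x)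

module _ {k n : ℕ} (x : Colouring (suc k) (suc n)) where
  private
    N = fromℕℚ (suc n)
    f = freq x zero
    S = collision x
    pr = isProbability-recolour x

  next≤1 : ∀ j → next x j ≤ 1ℚ
  next≤1 j = subst₂ _≤_ (E-recolour-δ x j) (mass pr) (E-mono (nonneg pr) (δ≤1 j))

  -- Here `τ` is the level to be exceeded after the round, `γ` a lower bound for the expected
  -- surplus over it, `t` the strength of the tilt, `h` the resulting gain per node and `D` the gain
  -- of the whole round in bits.
  module _ {t τ γ h : ℚ} {D : ℕ} (0≤t : 0ℚ ≤ t) (0≤τ : 0ℚ ≤ τ)
    (tP≤γ : t * next x zero ≤ γ) (h≤ : h ≤ t * γ - t * t * next x zero)
    (0≤h : 0ℚ ≤ h) (h≤1 : h ≤ 1ℚ) (D≤n : D ℕ.≤ suc n) (D≤nh : fromℕℚ D ≤ N * h) where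

    tail-lead : ∀ {j} → j ≢ zero → γ ≤ next x zero - next x j - τ →
      TailBound (majorityRound x) (λ y → freq y zero ≤ freq y j + τ) (½ ^ D)
    tail-lead {j} j≢0 γ≤ = record
      { ζ   = potential
      ; 0≤ζ = 0≤potential
      ; 1≤ζ = λ y bad → 1≤potential y (subst₂ _≤_ (freq-sumV y zero)
          (trans (*-distribˡ-+ N (freq y j) τ) (cong (_+ N * τ) (freq-sumV y j)))
          (*-monoˡ N (0≤fromℕℚ (suc n)) bad))
      ; Eζ≤ = E-potential {d = recolour x} {γ} {h} {D} pr
          (subst₂ (λ p q → γ ≤ p - q - τ) (sym (E-recolour-δ x zero)) (sym (E-recolour-δ x j)) γ≤)
          (subst (λ p → t * p ≤ γ) (sym (E-recolour-δ x zero)) tP≤γ)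
          (subst (λ p → h ≤ t * γ - t * t * p) (sym (E-recolour-δ x zero)) h≤)
          0≤h h≤1 D≤n D≤nh
      }
      where
      disjoint : ∀ a → Disjoint (δ zero a) (δ j a)
      disjoint a with a Fin.≟ zero | a Fin.≟ j
      ... | yes refl | yes refl = ⊥-elim (j≢0 refl)
      ... | yes _    | no  _    = left refl refl
      ... | no  _    | yes _    = right refl refl
      ... | no  _    | no  _    = none refl refl
      open Chernoff disjoint {t} {τ} 0≤t 0≤τ n

    tail-low : γ ≤ next x zero - τ →
      TailBound (majorityRound x) (λ y → freq y zero ≤ τ) (½ ^ D)
    tail-low γ≤ = record
      { ζ   = potential
      ; 0≤ζ = 0≤potential
      ; 1≤ζ = λ y bad → 1≤potential y (subst₂ _≤_ (freq-sumV y zero)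
          (trans (sym (+-identityˡ (N * τ))) (cong (_+ N * τ) (sym (sumV-0 y))))
          (*-monoˡ N (0≤fromℕℚ (suc n)) bad))
      ; Eζ≤ = E-potential {d = recolour x} {γ} {h} {D} pr
          (subst₂ (λ p q → γ ≤ p - q - τ) (sym (E-recolour-δ x zero)) (sym (E-const pr 0ℚ))
            (subst (γ ≤_) (solve 2 (λ p τ → p :- τ := p :- con 0ℚ :- τ) refl (next x zero) τ) γ≤))
          (subst (λ p → t * p ≤ γ) (sym (E-recolour-δ x zero)) tP≤γ)
          (subst (λ p → h ≤ t * γ - t * t * p) (sym (E-recolour-δ x zero)) h≤)
          0≤h h≤1 D≤n D≤nh
      }
      where
      sumV-0 : ∀ {m} (y : Vec (Fin (suc k)) m) → sumV (λ _ → 0ℚ) y ≡ 0ℚ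
      sumV-0 []      = refl
      sumV-0 (_ ∷ y) = trans (+-identityˡ _) (sumV-0 y)
      disjoint : ∀ a → Disjoint (δ zero a) 0ℚ
      disjoint a with a Fin.≟ zero
      ... | yes _ = left refl refl
      ... | no  _ = none refl refl
      open Chernoff disjoint {t} {τ} 0≤t 0≤τ n

-- The late phase: the plurality colour holds at least 2/3 of the nodes

⅔ ⅓ ⁷/₉ : ℚ
⅔   = + 2 / 3
⅓   = + 1 / 3
⁷/₉ = + 7 / 9

module _ {k n : ℕ} (x : Colouring (suc k) (suc n)) (⅔≤f : ⅔ ≤ freq x zero) where
  private
    N = fromℕℚ (suc n)
    f = freq x zero
    S = collision x
    0≤f = 0≤freq x zero
    0≤1-f = 0≤q-p (freq≤1 x zero)
    0≤e : 0ℚ ≤ f * f + (1ℚ - f) * (1ℚ - f) - S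
    0≤e = 0≤q-p (collision≤ x (λ i → freq+freq≤1 x))

  -- With y = 1-f the expected minority fraction is at most 3y²-2y³.
  contraction : 1ℚ - next x zero ≤ ⁷/₉ * (1ℚ - f)
  contraction = ≤-by ((1ℚ - f) * (f - ⅔) * (⅓ + (f + f)) + f * (f * f + (1ℚ - f) * (1ℚ - f) - S))
    (0≤+ (0≤* (0≤* 0≤1-f (0≤q-p ⅔≤f)) (0≤+ (nonNegative⁻¹ ⅓) (0≤+ 0≤f 0≤f))) (0≤* 0≤f 0≤e))
    (solve 2 (λ f S → con 1ℚ :- f :* (con 1ℚ :+ f :- S) :+ ((con 1ℚ :- f) :* (f :- con ⅔) :* (con ⅓ :+ (f :+ f))
        :+ f :* (f :* f :+ (con 1ℚ :- f) :* (con 1ℚ :- f) :- S)) := con ⁷/₉ :* (con 1ℚ :- f)) refl f S)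

  -- By `contraction` the expected minority is at most 7/9 · 1/3 = 7/27, so the plurality is
  -- expected to exceed 2/3 by γ = 2/27. As the probability p is at most 1, t = γ/2 = 1/27 is the
  -- best tilt and gives tγ - t² = 1/729.
  tail-majority : ∀ {h D} → 0ℚ ≤ h → h ≤ + 1 / 729 → D ℕ.≤ suc n → fromℕℚ D ≤ N * h →
    TailBound (majorityRound x) (λ y → freq y zero ≤ ⅔) (½ ^ D)
  tail-majority {h} {D} 0≤h h≤ D≤n D≤nh = tail-low x {+ 1 / 27} {⅔} {+ 2 / 27} {h} {D}
    (nonNegative⁻¹ (+ 1 / 27)) (nonNegative⁻¹ ⅔)
    (≤-by (+ 1 / 27 + (+ 1 / 27) * (1ℚ - p)) (0≤+ (nonNegative⁻¹ (+ 1 / 27)) (0≤* (nonNegative⁻¹ (+ 1 / 27)) 0≤1-p))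
      (solve 1 (λ p → con (+ 1 / 27) :* p :+ (con (+ 1 / 27) :+ con (+ 1 / 27) :* (con 1ℚ :- p)) := con (+ 2 / 27)) refl p))
    (≤-trans h≤ (≤-by ((+ 1 / 729) * (1ℚ - p)) (0≤* (nonNegative⁻¹ (+ 1 / 729)) 0≤1-p)
      (solve 1 (λ p → con (+ 1 / 729) :+ con (+ 1 / 729) :* (con 1ℚ :- p)
        := con (+ 1 / 27) :* con (+ 2 / 27) :- con (+ 1 / 27) :* con (+ 1 / 27) :* p) refl p)))
    0≤h (≤-trans h≤ (p≤1 (+ 1 / 729) refl)) D≤n D≤nh
    (≤-by ((⁷/₉ * (1ℚ - f) - (1ℚ - p)) + ⁷/₉ * (f - ⅔))
      (0≤+ (0≤q-p contraction) (0≤* (nonNegative⁻¹ ⁷/₉) (0≤q-p ⅔≤f)))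
      (solve 2 (λ f p → con (+ 2 / 27) :+ ((con ⁷/₉ :* (con 1ℚ :- f) :- (con 1ℚ :- p)) :+ con ⁷/₉ :* (f :- con ⅔))
        := p :- con ⅔) refl f p))
    where
    p = next x zero
    0≤1-p = 0≤q-p (next≤1 x zero)
    p≤1 : ∀ p → (p ≤ᵇ 1ℚ) ≡ true → p ≤ 1ℚ
    p≤1 p eq = ≤ᵇ⇒≤ (subst T (sym eq) tt)

module _ {k n : ℕ} where
  private
    N = fromℕℚ (suc n)

  -- The first term is linear in the number of minority nodes, so its mean after one round follows
  -- from `E-freq` and `contraction`. A fall to 2/3 or below, where the induction hypothesis is no
  -- longer available, is paid for by one more `½ ^ D`.
  fail-majority : ∀ {h D} → 0ℚ ≤ h → h ≤ + 1 / 729 → D ℕ.≤ suc n → fromℕℚ D ≤ N * h →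
    ∀ T (x : Colouring (suc k) (suc n)) → ⅔ ≤ freq x zero →
    fail T x ≤ N * (1ℚ - freq x zero) * ⁷/₉ ^ T + fromℕℚ T * ½ ^ D
  fail-majority {h} {D} 0≤h h≤ D≤n D≤nh zero x ⅔≤f = ≤-trans (fail-zero x) (≤-reflexive
    (solve 2 (λ a b → a := a :* con 1ℚ :+ con 0ℚ :* b) refl (N * (1ℚ - freq x zero)) (½ ^ D)))
  fail-majority {h} {D} 0≤h h≤ D≤n D≤nh (suc T) x ⅔≤f = ≤-trans (fail-suc T x)
    (≤-trans (E-tail pm (tail-majority x ⅔≤f {h} {D} 0≤h h≤ D≤n D≤nh) 0≤g (fail≤1 T) (ListAll.universal (λ _ → pointwise _) (majorityRound x)))
      (≤-trans (≤-reflexive (cong (_+ β) Eg))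
      (≤-by (N * ρT * (⁷/₉ * (1ℚ - freq x zero) - (1ℚ - next x zero)))
        (0≤* (0≤* 0≤N 0≤ρT) (0≤q-p (contraction x ⅔≤f)))
        (trans (solve 6 (λ N r f p T b → (con 1ℚ :- p) :* (N :* r) :+ T :* b :+ b :+
              N :* r :* (con ⁷/₉ :* (con 1ℚ :- f) :- (con 1ℚ :- p))
              := N :* (con 1ℚ :- f) :* (con ⁷/₉ :* r) :+ (con 1ℚ :+ T) :* b)
            refl N ρT (freq x zero) (next x zero) (fromℕℚ T) β)
          (cong (λ m → N * (1ℚ - freq x zero) * (⁷/₉ * ρT) + m * β) (sym (fromℕℚ-suc T)))))))
    where
    pm = isProbability-majorityRound x
    ρT = ⁷/₉ ^ T
    β = ½ ^ D
    0≤N = 0≤fromℕℚ (suc n)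
    0≤ρT : 0ℚ ≤ ρT
    0≤ρT = 0≤^ (nonNegative⁻¹ ⁷/₉) T
    0≤Tβ : 0ℚ ≤ fromℕℚ T * β
    0≤Tβ = 0≤* (0≤fromℕℚ T) (0≤^ (<⇒≤ 0<½) D)
    g : Colouring (suc k) (suc n) → ℚ
    g y = N * (1ℚ - freq y zero) * ρT + fromℕℚ T * β
    0≤g : ∀ y → 0ℚ ≤ g y
    0≤g y = 0≤+ (0≤* (0≤* 0≤N (0≤q-p (freq≤1 y zero))) 0≤ρT) 0≤Tβ
    pointwise : ∀ y → fail T y ≤ g y ⊎ freq y zero ≤ ⅔
    pointwise y with ≤-total ⅔ (freq y zero)
    ... | inj₁ h′ = inj₁ (fail-majority {h} {D} 0≤h h≤ D≤n D≤nh T y h′)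
    ... | inj₂ h′ = inj₂ h′
    Eg : E (majorityRound x) g ≡ (1ℚ - next x zero) * (N * ρT) + fromℕℚ T * β
    Eg = trans (E-cong (majorityRound x) λ y → trans
          (solve 4 (λ N f r b → N :* (con 1ℚ :- f) :* r :+ b := (N :* r :+ b) :+ (:- r) :* (N :* f))
            refl N (freq y zero) ρT (fromℕℚ T * β))
          (cong (λ s → (N * ρT + fromℕℚ T * β) + (- ρT) * s) (freq-sumV y zero)))
      (trans (E-+ (λ _ → N * ρT + fromℕℚ T * β) (λ y → (- ρT) * sumV (δ zero) y) (majorityRound x))
      (trans (cong₂ _+_ (E-const pm (N * ρT + fromℕℚ T * β))
          (trans (E-* (- ρT) (sumV (δ zero)) (majorityRound x)) (cong ((- ρT) *_) (E-freq x zero))))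
        (solve 4 (λ N r b p → (N :* r :+ b) :+ (:- r) :* (N :* p) := (con 1ℚ :- p) :* (N :* r) :+ b)
          refl N ρT (fromℕℚ T * β) (next x zero))))

-- The early phase: growth of the lead while the plurality fraction is at most 2/3

record Leading {k n} (α σ : ℚ) (x : Colouring (suc k) (suc n)) : Set where
  field
    lead  : ∀ i → lookup x i ≢ zero → freq x (lookup x i) + σ ≤ freq x zero
    large : α ≤ freq x zero

open Leading

module _ {k n : ℕ} {α σ : ℚ} (x : Colouring (suc k) (suc n)) (0≤α : 0ℚ ≤ α) (0≤σ : 0ℚ ≤ σ)
  (good : Leading α σ x) (f≤⅔ : freq x zero ≤ ⅔) where
  private
    N = fromℕℚ (suc n)
    f = freq x zero
    S = collision x
    p₀ = next x zero
    0≤f = 0≤freq x zero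
    1-f≥0 = 0≤q-p (freq≤1 x zero)
    0≤1/12 = nonNegative⁻¹ (+ 1 / 12)
    0≤1/16 = nonNegative⁻¹ (+ 1 / 16)
    0≤B : 0ℚ ≤ f * f + (1ℚ - f) * (f - σ) - S
    0≤B = 0≤q-p (collision≤ x (λ i x≢0 → ≤-by (f - (freq x (lookup x i) + σ)) (0≤q-p (lead good i x≢0))
      (solve 3 (λ f σ g → g :+ (f :- (g :+ σ)) := f :- σ) refl f σ (freq x (lookup x i)))))
    -- t minimises 2ft² - tγ.
    t γ : ℚ
    t = + 1 / 16 * σ
    γ = + 1 / 4 * (σ * f)
    0≤t : 0ℚ ≤ t
    0≤t = 0≤* 0≤1/16 0≤σ
    tp≤γ : t * p₀ ≤ γ
    tp≤γ = ≤-by (+ 1 / 16 * σ * (f * (1ℚ + 1ℚ + (1ℚ - f) + S)))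
      (0≤* 0≤t (0≤* 0≤f (0≤+ (0≤+ (0≤+ 0≤1 0≤1) 1-f≥0) (0≤collision x))))
      (solve 3 (λ σ f S → con (+ 1 / 16) :* σ :* (f :* (con 1ℚ :+ f :- S))
        :+ con (+ 1 / 16) :* σ :* (f :* (con 1ℚ :+ con 1ℚ :+ (con 1ℚ :- f) :+ S))
        := con (+ 1 / 4) :* (σ :* f)) refl σ f S)
    -- From p₀ ≤ 2f: tγ - 2ft² = σ²f/64 - σ²f/128.
    gain : + 1 / 128 * (σ * σ * f) ≤ t * γ - t * t * p₀
    gain = ≤-by (+ 1 / 256 * (σ * σ * (f * ((1ℚ - f) + S))))
      (0≤* (nonNegative⁻¹ (+ 1 / 256)) (0≤* (0≤* 0≤σ 0≤σ) (0≤* 0≤f (0≤+ 1-f≥0 (0≤collision x)))))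
      (solve 3 (λ σ f S → con (+ 1 / 128) :* (σ :* σ :* f)
        :+ con (+ 1 / 256) :* (σ :* σ :* (f :* ((con 1ℚ :- f) :+ S)))
        := con (+ 1 / 16) :* σ :* (con (+ 1 / 4) :* (σ :* f))
          :- con (+ 1 / 16) :* σ :* (con (+ 1 / 16) :* σ) :* (f :* (con 1ℚ :+ f :- S))) refl σ f S)
    -- `0≤B` says S ≤ f - σ(1-f), so p₀ ≥ f + fσ(1-f) ≥ f + fσ/3. The 1/12 is what 1/3 leaves over
    -- the 1/4 of `γ`.
    gap-large : γ ≤ p₀ - α
    gap-large = ≤-by ((f - α) + f * σ * ((⅔ - f) + + 1 / 12) + f * (f * f + (1ℚ - f) * (f - σ) - S))
      (0≤+ (0≤+ (0≤q-p (large good)) (0≤* (0≤* 0≤f 0≤σ) (0≤+ (0≤q-p f≤⅔) 0≤1/12))) (0≤* 0≤f 0≤B))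
      (solve 4 (λ σ f S α → con (+ 1 / 4) :* (σ :* f) :+ ((f :- α) :+ f :* σ :* ((con ⅔ :- f) :+ con (+ 1 / 12))
          :+ f :* (f :* f :+ (con 1ℚ :- f) :* (f :- σ) :- S))
        := f :* (con 1ℚ :+ f :- S) :- α) refl σ f S α)
    -- The difference of the two probabilities is (f-g)(1+f+g-S) with f-g = σ+u. Together with `0≤B`
    -- and σ ≤ f ≤ 2/3 it is at least σ(1+f/3); of the f/3, a quarter of f is spent on `γ` and a
    -- twelfth on the growth of σ.
    gap-lead : ∀ i → lookup x i ≢ zero →
      γ ≤ p₀ - next x (lookup x i) - σ * (1ℚ + + 1 / 12 * α)
    gap-lead i x≢0 = ≤-by
      (σ * (f * f + (1ℚ - f) * (f - σ) - S) + u * ((1ℚ - S) + ((g + u) + g))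
        + σ * (f * ((⅔ - f) + (u + g)) + + 1 / 12 * (f - α)))
      (0≤+ (0≤+ (0≤* 0≤σ 0≤B) (0≤* 0≤u (0≤+ (0≤q-p (collision≤1 x)) (0≤+ (0≤+ 0≤g 0≤u) 0≤g))))
        (0≤* 0≤σ (0≤+ (0≤* 0≤f (0≤+ (0≤q-p f≤⅔) (0≤+ 0≤u 0≤g))) (0≤* 0≤1/12 (0≤q-p (large good))))))
      (solve 5 (λ σ f S α g → con (+ 1 / 4) :* (σ :* f) :+ (σ :* (f :* f :+ (con 1ℚ :- f) :* (f :- σ) :- S)
            :+ (f :- (g :+ σ)) :* ((con 1ℚ :- S) :+ ((g :+ (f :- (g :+ σ))) :+ g))
            :+ σ :* (f :* ((con ⅔ :- f) :+ ((f :- (g :+ σ)) :+ g)) :+ con (+ 1 / 12) :* (f :- α)))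
          := f :* (con 1ℚ :+ f :- S) :- g :* (con 1ℚ :+ g :- S) :- σ :* (con 1ℚ :+ con (+ 1 / 12) :* α))
        refl σ f S α g)
      where
      g = freq x (lookup x i)
      u = f - (g + σ)
      0≤u = 0≤q-p (lead good i x≢0)
      0≤g = 0≤freq x (lookup x i)

  σ′ : ℚ
  σ′ = σ * (1ℚ + + 1 / 12 * α)

  Fails : Colouring (suc k) (suc n) → Set
  Fails y = (∃ λ i → lookup x i ≢ zero × freq y zero ≤ freq y (lookup x i) + σ′) ⊎ freq y zero ≤ α

  -- The union is over nodes rather than colours: k is not bounded in terms of n.
  tail-leading : ∀ {h D} → 0ℚ ≤ h → h ≤ 1ℚ → h ≤ + 1 / 128 * (σ * σ * α) →
    D ℕ.≤ suc n → fromℕℚ D ≤ N * h →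
    TailBound (majorityRound x) Fails (N * ½ ^ D + ½ ^ D)
  tail-leading {h} {D} 0≤h h≤1 h≤ D≤n D≤nh = tail-⊎ (tail-∃ (suc n) one)
    (tail-low x {t} {α} {γ} {h} {D} 0≤t 0≤α tp≤γ h≤gain 0≤h h≤1 D≤n D≤nh gap-large)
    where
    h≤gain : h ≤ t * γ - t * t * p₀
    h≤gain = ≤-trans h≤ (≤-trans (*-monoˡ (+ 1 / 128) (nonNegative⁻¹ (+ 1 / 128))
      (*-monoˡ (σ * σ) (0≤* 0≤σ 0≤σ) (large good))) gain)
    0≤σ′ : 0ℚ ≤ σ′
    0≤σ′ = 0≤* 0≤σ (0≤+ 0≤1 (0≤* 0≤1/12 0≤α))
    one : ∀ i → TailBound (majorityRound x)
      (λ y → lookup x i ≢ zero × freq y zero ≤ freq y (lookup x i) + σ′) (½ ^ D)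
    one i with lookup x i Fin.≟ zero
    ... | yes e  = tail-never (isProbability-majorityRound x) (0≤^ (<⇒≤ 0<½) D) (λ y (ne , _) → ne e)
    ... | no  ne = record { ζ = ζ tb ; 0≤ζ = 0≤ζ tb ; 1≤ζ = λ y (_ , bad) → 1≤ζ tb y bad ; Eζ≤ = Eζ≤ tb }
      where
      tb = tail-lead x {t} {σ′} {γ} {h} {D} 0≤t 0≤σ′ tp≤γ h≤gain 0≤h h≤1 D≤n D≤nh ne (gap-lead i ne)

  -- Every colour at a node of `y` already occurs at some node of `x`, so a finite check over the
  -- nodes of `x` covers all surviving rivals.
  leading⊎fails : Support (λ y → Leading α σ′ y ⊎ Fails y) (majorityRound x)
  leading⊎fails = ListAll.map (λ {(y , _)} → step y) (Support-independently (recolour x) (Support-recolour x) (suc n))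
    where
    step : ∀ y → All (Present x) y → Leading α σ′ y ⊎ Fails y
    step y present with α ≤? freq y zero
    ... | no  α≰ = inj₂ (inj₂ (<⇒≤ (≰⇒> α≰)))
    ... | yes α≤ with Fin.all? (λ i → Ok? i)
      where
      Ok : Fin (suc n) → Set
      Ok i = lookup x i ≡ zero ⊎ freq y (lookup x i) + σ′ ≤ freq y zero
      Ok? : ∀ i → Dec (Ok i)
      Ok? i = (lookup x i Fin.≟ zero) ⊎-dec (freq y (lookup x i) + σ′ ≤? freq y zero)
    ... | yes ok = inj₁ (record { large = α≤ ; lead = λ i y≢0 →
        let i′ , e = VecAll.lookup⁺ present i in
        leads (lookup y i) y≢0 i′ e })
      where
      leads : ∀ c → c ≢ zero → ∀ i → lookup x i ≡ c → freq y c + σ′ ≤ freq y zero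
      leads c c≢0 i refl with ok i
      ... | inj₁ e = ⊥-elim (c≢0 e)
      ... | inj₂ h = h
    ... | no ¬ok = inj₂ (inj₁ (i , (λ e → ¬oki (inj₁ e)) , <⇒≤ (≰⇒> λ h → ¬oki (inj₂ h))))
      where
      fails = Fin.¬∀⟶∃¬ (suc n) _ (λ i → (lookup x i Fin.≟ zero) ⊎-dec (freq y (lookup x i) + σ′ ≤? freq y zero)) ¬ok
      i = proj₁ fails
      ¬oki = proj₂ fails

-- Supplies the rival without which `lead` would be vacuous and could not bound σ by 1.
minority : ∀ {k n} (x : Colouring (suc k) (suc n)) → freq x zero ≤ ⅔ → ∃ λ i → lookup x i ≢ zero
minority {k} {n} x f≤⅔ = Fin.¬∀⟶∃¬ (suc n) _ (λ i → lookup x i Fin.≟ zero) λ all0 →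
  <-irrefl refl (≤-<-trans (subst₂ _≤_ (avg-const x 1ℚ) refl
    (≤-trans (avg-mono x (λ _ → 1ℚ) (δ zero) (λ i → subst (1ℚ ≤_) (cong (δ zero) (sym (all0 i))) ≤-refl)) f≤⅔)) ⅔<1)
  where
  ⅔<1 : ⅔ < 1ℚ
  ⅔<1 = <-by ⅓ (positive⁻¹ ⅓) refl

-- Composition of the two phases

module _ {k n : ℕ} {α σ₀ h : ℚ} {D T₂ : ℕ} (0≤α : 0ℚ ≤ α) (0≤σ₀ : 0ℚ ≤ σ₀)
  (0≤h : 0ℚ ≤ h) (h≤ : h ≤ + 1 / 729) (h≤σ₀ : h ≤ + 1 / 128 * (σ₀ * σ₀ * α))
  (D≤n : D ℕ.≤ suc n) (D≤nh : fromℕℚ D ≤ fromℕℚ (suc n) * h) where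
  private
    N = fromℕℚ (suc n)
    β = N * ½ ^ D + ½ ^ D
    0≤N = 0≤fromℕℚ (suc n)
    0≤½ᴰ = 0≤^ (<⇒≤ 0<½) D
    0≤β : 0ℚ ≤ β
    0≤β = 0≤+ (0≤* 0≤N 0≤½ᴰ) 0≤½ᴰ
    0≤⁷/₉ = nonNegative⁻¹ ⁷/₉
    h≤1 : h ≤ 1ℚ
    h≤1 = ≤-trans h≤ (≤-by (+ 728 / 729) (nonNegative⁻¹ (+ 728 / 729)) refl)

  failBound : ℕ → ℚ
  failBound T = N * ⁷/₉ ^ T₂ + fromℕℚ (T ℕ.+ T₂) * β

  0≤failBound : ∀ T → 0ℚ ≤ failBound T
  0≤failBound T = 0≤+ (0≤* 0≤N (0≤^ 0≤⁷/₉ T₂)) (0≤* (0≤fromℕℚ (T ℕ.+ T₂)) 0≤β)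

  -- As soon as f ≥ 2/3, all remaining rounds, at least `T₂` of them, go to the late phase. Until
  -- then a successful round trades one factor of the growth for a larger σ, so that σ(1+α/12)^T > 1
  -- is invariant; at T = 0 it would be a lead above 1. A single `h` serves all rounds because σ
  -- never drops below `σ₀`.
  fail-leading : ∀ T {σ} (x : Colouring (suc k) (suc n)) → σ₀ ≤ σ →
    1ℚ < σ * (1ℚ + + 1 / 12 * α) ^ T → Leading α σ x → fail (T ℕ.+ T₂) x ≤ failBound T
  fail-leading T {σ} x σ₀≤σ 1<σgᵀ good with ≤-total ⅔ (freq x zero)
  ... | inj₁ ⅔≤f = ≤-trans (fail-majority {h = h} {D} 0≤h h≤ D≤n D≤nh (T ℕ.+ T₂) x ⅔≤f)
    (+-mono-≤ (*-mono (0≤* 0≤N (0≤q-p (freq≤1 x zero))) (0≤^ 0≤⁷/₉ T₂)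
        (subst (N * (1ℚ - freq x zero) ≤_) (*-identityʳ N) (*-monoˡ N 0≤N
          (≤-by {1ℚ - freq x zero} {1ℚ} (freq x zero) (0≤freq x zero) (solve 1 (λ f → con 1ℚ :- f :+ f := con 1ℚ) refl (freq x zero)))))
        (subst (_≤ ⁷/₉ ^ T₂) (sym (^-+ ⁷/₉ T T₂)) (subst (⁷/₉ ^ T * ⁷/₉ ^ T₂ ≤_) (*-identityˡ (⁷/₉ ^ T₂))
          (*-monoʳ (⁷/₉ ^ T₂) (0≤^ 0≤⁷/₉ T₂) (^≤1 0≤⁷/₉ (≤-by (+ 2 / 9) (nonNegative⁻¹ (+ 2 / 9)) refl) T)))))
      (*-monoˡ (fromℕℚ (T ℕ.+ T₂)) (0≤fromℕℚ (T ℕ.+ T₂)) (≤-by {½ ^ D} {β} (N * ½ ^ D) (0≤* 0≤N 0≤½ᴰ) (+-comm (½ ^ D) (N * ½ ^ D)))))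
  fail-leading zero {σ} x σ₀≤σ 1<σ good | inj₂ f≤⅔ = ⊥-elim (<-irrefl refl (<-≤-trans 1<σ
    (subst (_≤ 1ℚ) (sym (*-identityʳ σ)) (≤-trans (≤-trans
      (≤-by (freq x (lookup x i)) (0≤freq x (lookup x i)) (+-comm σ _)) (lead good i x≢0)) (freq≤1 x zero)))))
    where
    i = proj₁ (minority x f≤⅔)
    x≢0 = proj₂ (minority x f≤⅔)
  fail-leading (suc T) {σ} x σ₀≤σ 1<σgᵀ good | inj₂ f≤⅔ = ≤-trans (fail-suc (T ℕ.+ T₂) x)
    (subst (E (majorityRound x) (fail (T ℕ.+ T₂)) ≤_) eq
      (E-tail {f = fail (T ℕ.+ T₂)} {g = λ _ → failBound T} pm
        (tail-leading x 0≤α 0≤σ good f≤⅔ {h} {D} 0≤h h≤1 h≤σ D≤n D≤nh)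
        (λ _ → 0≤failBound T) (fail≤1 (T ℕ.+ T₂))
        (ListAll.map (λ {(y , _)} → pointwise y) (leading⊎fails x 0≤α 0≤σ good f≤⅔))))
    where
    pm = isProbability-majorityRound x
    0≤σ = ≤-trans 0≤σ₀ σ₀≤σ
    g = 1ℚ + + 1 / 12 * α
    h≤σ : h ≤ + 1 / 128 * (σ * σ * α)
    h≤σ = ≤-trans h≤σ₀ (*-monoˡ (+ 1 / 128) (nonNegative⁻¹ (+ 1 / 128)) (*-monoʳ α 0≤α
      (*-mono 0≤σ₀ 0≤σ σ₀≤σ σ₀≤σ)))
    eq : E (majorityRound x) (λ _ → failBound T) + β ≡ failBound (suc T)
    eq = trans (cong (_+ β) (E-const pm (failBound T)))
      (trans (solve 3 (λ a m b → a :+ m :* b :+ b := a :+ (con 1ℚ :+ m) :* b) refl (N * ⁷/₉ ^ T₂) (fromℕℚ (T ℕ.+ T₂)) β)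
        (cong (λ m → N * ⁷/₉ ^ T₂ + m * β) (sym (fromℕℚ-suc (T ℕ.+ T₂)))))
    pointwise : ∀ y → Leading α (σ * g) y ⊎ Fails x 0≤α 0≤σ good f≤⅔ y →
      fail (T ℕ.+ T₂) y ≤ failBound T ⊎ Fails x 0≤α 0≤σ good f≤⅔ y
    pointwise y (inj₂ bad)   = inj₂ bad
    pointwise y (inj₁ good′) = inj₁ (fail-leading T y
      (≤-trans σ₀≤σ (subst (_≤ σ * g) (*-identityʳ σ)
        (*-monoˡ σ 0≤σ (≤-by (+ 1 / 12 * α) (0≤* (nonNegative⁻¹ (+ 1 / 12)) 0≤α) refl))))
      (subst (1ℚ <_) (sym (*-assoc σ g (g ^ T))) 1<σgᵀ) good′)

-- The exponential series

-- Unlike `partial`, it recurses at the first term, in step with `conv`.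
Σ< : ℕ → (ℕ → ℚ) → ℚ
Σ< zero    f = 0ℚ
Σ< (suc n) f = f 0 + Σ< n (f ∘ suc)

Σ<-last : ∀ n f → Σ< (suc n) f ≡ Σ< n f + f n
Σ<-last zero    f = trans (+-identityʳ (f 0)) (sym (+-identityˡ (f 0)))
Σ<-last (suc n) f = trans (cong (λ s → f 0 + s) (Σ<-last n (f ∘ suc)))
  (sym (+-assoc (f 0) (Σ< n (f ∘ suc)) (f (suc n))))

Σ<-cong : ∀ n {f g} → (∀ i → f i ≡ g i) → Σ< n f ≡ Σ< n g
Σ<-cong zero    h = refl
Σ<-cong (suc n) h = cong₂ _+_ (h 0) (Σ<-cong n (h ∘ suc))

Σ<-mono : ∀ n {f g} → (∀ i → f i ≤ g i) → Σ< n f ≤ Σ< n g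
Σ<-mono zero    h = ≤-refl
Σ<-mono (suc n) h = +-mono-≤ (h 0) (Σ<-mono n (h ∘ suc))

0≤Σ< : ∀ n {f} → (∀ i → 0ℚ ≤ f i) → 0ℚ ≤ Σ< n f
0≤Σ< zero    h = ≤-refl
0≤Σ< (suc n) h = 0≤+ (h 0) (0≤Σ< n (h ∘ suc))

Σ<-≤ : ∀ {f} → (∀ i → 0ℚ ≤ f i) → ∀ {m n} → m ℕ.≤ n → Σ< m f ≤ Σ< n f
Σ<-≤ h {n = n} ℕ.z≤n       = 0≤Σ< n h
Σ<-≤ {f} h     (ℕ.s≤s m≤n) = +-monoʳ-≤ (f 0) (Σ<-≤ (h ∘ suc) m≤n)

∣Σ<-Σ<∣ : ∀ f {m n} → m ℕ.≤ n → ∣ Σ< n f - Σ< m f ∣ ≤ Σ< n (∣_∣ ∘ f) - Σ< m (∣_∣ ∘ f)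
∣Σ<-Σ<∣ f {n = zero}  ℕ.z≤n = ≤-refl
∣Σ<-Σ<∣ f {n = suc n} ℕ.z≤n = subst₂ _≤_
  (cong ∣_∣ (solve 2 (λ a s → a :+ (s :- con 0ℚ) := a :+ s :- con 0ℚ) refl (f 0) (Σ< n (f ∘ suc))))
  (solve 2 (λ a s → a :+ (s :- con 0ℚ) := a :+ s :- con 0ℚ) refl ∣ f 0 ∣ (Σ< n (∣_∣ ∘ f ∘ suc)))
  (≤-trans (∣p+q∣≤∣p∣+∣q∣ (f 0) (Σ< n (f ∘ suc) - 0ℚ)) (+-monoʳ-≤ ∣ f 0 ∣ (∣Σ<-Σ<∣ (f ∘ suc) {0} {n} ℕ.z≤n)))
∣Σ<-Σ<∣ f {suc m} {suc n} (ℕ.s≤s m≤n) = subst₂ _≤_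
  (cong ∣_∣ (shift (f 0) (Σ< n (f ∘ suc)) (Σ< m (f ∘ suc))))
  (shift ∣ f 0 ∣ (Σ< n (∣_∣ ∘ f ∘ suc)) (Σ< m (∣_∣ ∘ f ∘ suc)))
  (∣Σ<-Σ<∣ (f ∘ suc) m≤n)
  where
  shift : ∀ a s t → s - t ≡ a + s - (a + t)
  shift = solve 3 (λ a s t → s :- t := a :+ s :- (a :+ t)) refl

-- The terms of the Cauchy product of two series.
conv : (ℕ → ℚ) → (ℕ → ℚ) → ℕ → ℚ
conv f g zero    = f 0 * g 0
conv f g (suc n) = f 0 * g (suc n) + conv (f ∘ suc) g n

conv-congˡ : ∀ {f f′} g → (∀ i → f i ≡ f′ i) → ∀ n → conv f g n ≡ conv f′ g n
conv-congˡ g h zero    = cong (_* g 0) (h 0)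
conv-congˡ g h (suc n) = cong₂ _+_ (cong (_* g (suc n)) (h 0)) (conv-congˡ g (h ∘ suc) n)

conv-congʳ : ∀ f {g g′} → (∀ i → g i ≡ g′ i) → ∀ n → conv f g n ≡ conv f g′ n
conv-congʳ f h zero    = cong (f 0 *_) (h 0)
conv-congʳ f h (suc n) = cong₂ _+_ (cong (f 0 *_) (h (suc n))) (conv-congʳ (f ∘ suc) h n)

conv-+ˡ : ∀ f f′ g n → conv (λ i → f i + f′ i) g n ≡ conv f g n + conv f′ g n
conv-+ˡ f f′ g zero    = *-distribʳ-+ (g 0) (f 0) (f′ 0)
conv-+ˡ f f′ g (suc n) = trans (cong (λ s → (f 0 + f′ 0) * g (suc n) + s) (conv-+ˡ (f ∘ suc) (f′ ∘ suc) g n))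
  (solve 5 (λ a b c s t → (a :+ b) :* c :+ (s :+ t) := (a :* c :+ s) :+ (b :* c :+ t)) refl
    (f 0) (f′ 0) (g (suc n)) (conv (f ∘ suc) g n) (conv (f′ ∘ suc) g n))

conv-*ˡ : ∀ c f g n → conv (λ i → c * f i) g n ≡ c * conv f g n
conv-*ˡ c f g zero    = *-assoc c (f 0) (g 0)
conv-*ˡ c f g (suc n) = trans (cong (λ s → c * f 0 * g (suc n) + s) (conv-*ˡ c (f ∘ suc) g n))
  (solve 4 (λ c a b s → c :* a :* b :+ c :* s := c :* (a :* b :+ s)) refl c (f 0) (g (suc n)) (conv (f ∘ suc) g n))

conv-*ʳ : ∀ c f g n → conv f (λ i → c * g i) n ≡ c * conv f g n
conv-*ʳ c f g zero    = solve 3 (λ c a b → a :* (c :* b) := c :* (a :* b)) refl c (f 0) (g 0)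
conv-*ʳ c f g (suc n) = trans (cong (λ s → f 0 * (c * g (suc n)) + s) (conv-*ʳ c (f ∘ suc) g n))
  (solve 4 (λ c a b s → a :* (c :* b) :+ c :* s := c :* (a :* b :+ s)) refl c (f 0) (g (suc n)) (conv (f ∘ suc) g n))

conv-last : ∀ f g n → conv f g (suc n) ≡ conv f (g ∘ suc) n + f (suc n) * g 0
conv-last f g zero    = refl
conv-last f g (suc n) = trans (cong (λ s → f 0 * g (suc (suc n)) + s) (conv-last (f ∘ suc) g n))
  (sym (+-assoc (f 0 * g (suc (suc n))) (conv (f ∘ suc) (g ∘ suc) n) (f (suc (suc n)) * g 0)))

-- f ↦ x f′ on coefficient sequences.
euler : (ℕ → ℚ) → ℕ → ℚ
euler f i = fromℕℚ i * f i

-- The Leibniz rule: the operator `euler` is a derivation for the Cauchy product.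
euler-conv : ∀ f g n → fromℕℚ n * conv f g n ≡ conv (euler f) g n + conv f (euler g) n
euler-conv f g zero    = solve 2 (λ a b → con 0ℚ :* (a :* b) := con 0ℚ :* a :* b :+ a :* (con 0ℚ :* b)) refl (f 0) (g 0)
euler-conv f g (suc n) = trans (cong (_* (f 0 * g (suc n) + c)) (fromℕℚ-suc n))
  (trans (solve 4 (λ n a b c → (con 1ℚ :+ n) :* (a :* b :+ c) := (con 1ℚ :+ n) :* (a :* b) :+ c :+ n :* c)
      refl (fromℕℚ n) (f 0) (g (suc n)) c)
  (trans (cong₂ (λ m s → m * (f 0 * g (suc n)) + c + s) (sym (fromℕℚ-suc n)) (euler-conv (f ∘ suc) g n))
  (trans (solve 6 (λ m a b c s t → m :* (a :* b) :+ c :+ (s :+ t) := con 0ℚ :* a :* b :+ (c :+ s) :+ (a :* (m :* b) :+ t))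
      refl (fromℕℚ (suc n)) (f 0) (g (suc n)) c (conv (euler (f ∘ suc)) g n) (conv (f ∘ suc) (euler g) n))
    (cong (λ s → 0ℚ * f 0 * g (suc n) + s + (f 0 * (fromℕℚ (suc n) * g (suc n)) + conv (f ∘ suc) (euler g) n))
      (trans (sym (conv-+ˡ (f ∘ suc) (euler (f ∘ suc)) g n)) (conv-congˡ g shift n))))))
  where
  c = conv (f ∘ suc) g n
  shift : ∀ i → f (suc i) + euler (f ∘ suc) i ≡ euler f (suc i)
  shift i = trans (solve 2 (λ i x → x :+ i :* x := (con 1ℚ :+ i) :* x) refl (fromℕℚ i) (f (suc i)))
    (cong (_* f (suc i)) (sym (fromℕℚ-suc i)))

Σ<-conv : ∀ n f g → Σ< (suc n) (conv f g) ≡ f 0 * Σ< (suc n) g + Σ< n (conv (f ∘ suc) g)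
Σ<-conv n f g = trans (cong (λ s → f 0 * g 0 + s) (split n (g ∘ suc) (conv (f ∘ suc) g)))
  (solve 4 (λ a b s t → a :* b :+ (a :* s :+ t) := a :* (b :+ s) :+ t)
    refl (f 0) (g 0) (Σ< n (g ∘ suc)) (Σ< n (conv (f ∘ suc) g)))
  where
  split : ∀ n h k → Σ< n (λ i → f 0 * h i + k i) ≡ f 0 * Σ< n h + Σ< n k
  split zero    h k = trans (sym (*-zeroʳ (f 0))) (sym (+-identityʳ (f 0 * 0ℚ)))
  split (suc n) h k = trans (cong (λ s → f 0 * h 0 + k 0 + s) (split n (h ∘ suc) (k ∘ suc)))
    (solve 5 (λ a b c s t → (a :* b :+ c) :+ (a :* s :+ t) := a :* (b :+ s) :+ (c :+ t))
      refl (f 0) (h 0) (k 0) (Σ< n (h ∘ suc)) (Σ< n (k ∘ suc)))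

-- The defect consists of the terms f i * g j with i < k, j < N and i + j ≥ k; the triangle
-- inequality applies term by term.
Σ<-product-defect : ∀ N g k f → k ℕ.≤ N →
  ∣ Σ< k f * Σ< N g - Σ< k (conv f g) ∣ ≤
  Σ< k (∣_∣ ∘ f) * Σ< N (∣_∣ ∘ g) - Σ< k (conv (∣_∣ ∘ f) (∣_∣ ∘ g))
Σ<-product-defect N g zero    f h = subst₂ _≤_
  (cong ∣_∣ (solve 1 (λ s → con 0ℚ := con 0ℚ :* s :- con 0ℚ) refl (Σ< N g)))
  (solve 1 (λ s → con 0ℚ := con 0ℚ :* s :- con 0ℚ) refl (Σ< N (∣_∣ ∘ g))) ≤-refl
Σ<-product-defect N g (suc k) f h = subst₂ _≤_ (cong ∣_∣ (unfold f g)) (unfold (∣_∣ ∘ f) (∣_∣ ∘ g))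
  (≤-trans (∣p+q∣≤∣p∣+∣q∣ (f 0 * (Σ< N g - Σ< (suc k) g)) _)
    (+-mono-≤ (subst (_≤ ∣ f 0 ∣ * (Σ< N (∣_∣ ∘ g) - Σ< (suc k) (∣_∣ ∘ g)))
        (sym (∣p*q∣≡∣p∣*∣q∣ (f 0) (Σ< N g - Σ< (suc k) g)))
        (*-monoˡ ∣ f 0 ∣ (0≤∣p∣ (f 0)) (∣Σ<-Σ<∣ g h)))
      (Σ<-product-defect N g k (f ∘ suc) (ℕ.≤-trans (ℕ.n≤1+n k) h))))
  where
  unfold : ∀ f g → f 0 * (Σ< N g - Σ< (suc k) g) + (Σ< k (f ∘ suc) * Σ< N g - Σ< k (conv (f ∘ suc) g))
    ≡ Σ< (suc k) f * Σ< N g - Σ< (suc k) (conv f g)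
  unfold f g = trans (solve 5 (λ a s t u v → a :* (s :- t) :+ (u :* s :- v) := (a :+ u) :* s :- (a :* t :+ v))
      refl (f 0) (Σ< N g) (Σ< (suc k) g) (Σ< k (f ∘ suc)) (Σ< k (conv (f ∘ suc) g)))
    (cong (λ s → Σ< (suc k) f * Σ< N g - s) (sym (Σ<-conv k f g)))

0≤conv : ∀ {f g} → (∀ i → 0ℚ ≤ f i) → (∀ i → 0ℚ ≤ g i) → ∀ n → 0ℚ ≤ conv f g n
0≤conv hf hg zero    = 0≤* (hf 0) (hg 0)
0≤conv hf hg (suc n) = 0≤+ (0≤* (hf 0) (hg (suc n))) (0≤conv (hf ∘ suc) hg n)

-- The rectangle of index pairs of the product lies in the triangle of pairs with sum below k + j.
Σ<*Σ<≤ : ∀ {g} → (∀ i → 0ℚ ≤ g i) → ∀ k j f → (∀ i → 0ℚ ≤ f i) →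
  Σ< k f * Σ< j g ≤ Σ< (k ℕ.+ j) (conv f g)
Σ<*Σ<≤ {g} hg zero    j f hf = subst (_≤ Σ< j (conv f g)) (sym (*-zeroˡ (Σ< j g))) (0≤Σ< j (0≤conv hf hg))
Σ<*Σ<≤ {g} hg (suc k) j f hf = subst₂ _≤_ (sym (*-distribʳ-+ (Σ< j g) (f 0) (Σ< k (f ∘ suc))))
  (sym (Σ<-conv (k ℕ.+ j) f g))
  (+-mono-≤ (*-monoˡ (f 0) (hf 0) (Σ<-≤ hg (ℕ.m≤n+m j (suc k)))) (Σ<*Σ<≤ hg k j (f ∘ suc) (hf ∘ suc)))

expTerm : ℚ → ℕ → ℚ
expTerm a i = expCoeff i * a ^ i

exp-partial : ℚ → ℕ → ℚ
exp-partial = partial expCoeff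

exp-partial-Σ< : ∀ a n → exp-partial a n ≡ Σ< n (expTerm a)
exp-partial-Σ< a zero    = refl
exp-partial-Σ< a (suc n) = trans (cong (_+ expTerm a n) (exp-partial-Σ< a n)) (sym (Σ<-last n (expTerm a)))

0≤expCoeff : ∀ i → 0ℚ ≤ expCoeff i
0≤expCoeff i = <⇒≤ (0<recip (0<! i))

expCoeff-suc : ∀ i → fromℕℚ (suc i) * expCoeff (suc i) ≡ expCoeff i
expCoeff-suc i = trans (sym (*-identityʳ (m * u)))
  (trans (cong (m * u *_) (sym (*-recip (0<! i))))
  (trans (solve 4 (λ m u w v → m :* u :* (w :* v) := (m :* w) :* u :* v) refl m u w v)
  (trans (cong (λ z → z * u * v) (sym (fromℕℚ-* (suc i) (i ℕ.!))))
  (trans (cong (_* v) (*-recip (0<! (suc i)))) (*-identityˡ v)))))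
  where
  m = fromℕℚ (suc i)
  u = expCoeff (suc i)
  v = expCoeff i
  w = fromℕℚ (i ℕ.!)

euler-expTerm : ∀ a i → euler (expTerm a) (suc i) ≡ a * expTerm a i
euler-expTerm a i = trans (solve 4 (λ m u a p → m :* (u :* (a :* p)) := a :* ((m :* u) :* p))
    refl (fromℕℚ (suc i)) (expCoeff (suc i)) a (a ^ i))
  (cong (λ z → a * (z * a ^ i)) (expCoeff-suc i))

-- The binomial theorem without binomial coefficients: by `euler-conv` both sides solve (n+1) c(n+1)
-- = (a+b) c(n), the recurrence of y′ = (a+b) y, with the same initial value.
conv-expTerm : ∀ a b n → conv (expTerm a) (expTerm b) n ≡ expTerm (a + b) n
conv-expTerm a b zero    = refl
conv-expTerm a b (suc n) = trans (sym (cancel c)) (trans (cong (h *_) eq) (cancel (expTerm (a + b) (suc n))))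
  where
  c = conv (expTerm a) (expTerm b) (suc n)
  m = fromℕℚ (suc n)
  h = recip m
  cancel : ∀ z → h * (m * z) ≡ z
  cancel z = trans (sym (*-assoc h m z)) (trans (cong (_* z) (recip-* n)) (*-identityˡ z))
  u = conv (expTerm a) (expTerm b) n
  eq : m * c ≡ m * expTerm (a + b) (suc n)
  eq = trans (euler-conv (expTerm a) (expTerm b) (suc n))
    (trans (cong₂ _+_
      (trans (cong₂ _+_ (solve 2 (λ x y → con 0ℚ :* x :* y := con 0ℚ) refl (expTerm a 0) (expTerm b (suc n)))
          (trans (conv-congˡ (expTerm b) (euler-expTerm a) n) (conv-*ˡ a (expTerm a) (expTerm b) n)))
        (+-identityˡ (a * u)))
      (trans (conv-last (expTerm a) (euler (expTerm b)) n)
        (trans (cong₂ _+_ (trans (conv-congʳ (expTerm a) (euler-expTerm b) n) (conv-*ʳ b (expTerm a) (expTerm b) n))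
            (solve 2 (λ x y → x :* (con 0ℚ :* y) := con 0ℚ) refl (expTerm a (suc n)) (expTerm b 0)))
          (+-identityʳ (b * u)))))
    (trans (sym (*-distribʳ-+ u a b))
      (trans (cong ((a + b) *_) (conv-expTerm a b n)) (sym (euler-expTerm (a + b) n)))))

∣^∣ : ∀ p n → ∣ p ^ n ∣ ≡ ∣ p ∣ ^ n
∣^∣ p zero    = refl
∣^∣ p (suc n) = trans (∣p*q∣≡∣p∣*∣q∣ p (p ^ n)) (cong (∣ p ∣ *_) (∣^∣ p n))

∣expTerm∣ : ∀ a i → ∣ expTerm a i ∣ ≡ expTerm ∣ a ∣ i
∣expTerm∣ a i = trans (∣p*q∣≡∣p∣*∣q∣ (expCoeff i) (a ^ i))
  (cong₂ _*_ (0≤p⇒∣p∣≡p (0≤expCoeff i)) (∣^∣ a i))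

0≤expTerm : ∀ {a} → 0ℚ ≤ a → ∀ i → 0ℚ ≤ expTerm a i
0≤expTerm 0≤a i = 0≤* (0≤expCoeff i) (0≤^ 0≤a i)

Σ<-conv-exp : ∀ a b n → Σ< n (conv (expTerm a) (expTerm b)) ≡ exp-partial (a + b) n
Σ<-conv-exp a b n = trans (Σ<-cong n (conv-expTerm a b)) (sym (exp-partial-Σ< (a + b) n))

exp-defect : ∀ a b n → ∣ exp-partial a n * exp-partial b n - exp-partial (a + b) n ∣ ≤
  (exp-partial ∣ a ∣ n) * (exp-partial ∣ b ∣ n) - exp-partial (∣ a ∣ + ∣ b ∣) n
exp-defect a b n = subst₂ _≤_
  (cong ∣_∣ (cong₂ _-_ (cong₂ _*_ (sym (exp-partial-Σ< a n)) (sym (exp-partial-Σ< b n))) (Σ<-conv-exp a b n)))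
  (cong₂ _-_ (cong₂ _*_ (abs a) (abs b))
    (trans (Σ<-cong n λ i → trans (conv-congˡ (∣_∣ ∘ expTerm b) (∣expTerm∣ a) i)
      (conv-congʳ (expTerm ∣ a ∣) (∣expTerm∣ b) i)) (Σ<-conv-exp ∣ a ∣ ∣ b ∣ n)))
  (Σ<-product-defect n (expTerm b) n (expTerm a) ℕ.≤-refl)
  where
  abs : ∀ a → Σ< n (∣_∣ ∘ expTerm a) ≡ exp-partial ∣ a ∣ n
  abs a = trans (Σ<-cong n (∣expTerm∣ a)) (sym (exp-partial-Σ< ∣ a ∣ n))

-- For nonnegative arguments the bound of `exp-defect` is the defect itself, which is therefore
-- nonnegative.
exp-partial-+≤ : ∀ {a b} → 0ℚ ≤ a → 0ℚ ≤ b → ∀ n →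
  exp-partial (a + b) n ≤ exp-partial a n * exp-partial b n
exp-partial-+≤ {a} {b} 0≤a 0≤b n = ≤-by (exp-partial a n * exp-partial b n - exp-partial (a + b) n)
  (subst₂ (λ c d → 0ℚ ≤ exp-partial c n * exp-partial d n - exp-partial (c + d) n)
    (0≤p⇒∣p∣≡p 0≤a) (0≤p⇒∣p∣≡p 0≤b)
    (≤-trans (0≤∣p∣ (exp-partial a n * exp-partial b n - exp-partial (a + b) n)) (exp-defect a b n)))
  (solve 2 (λ x y → y :+ (x :- y) := x) refl (exp-partial a n * exp-partial b n) (exp-partial (a + b) n))

-- The defect is at most the tail from n to 2n of the series at ∣a∣+∣b∣.
exp-+ : ∀ k ε → 0ℚ < ε → ∃ λ N → ∀ n → N ℕ.≤ n → ∀ a b → ∣ a ∣ + ∣ b ∣ ≤ fromℕℚ (suc k) →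
  ∣ exp-partial a n * exp-partial b n - exp-partial (a + b) n ∣ ≤ ε
exp-+ k ε 0<ε = N , λ n N≤n a b h →
  let A   = ∣ a ∣
      B   = ∣ b ∣
      0≤A = 0≤∣p∣ a
      0≤B = 0≤∣p∣ b
      h′  = subst (_≤ fromℕℚ (suc k)) (sym (0≤p⇒∣p∣≡p (0≤+ 0≤A 0≤B))) h
      t₁  = tail h′ (n ℕ.+ n) (ℕ.≤-trans N≤n (ℕ.m≤m+n n n))
      t₂  = tail h′ n N≤n
      x   = exp-partial (A + B) (n ℕ.+ n)
      y   = exp-partial (A + B) n
      z   = exp-partial (A + B) N
      p   = exp-partial A n * exp-partial B n
      p≤x : p ≤ x
      p≤x = subst₂ _≤_ (sym (cong₂ _*_ (exp-partial-Σ< A n) (exp-partial-Σ< B n))) (Σ<-conv-exp A B (n ℕ.+ n))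
        (Σ<*Σ<≤ {expTerm B} (0≤expTerm 0≤B) n n (expTerm A) (0≤expTerm 0≤A))
      x-y≤ : x - y ≤ ε
      x-y≤ = ≤-trans (p≤∣p∣ (x - y)) (≤-trans (∣∣-triangle x z y)
        (subst (∣ x - z ∣ + ∣ z - y ∣ ≤_) (½+½ ε)
          (+-mono-≤ t₁ (subst (_≤ ½ * ε) (∣-∣-comm y z) t₂))))
  in ≤-trans (exp-defect a b n) (≤-trans (+-monoˡ-≤ (- y) p≤x) x-y≤)
  where
  N = proj₁ (tail-small (exp-dominated k) (½ * ε) (0<* 0<½ 0<ε))
  tail : ∀ {p} → ∣ p ∣ ≤ fromℕℚ (suc k) → ∀ m → N ℕ.≤ m →
    ∣ exp-partial p m - exp-partial p N ∣ ≤ ½ * ε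
  tail = proj₂ (tail-small (exp-dominated k) (½ * ε) (0<* 0<½ 0<ε))

exp-partial-mono : ∀ {a b} → 0ℚ ≤ a → a ≤ b → ∀ n → exp-partial a n ≤ exp-partial b n
exp-partial-mono {a} {b} 0≤a a≤b n = subst₂ _≤_ (sym (exp-partial-Σ< a n)) (sym (exp-partial-Σ< b n))
  (Σ<-mono n λ i → *-monoˡ (expCoeff i) (0≤expCoeff i) (^-mono 0≤a a≤b i))

0≤exp-partial : ∀ {a} → 0ℚ ≤ a → ∀ n → 0ℚ ≤ exp-partial a n
0≤exp-partial {a} 0≤a n = subst (0ℚ ≤_) (sym (exp-partial-Σ< a n)) (0≤Σ< n (0≤expTerm 0≤a))

exp-partial-0 : ∀ n → exp-partial 0ℚ (suc n) ≡ 1ℚ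
exp-partial-0 zero    = refl
exp-partial-0 (suc n) = trans (cong₂ _+_ (exp-partial-0 n)
  (solve 2 (λ u v → u :* (con 0ℚ :* v) := con 0ℚ) refl (expCoeff (suc n)) (0ℚ ^ n))) (+-identityʳ 1ℚ)

1≤exp-partial : ∀ {a} → 0ℚ ≤ a → ∀ n → 1ℚ ≤ exp-partial a (suc n)
1≤exp-partial 0≤a n = subst (_≤ exp-partial _ (suc n)) (exp-partial-0 n) (exp-partial-mono ≤-refl 0≤a (suc n))

-- Keeps only the terms 1 and h of the series at h. Multiplication by h raises the degree by one,
-- hence the extra term on the right.
exp-partial-step : ∀ {a h} → 0ℚ ≤ a → 0ℚ ≤ h → ∀ n →
  (1ℚ + h) * exp-partial a n ≤ exp-partial (h + a) (suc n)
exp-partial-step {a} {h} 0≤a 0≤h zero    = subst (_≤ exp-partial (h + a) 1) (sym (*-zeroʳ (1ℚ + h)))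
  (0≤exp-partial (0≤+ 0≤h 0≤a) 1)
exp-partial-step {a} {h} 0≤a 0≤h (suc n) = subst₂ _≤_ lhs rhs
  (+-mono-≤ {s} {Σ< (suc (suc n)) (expTerm a)} (Σ<-≤ {expTerm a} (0≤expTerm 0≤a) (ℕ.n≤1+n (suc n)))
    (≤-by {expTerm h 1 * s} (Σ< n (conv (f₂) (expTerm a)))
      (0≤Σ< n (0≤conv {f₂} {expTerm a} (λ i → 0≤expTerm 0≤h (suc (suc i))) (0≤expTerm 0≤a))) refl))
  where
  f₁ f₂ : ℕ → ℚ
  f₁ i = expTerm h (suc i)
  f₂ i = f₁ (suc i)
  s = Σ< (suc n) (expTerm a)
  lhs : s + expTerm h 1 * s ≡ (1ℚ + h) * exp-partial a (suc n)
  lhs = trans (solve 2 (λ h s → s :+ con 1ℚ :* (h :* con 1ℚ) :* s := (con 1ℚ :+ h) :* s) refl h s)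
    (cong ((1ℚ + h) *_) (sym (exp-partial-Σ< a (suc n))))
  rhs : Σ< (suc (suc n)) (expTerm a) + (expTerm h 1 * s + Σ< n (conv (f₂) (expTerm a)))
    ≡ exp-partial (h + a) (suc (suc n))
  rhs = trans (cong₂ _+_ (sym (*-identityˡ (Σ< (suc (suc n)) (expTerm a)))) (sym (Σ<-conv n (f₁) (expTerm a))))
    (trans (sym (Σ<-conv (suc n) (expTerm h) (expTerm a))) (Σ<-conv-exp h a (suc (suc n))))

expCoeff≤1 : ∀ i → expCoeff i ≤ 1ℚ
expCoeff≤1 i = recip≤1 (fromℕℚ-mono {1} (ℕ.1≤n! i))

-- Since the coefficients are at most 1, the geometric series dominates; the bound 1/(1-c) is what
-- turns powers of n into rational powers below.
exp-partial-geometric : ∀ {c} → 0ℚ ≤ c → c ≤ 1ℚ → ∀ n → (1ℚ - c) * exp-partial c n ≤ 1ℚ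
exp-partial-geometric {c} 0≤c c≤1 n = ≤-trans (go n) (≤-by (c ^ n) (0≤^ 0≤c n)
  (solve 1 (λ p → con 1ℚ :- p :+ p := con 1ℚ) refl (c ^ n)))
  where
  go : ∀ n → (1ℚ - c) * exp-partial c n ≤ 1ℚ - c ^ n
  go zero    = ≤-reflexive (*-zeroʳ (1ℚ - c))
  go (suc n) = subst (_≤ 1ℚ - c * c ^ n) (sym (*-distribˡ-+ (1ℚ - c) (exp-partial c n) (expTerm c n)))
    (subst ((1ℚ - c) * exp-partial c n + (1ℚ - c) * expTerm c n ≤_) (solve 2 (λ c p → con 1ℚ :- p :+ (con 1ℚ :- c) :* p := con 1ℚ :- c :* p) refl c (c ^ n))
      (+-mono-≤ (go n) (*-monoˡ (1ℚ - c) (0≤q-p c≤1)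
        (subst (expTerm c n ≤_) (*-identityˡ (c ^ n)) (*-monoʳ (c ^ n) (0≤^ 0≤c n) (expCoeff≤1 n))))))

exp-partial-multiple : ∀ {c u} → 0ℚ ≤ c → c ≤ 1ℚ → u * (1ℚ - c) ≡ 1ℚ → 0ℚ ≤ u → ∀ m n →
  exp-partial (fromℕℚ m * c) (suc n) ≤ u ^ m
exp-partial-multiple {c} {u} 0≤c c≤1 eq 0≤u zero    n = ≤-reflexive
  (trans (cong (λ a → exp-partial a (suc n)) (*-zeroˡ c)) (exp-partial-0 n))
exp-partial-multiple {c} {u} 0≤c c≤1 eq 0≤u (suc m) n = ≤-trans
  (≤-reflexive (cong (λ a → exp-partial a (suc n))
    (trans (cong (_* c) (fromℕℚ-suc m)) (solve 2 (λ m c → (con 1ℚ :+ m) :* c := c :+ m :* c) refl (fromℕℚ m) c))))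
  (≤-trans (exp-partial-+≤ 0≤c 0≤mc (suc n))
    (*-mono (0≤exp-partial 0≤c (suc n)) (0≤^ 0≤u m) P≤u (exp-partial-multiple 0≤c c≤1 eq 0≤u m n)))
  where
  0≤mc = 0≤* (0≤fromℕℚ m) 0≤c
  P = exp-partial c (suc n)
  P≤u : P ≤ u
  P≤u = subst₂ _≤_ (trans (sym (*-assoc u (1ℚ - c) P)) (trans (cong (_* P) eq) (*-identityˡ P)))
    (*-identityʳ u) (*-monoˡ u 0≤u (exp-partial-geometric 0≤c c≤1 (suc n)))

-- The logarithm series

power-small : ∀ {u} → 0ℚ < u → u ≤ 1ℚ → ∀ ε → 0ℚ < ε → Eventually (λ m → (1ℚ - u) ^ m ≤ ε)
power-small {u} 0<u u≤1 ε 0<ε = N , λ m N≤m →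
  let ρᵐ = (1ℚ - u) ^ m
      0≤ρᵐ = 0≤^ (0≤q-p u≤1) m
      1≤mεu = ≤-trans 1≤Nεu (*-monoʳ (ε * u) (<⇒≤ 0<εu) (fromℕℚ-mono N≤m))
  in ≤-trans (subst (_≤ ρᵐ * (fromℕℚ m * (ε * u))) (*-identityʳ ρᵐ) (*-monoˡ ρᵐ 0≤ρᵐ 1≤mεu))
    (≤-trans (subst (_≤ ε * (ρᵐ * (1ℚ + fromℕℚ m * u)))
        (solve 4 (λ e p m u → e :* (p :* (m :* u)) := p :* (m :* (e :* u))) refl ε ρᵐ (fromℕℚ m) u)
        (*-monoˡ ε 0≤ε (*-monoˡ ρᵐ 0≤ρᵐ (≤-by 1ℚ 0≤1 (+-comm (fromℕℚ m * u) 1ℚ)))))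
      (subst (ε * (ρᵐ * (1ℚ + fromℕℚ m * u)) ≤_) (*-identityʳ ε)
        (*-monoˡ ε 0≤ε (geometric (artanh-dominated u 0<u u≤1) m))))
  where
  0≤ε = <⇒≤ 0<ε
  0<εu = 0<* 0<ε 0<u
  N = proj₁ (∃-fromℕℚ* 1ℚ (ε * u) 0<εu)
  1≤Nεu = proj₂ (∃-fromℕℚ* 1ℚ (ε * u) 0<εu)

geo : ℚ → ℕ → ℚ
geo w zero    = 0ℚ
geo w (suc m) = geo w m + w ^ m

geo-sum : ∀ w m → (1ℚ - w) * geo w m ≡ 1ℚ - w ^ m
geo-sum w zero    = *-zeroʳ (1ℚ - w)
geo-sum w (suc m) = trans (*-distribˡ-+ (1ℚ - w) (geo w m) (w ^ m))
  (trans (cong (_+ (1ℚ - w) * w ^ m) (geo-sum w m))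
    (solve 2 (λ w p → con 1ℚ :- p :+ (con 1ℚ :- w) :* p := con 1ℚ :- w :* p) refl w (w ^ m)))

0≤geo : ∀ {w} → 0ℚ ≤ w → ∀ m → 0ℚ ≤ geo w m
0≤geo 0≤w zero    = ≤-refl
0≤geo 0≤w (suc m) = 0≤+ (0≤geo 0≤w m) (0≤^ 0≤w m)

odd : ℕ → ℚ
odd j = fromℕℚ (suc (2 ℕ.* j))

odd-suc : ∀ j → odd (suc j) ≡ 1ℚ + 1ℚ + odd j
odd-suc j = trans (cong (λ m → fromℕℚ (suc m)) (ℕ.*-suc 2 j))
  (trans (fromℕℚ-suc (suc (suc (2 ℕ.* j))))
    (trans (cong (λ q → 1ℚ + q) (fromℕℚ-suc (suc (2 ℕ.* j)))) (sym (+-assoc 1ℚ 1ℚ (odd j)))))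

artanhPartial : ℚ → ℕ → ℚ
artanhPartial z m = z * partial artanhCoeff (z * z) m

module _ {a b : ℚ} (0≤a : 0ℚ ≤ a) (a≤b : a ≤ b) where
  private
    0≤b = ≤-trans 0≤a a≤b
    0≤d = 0≤q-p a≤b
    A B : ℕ → ℚ
    A j = (a * a) ^ j
    B j = (b * b) ^ j
    0≤A : ∀ j → 0ℚ ≤ A j
    0≤A = 0≤^ (0≤* 0≤a 0≤a)
    0≤B : ∀ j → 0ℚ ≤ B j
    0≤B = 0≤^ (0≤* 0≤b 0≤b)
    A≤B : ∀ j → A j ≤ B j
    A≤B = ^-mono (0≤* 0≤a 0≤a) (*-mono 0≤a 0≤b a≤b a≤b)

  -- This and `power-upper` are the mean value inequalities for z^(2j+1), proved by induction in
  -- place of calculus.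
  power-lower : ∀ j → odd j * (A j * (b - a)) ≤ b * B j - a * A j
  power-lower zero    = ≤-reflexive (solve 2 (λ a b → con 1ℚ :* (con 1ℚ :* (b :- a)) := b :* con 1ℚ :- a :* con 1ℚ) refl a b)
  power-lower (suc j) = ≤-by
    (a * a * (b * B j - a * A j - odd j * (A j * (b - a)))
      + (b - a) * ((b - a) * b * B j + (b - a) * (a + a) * B j + (a * a * (B j - A j) + a * a * (B j - A j))))
    (0≤+ (0≤* (0≤* 0≤a 0≤a) (0≤q-p (power-lower j)))
      (0≤* 0≤d (0≤+ (0≤+ (0≤* (0≤* 0≤d 0≤b) (0≤B j)) (0≤* (0≤* 0≤d (0≤+ 0≤a 0≤a)) (0≤B j)))
        (0≤+ 0≤aaBA 0≤aaBA))))
    (trans (cong (λ o → o * (A (suc j) * (b - a)) + d) (odd-suc j))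
      (solve 5 (λ a b A B o → (con 1ℚ :+ con 1ℚ :+ o) :* (a :* a :* A :* (b :- a)) :+
        (a :* a :* (b :* B :- a :* A :- o :* (A :* (b :- a)))
         :+ (b :- a) :* ((b :- a) :* b :* B :+ (b :- a) :* (a :+ a) :* B :+ (a :* a :* (B :- A) :+ a :* a :* (B :- A))))
        := b :* (b :* b :* B) :- a :* (a :* a :* A)) refl a b (A j) (B j) (odd j)))
    where
    0≤aaBA = 0≤* (0≤* 0≤a 0≤a) (0≤q-p (A≤B j))
    d = a * a * (b * B j - a * A j - odd j * (A j * (b - a)))
      + (b - a) * ((b - a) * b * B j + (b - a) * (a + a) * B j + (a * a * (B j - A j) + a * a * (B j - A j)))

  power-upper : ∀ j → b * B j - a * A j ≤ odd j * (B j * (b - a))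
  power-upper zero    = ≤-reflexive (solve 2 (λ a b → b :* con 1ℚ :- a :* con 1ℚ := con 1ℚ :* (con 1ℚ :* (b :- a))) refl a b)
  power-upper (suc j) = ≤-by d
    (0≤+ (0≤* (0≤* 0≤b 0≤b) (0≤q-p (power-upper j)))
      (0≤* 0≤d (0≤+ (0≤* (0≤+ (0≤* 0≤b 0≤b) (0≤* 0≤b 0≤b)) (0≤q-p (A≤B j)))
        (0≤* (0≤* 0≤d (0≤+ (0≤+ 0≤b 0≤b) 0≤a)) (0≤A j)))))
    (trans (solve 5 (λ a b A B o → b :* (b :* b :* B) :- a :* (a :* a :* A) :+
        (b :* b :* (o :* (B :* (b :- a)) :- (b :* B :- a :* A))
         :+ (b :- a) :* ((b :* b :+ b :* b) :* (B :- A) :+ (b :- a) :* (b :+ b :+ a) :* A))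
        := (con 1ℚ :+ con 1ℚ :+ o) :* (b :* b :* B :* (b :- a))) refl a b (A j) (B j) (odd j))
      (cong (λ o → o * (B (suc j) * (b - a))) (sym (odd-suc j))))
    where
    d = b * b * (odd j * (B j * (b - a)) - (b * B j - a * A j))
      + (b - a) * ((b * b + b * b) * (B j - A j) + (b - a) * (b + b + a) * A j)

  private
    coeff*odd : ∀ j z → artanhCoeff j * (odd j * z) ≡ z
    coeff*odd j z = trans (sym (*-assoc (artanhCoeff j) (odd j) z))
      (trans (cong (_* z) (trans (*-comm (artanhCoeff j) (odd j)) (*-recip (0<fromℕℚ-suc (2 ℕ.* j))))) (*-identityˡ z))
    0≤coeff : ∀ j → 0ℚ ≤ artanhCoeff j
    0≤coeff j = <⇒≤ (0<recip (0<fromℕℚ-suc (2 ℕ.* j)))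
    split : ∀ m → artanhPartial b (suc m) - artanhPartial a (suc m)
      ≡ (artanhPartial b m - artanhPartial a m) + artanhCoeff m * (b * B m - a * A m)
    split m = solve 7 (λ a b p q c A B → b :* (q :+ c :* B) :- a :* (p :+ c :* A)
        := (b :* q :- a :* p) :+ c :* (b :* B :- a :* A))
      refl a b (partial artanhCoeff (a * a) m) (partial artanhCoeff (b * b) m) (artanhCoeff m) (A m) (B m)

  -- Dividing by 2j+1 cancels the derivative's factor, so the increments of artanh are compared with
  -- partial sums of its derivative 1/(1-z²).
  artanh-lower : ∀ m → geo (a * a) m * (b - a) ≤ artanhPartial b m - artanhPartial a m
  artanh-lower zero    = ≤-reflexive (solve 2 (λ a b → con 0ℚ :* (b :- a) := b :* con 0ℚ :- a :* con 0ℚ) refl a b)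
  artanh-lower (suc m) = subst₂ _≤_ (sym (*-distribʳ-+ (b - a) (geo (a * a) m) (A m))) (sym (split m))
    (+-mono-≤ (artanh-lower m) (subst (_≤ artanhCoeff m * (b * B m - a * A m)) (coeff*odd m (A m * (b - a)))
      (*-monoˡ (artanhCoeff m) (0≤coeff m) (power-lower m))))

  artanh-upper : ∀ m → artanhPartial b m - artanhPartial a m ≤ geo (b * b) m * (b - a)
  artanh-upper zero    = ≤-reflexive (solve 2 (λ a b → b :* con 0ℚ :- a :* con 0ℚ := con 0ℚ :* (b :- a)) refl a b)
  artanh-upper (suc m) = subst₂ _≤_ (sym (split m)) (sym (*-distribʳ-+ (b - a) (geo (b * b) m) (B m)))
    (+-mono-≤ (artanh-upper m) (subst (artanhCoeff m * (b * B m - a * A m) ≤_) (coeff*odd m (B m * (b - a)))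
      (*-monoˡ (artanhCoeff m) (0≤coeff m) (power-upper m))))

cay : ℚ → ℚ
cay x = (x - 1ℚ) * recip (x + 1ℚ)

-- By definition the m-th approximation of `log`, as a function of the m-th approximation of the
-- argument; hence its bounds apply to `ln n` and to the logarithm of `ln n` alike.
logPartial : ℚ → ℕ → ℚ
logPartial x m = fromℕℚ 2 * cay x * partial artanhCoeff (cay x * cay x) m

logPartial-1 : ∀ m → logPartial 1ℚ m ≡ 0ℚ
logPartial-1 m = *-zeroˡ (partial artanhCoeff (cay 1ℚ * cay 1ℚ) m)

module _ {x y : ℚ} (1≤x : 1ℚ ≤ x) (x≤y : x ≤ y) where
  private
    1≤y = ≤-trans 1≤x x≤y
    r = recip (x + 1ℚ)
    s = recip (y + 1ℚ)
    0≤x = ≤-trans 0≤1 1≤x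
    0<x+1′ : 0ℚ < x + 1ℚ
    0<x+1′ = <-≤-trans 0<1 (≤-by x 0≤x (+-comm 1ℚ x))
    0<y+1′ : 0ℚ < y + 1ℚ
    0<y+1′ = <-≤-trans 0<x+1′ (+-monoˡ-≤ 1ℚ x≤y)
    xr : (x + 1ℚ) * r ≡ 1ℚ
    xr = *-recip 0<x+1′
    ys : (y + 1ℚ) * s ≡ 1ℚ
    ys = *-recip 0<y+1′
    0≤r = <⇒≤ (0<recip 0<x+1′)
    0<r = 0<recip 0<x+1′
    0≤s = <⇒≤ (0<recip 0<y+1′)
    s≤r : s ≤ r
    s≤r = recip-≤ 0<x+1′ (+-monoˡ-≤ 1ℚ x≤y)
    a = cay x
    b = cay y
    a≡ : a ≡ 1ℚ - (r + r)
    a≡ = trans (solve 2 (λ x r → (x :- con 1ℚ) :* r := (x :+ con 1ℚ) :* r :- (r :+ r)) refl x r) (cong (_- (r + r)) xr)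
    b≡ : b ≡ 1ℚ - (s + s)
    b≡ = trans (solve 2 (λ x r → (x :- con 1ℚ) :* r := (x :+ con 1ℚ) :* r :- (r :+ r)) refl y s) (cong (_- (s + s)) ys)
    0≤a : 0ℚ ≤ a
    0≤a = 0≤* (0≤q-p 1≤x) 0≤r
    a≤b : a ≤ b
    a≤b = subst₂ _≤_ (sym a≡) (sym b≡) (+-monoʳ-≤ 1ℚ (neg-antimono-≤ (+-mono-≤ s≤r s≤r)))
    0≤b = ≤-trans 0≤a a≤b
    r-s : r - s ≡ (y - x) * (r * s)
    r-s = trans (cong₂ _-_ (sym (*-identityʳ r)) (sym (*-identityʳ s)))
      (trans (cong₂ (λ u v → r * u - s * v) (sym ys) (sym xr)) lem)
      where
      lem : r * ((y + 1ℚ) * s) - s * ((x + 1ℚ) * r) ≡ (y - x) * (r * s)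
      lem = solve 4 (λ r s x y → r :* ((y :+ con 1ℚ) :* s) :- s :* ((x :+ con 1ℚ) :* r) := (y :- x) :* (r :* s)) refl r s x y
    b-a : b - a ≡ (r - s) + (r - s)
    b-a = trans (cong₂ _-_ b≡ a≡) (solve 2 (λ r s → con 1ℚ :- (s :+ s) :- (con 1ℚ :- (r :+ r)) := (r :- s) :+ (r :- s)) refl r s)
    log-diff : ∀ m → logPartial y m - logPartial x m ≡ fromℕℚ 2 * (artanhPartial b m - artanhPartial a m)
    log-diff m = solve 4 (λ a b p q → con (fromℕℚ 2) :* b :* q :- con (fromℕℚ 2) :* a :* p
        := con (fromℕℚ 2) :* (b :* q :- a :* p)) refl a b (partial artanhCoeff (a * a) m) (partial artanhCoeff (b * b) m)

  logPartial-mono : ∀ m → logPartial x m ≤ logPartial y m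
  logPartial-mono m = ≤-by (logPartial y m - logPartial x m)
    (subst (0ℚ ≤_) (sym (log-diff m)) (0≤* (0≤fromℕℚ 2)
      (≤-trans (0≤* (0≤geo (0≤* 0≤a 0≤a) m) (0≤q-p a≤b)) (artanh-lower 0≤a a≤b m))))
    (solve 2 (λ u v → u :+ (v :- u) := v) refl (logPartial x m) (logPartial y m))

  -- With r = 1/(x+1) and s = 1/(y+1), the Cayley transforms are a = 1-2r and b = 1-2s. They differ
  -- by 2(y-x)rs, and the geometric sum at b² is at most 1/(1-b²) = 1/(4s(1-s)). What remains is xr
  -- = 1-r ≤ 1-s.
  logPartial-upper : ∀ m → x * (logPartial y m - logPartial x m) ≤ y - x
  logPartial-upper m = ≤-trans
    (*-monoˡ x 0≤x (subst (_≤ fromℕℚ 2 * (geo (b * b) m * (b - a))) (sym (log-diff m))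
      (*-monoˡ (fromℕℚ 2) (0≤fromℕℚ 2) (artanh-upper 0≤a a≤b m))))
    (≤-trans (≤-reflexive eq)
      (≤-trans (*-monoˡ (y - x) (0≤q-p x≤y) factor≤1) (≤-reflexive (*-identityʳ (y - x)))))
    where
    g = geo (b * b) m
    0≤g = 0≤geo (0≤* 0≤b 0≤b) m
    four = fromℕℚ 4
    eq : x * (fromℕℚ 2 * (g * (b - a))) ≡ (y - x) * (four * (1ℚ - r) * s * g)
    eq = trans (cong (λ z → x * (fromℕℚ 2 * (g * z))) (trans b-a (cong₂ _+_ r-s r-s)))
      (trans (solve 5 (λ x y g r s → x :* (con (fromℕℚ 2) :* (g :* ((y :- x) :* (r :* s) :+ (y :- x) :* (r :* s))))
          := (y :- x) :* (con (fromℕℚ 4) :* ((x :+ con 1ℚ) :* r :- r) :* s :* g)) refl x y g r s)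
        (cong (λ z → (y - x) * (four * (z - r) * s * g)) xr))
    factor≤1 : four * (1ℚ - r) * s * g ≤ 1ℚ
    factor≤1 = ≤-trans (≤-by (four * (r - s) * s * g) (0≤* (0≤* (0≤* (0≤fromℕℚ 4) (0≤q-p s≤r)) 0≤s) 0≤g)
        (solve 3 (λ r s g → con (fromℕℚ 4) :* (con 1ℚ :- r) :* s :* g :+ con (fromℕℚ 4) :* (r :- s) :* s :* g
          := (con 1ℚ :- (con 1ℚ :- (s :+ s)) :* (con 1ℚ :- (s :+ s))) :* g) refl r s g))
      (≤-trans (≤-reflexive (cong (λ z → (1ℚ - z * z) * g) (sym b≡)))
        (≤-trans (≤-reflexive (geo-sum (b * b) m))
          (≤-by ((b * b) ^ m) (0≤^ (0≤* 0≤b 0≤b) m) (solve 1 (λ p → con 1ℚ :- p :+ p := con 1ℚ) refl ((b * b) ^ m)))))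

  -- Here truncation works against the bound: the geometric sum at a² falls short of 1/(1-a²). As x
  -- < y, there is a positive slack r-s that absorbs the remainder once (a²)^m is below it.
  logPartial-lower : x < y → Eventually (λ m → y - x ≤ y * (logPartial y m - logPartial x m))
  logPartial-lower x<y = eventually₁ bound (power-small 0<u u≤1 (r - s) 0<r-s)
    where
    four = fromℕℚ 4
    0<s = 0<recip 0<y+1′
    0<r-s : 0ℚ < r - s
    0<r-s = subst (0ℚ <_) (sym r-s) (0<* (subst (_< y - x) (+-inverseʳ x) (+-monoˡ-< (- x) x<y)) (0<* 0<r 0<s))
    u = 1ℚ - a * a
    u≡ : u ≡ four * r * (1ℚ - r)
    u≡ = trans (cong (λ z → 1ℚ - z * z) a≡) (solve 1 (λ r → con 1ℚ :- (con 1ℚ :- (r :+ r)) :* (con 1ℚ :- (r :+ r))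
      := con (fromℕℚ 4) :* r :* (con 1ℚ :- r)) refl r)
    1-r≡ : 1ℚ - r ≡ x * r
    1-r≡ = trans (cong (_- r) (sym xr)) (solve 2 (λ x r → (x :+ con 1ℚ) :* r :- r := x :* r) refl x r)
    0<1-r : 0ℚ < 1ℚ - r
    0<1-r = subst (0ℚ <_) (sym 1-r≡) (0<* (<-≤-trans 0<1 1≤x) 0<r)
    0<u : 0ℚ < u
    0<u = subst (0ℚ <_) (sym u≡) (0<* (0<* (0<fromℕℚ-suc 3) 0<r) 0<1-r)
    u≤1 : u ≤ 1ℚ
    u≤1 = ≤-by (a * a) (0≤* 0≤a 0≤a) (solve 1 (λ p → con 1ℚ :- p :+ p := con 1ℚ) refl (a * a))
    bound : ∀ m → (1ℚ - u) ^ m ≤ r - s → y - x ≤ y * (logPartial y m - logPartial x m)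
    bound m h = ≤-trans (≤-reflexive (sym (*-identityʳ (y - x))))
      (≤-trans (*-monoˡ (y - x) (0≤q-p x≤y) 1≤factor) (≤-trans (≤-reflexive (sym eq))
      (*-monoˡ y (≤-trans 0≤x x≤y) (subst (fromℕℚ 2 * (g * (b - a)) ≤_) (sym (log-diff m))
        (*-monoˡ (fromℕℚ 2) (0≤fromℕℚ 2) (artanh-lower 0≤a a≤b m))))))
      where
      g = geo (a * a) m
      qᵐ = (a * a) ^ m
      0≤qᵐ = 0≤^ (0≤* 0≤a 0≤a) m
      qᵐ≤ : qᵐ ≤ r - s
      qᵐ≤ = subst (λ z → z ^ m ≤ r - s) (solve 1 (λ p → con 1ℚ :- (con 1ℚ :- p) := p) refl (a * a)) h
      eq : y * (fromℕℚ 2 * (g * (b - a))) ≡ (y - x) * (four * (1ℚ - s) * r * g)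
      eq = trans (cong (λ z → y * (fromℕℚ 2 * (g * z))) (trans b-a (cong₂ _+_ r-s r-s)))
        (trans (solve 5 (λ x y g r s → y :* (con (fromℕℚ 2) :* (g :* ((y :- x) :* (r :* s) :+ (y :- x) :* (r :* s))))
            := (y :- x) :* (con (fromℕℚ 4) :* ((y :+ con 1ℚ) :* s :- s) :* r :* g)) refl x y g r s)
          (cong (λ z → (y - x) * (four * (z - s) * r * g)) ys))
      ug : four * r * (1ℚ - r) * g ≡ 1ℚ - qᵐ
      ug = trans (cong (_* g) (sym u≡)) (geo-sum (a * a) m)
      1≤factor : 1ℚ ≤ four * (1ℚ - s) * r * g
      1≤factor = *-cancelˡ-≤ (1ℚ - r) 0<1-r (≤-trans
        (≤-by ((r - s - qᵐ) + s * qᵐ) (0≤+ (0≤q-p qᵐ≤) (0≤* 0≤s 0≤qᵐ))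
          (solve 3 (λ r s z → (con 1ℚ :- r) :* con 1ℚ :+ ((r :- s :- z) :+ s :* z) := (con 1ℚ :- s) :* (con 1ℚ :- z)) refl r s qᵐ))
        (≤-reflexive (trans (cong ((1ℚ - s) *_) (sym ug))
          (solve 3 (λ r s g → (con 1ℚ :- s) :* (con (fromℕℚ 4) :* r :* (con 1ℚ :- r) :* g)
            := (con 1ℚ :- r) :* (con (fromℕℚ 4) :* (con 1ℚ :- s) :* r :* g)) refl r s g))))

-- Each doubling contributes (y-x)/y = 1/2; the companion upper bound uses (y-x)/x = 1. These crude
-- values of log 2 suffice to compare log n with `L`.
logPartial-2^-lower : ∀ M → Eventually (λ m → fromℕℚ M * ½ ≤ logPartial (fromℕℚ (2 ℕ.^ M)) m)
logPartial-2^-lower zero    = always λ m → ≤-reflexive (trans (*-zeroˡ ½) (sym (logPartial-1 m)))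
logPartial-2^-lower (suc M) = eventually₂ step (logPartial-2^-lower M) (logPartial-lower 1≤x (<⇒≤ x<y) x<y)
  where
  x = fromℕℚ (2 ℕ.^ M)
  y = fromℕℚ (2 ℕ.^ suc M)
  1≤x : 1ℚ ≤ x
  1≤x = fromℕℚ-mono {1} (ℕ.m^n>0 2 M)
  y≡ : y ≡ x + x
  y≡ = trans (fromℕℚ-* 2 (2 ℕ.^ M)) (solve 1 (λ x → con (fromℕℚ 2) :* x := x :+ x) refl x)
  0<x = <-≤-trans 0<1 1≤x
  x<y : x < y
  x<y = <-by x 0<x (sym y≡)
  step : ∀ m → fromℕℚ M * ½ ≤ logPartial x m → y - x ≤ y * (logPartial y m - logPartial x m) →
    fromℕℚ (suc M) * ½ ≤ logPartial y m
  step m h₁ h₂ = subst (_≤ logPartial y m)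
    (trans (solve 1 (λ k → k :* con ½ :+ con ½ := (con 1ℚ :+ k) :* con ½) refl (fromℕℚ M))
      (cong (_* ½) (sym (fromℕℚ-suc M))))
    (≤-trans (+-mono-≤ h₁ ½≤) (≤-reflexive
      (solve 2 (λ u v → u :+ (v :- u) := v) refl (logPartial x m) (logPartial y m))))
    where
    ½≤ : ½ ≤ logPartial y m - logPartial x m
    ½≤ = *-cancelˡ-≤ y (<-≤-trans 0<x (<⇒≤ x<y)) (subst (_≤ y * (logPartial y m - logPartial x m))
      (trans (cong (_- x) y≡) (trans (solve 1 (λ x → x :+ x :- x := (x :+ x) :* con ½) refl x) (cong (_* ½) (sym y≡)))) h₂)

logPartial-2^-upper : ∀ M m → logPartial (fromℕℚ (2 ℕ.^ M)) m ≤ fromℕℚ M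
logPartial-2^-upper zero    m = ≤-reflexive (logPartial-1 m)
logPartial-2^-upper (suc M) m = ≤-trans (≤-reflexive
    (solve 2 (λ u v → v := (v :- u) :+ u) refl (logPartial x m) (logPartial y m)))
  (≤-trans (+-mono-≤ ≤1 (logPartial-2^-upper M m)) (≤-reflexive (sym (fromℕℚ-suc M))))
  where
  x = fromℕℚ (2 ℕ.^ M)
  y = fromℕℚ (2 ℕ.^ suc M)
  1≤x : 1ℚ ≤ x
  1≤x = fromℕℚ-mono {1} (ℕ.m^n>0 2 M)
  0<x = <-≤-trans 0<1 1≤x
  y≡ : y ≡ x + x
  y≡ = trans (fromℕℚ-* 2 (2 ℕ.^ M)) (solve 1 (λ x → con (fromℕℚ 2) :* x := x :+ x) refl x)
  ≤1 : logPartial y m - logPartial x m ≤ 1ℚ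
  ≤1 = *-cancelˡ-≤ x 0<x (≤-trans (logPartial-upper 1≤x (≤-by x (<⇒≤ 0<x) (sym y≡)) m)
    (≤-reflexive (trans (cong (_- x) y≡) (solve 1 (λ x → x :+ x :- x := x :* con 1ℚ) refl x))))

-- A lower bound for exp (log x)

¼ : ℚ
¼ = + 1 / 4

-- A lower bound for log on the grid ¼ℕ.  The mesh determines the constant 4/5 in exp (log x) ≥ 4/5 x below,
-- which has to exceed 96/121 for the factor 22 of the bias to suffice.
harmonic : ℕ → ℚ
harmonic zero    = 0ℚ
harmonic (suc i) = recip (fromℕℚ (5 ℕ.+ i)) + harmonic i

0≤harmonic : ∀ i → 0ℚ ≤ harmonic i
0≤harmonic zero    = ≤-refl
0≤harmonic (suc i) = 0≤+ (<⇒≤ (0<recip (0<fromℕℚ-suc (4 ℕ.+ i)))) (0≤harmonic i)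

-- One grid step adds (y-x)/y = (1/4) / ((5+i)/4) = 1/(5+i).
logPartial-grid : ∀ i → Eventually (λ m → harmonic i ≤ logPartial (fromℕℚ (4 ℕ.+ i) * ¼) m)
logPartial-grid zero    = always λ m → ≤-reflexive (sym (logPartial-1 m))
logPartial-grid (suc i) = eventually₂ step (logPartial-grid i) (logPartial-lower 1≤x (<⇒≤ x<y) x<y)
  where
  p = fromℕℚ (5 ℕ.+ i)
  x = fromℕℚ (4 ℕ.+ i) * ¼
  y = p * ¼
  y≡ : y ≡ x + ¼
  y≡ = trans (cong (_* ¼) (fromℕℚ-suc (4 ℕ.+ i)))
    (solve 1 (λ k → (con 1ℚ :+ k) :* con ¼ := k :* con ¼ :+ con ¼) refl (fromℕℚ (4 ℕ.+ i)))
  x<y : x < y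
  x<y = <-by ¼ (positive⁻¹ ¼) (sym y≡)
  1≤x : 1ℚ ≤ x
  1≤x = *-monoʳ ¼ (nonNegative⁻¹ ¼) (fromℕℚ-mono {4} {4 ℕ.+ i} (ℕ.m≤m+n 4 i))
  step : ∀ m → harmonic i ≤ logPartial x m → y - x ≤ y * (logPartial y m - logPartial x m) →
    recip p + harmonic i ≤ logPartial y m
  step m h₁ h₂ = ≤-trans (+-mono-≤ r≤ h₁) (≤-reflexive
      (solve 2 (λ u v → (v :- u) :+ u := v) refl (logPartial x m) (logPartial y m)))
    where
    r≤ : recip p ≤ logPartial y m - logPartial x m
    r≤ = *-cancelˡ-≤ y (<-≤-trans 0<1 (≤-trans 1≤x (<⇒≤ x<y)))
      (subst (_≤ y * (logPartial y m - logPartial x m))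
        (trans (cong (_- x) y≡) (trans (solve 1 (λ x → x :+ con ¼ :- x := con 1ℚ :* con ¼) refl x)
          (trans (cong (_* ¼) (sym (*-recip (0<fromℕℚ-suc (4 ℕ.+ i)))))
            (solve 2 (λ p r → p :* r :* con ¼ := p :* con ¼ :* r) refl p (recip p))))) h₂)

⅕ : ℚ
⅕ = + 1 / 5

-- The product of the factors 1 + 1/(5+j) telescopes to (5+i)/5, which is (4x+1)/5 at the grid point
-- x = (4+i)/4.
exp-harmonic : ∀ i n → i ℕ.≤ n → fromℕℚ (5 ℕ.+ i) * ⅕ ≤ exp-partial (harmonic i) (suc n)
exp-harmonic zero    n       i≤n = 1≤exp-partial ≤-refl n
exp-harmonic (suc i) (suc n) (ℕ.s≤s i≤n) = ≤-trans (≤-reflexive eq)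
  (≤-trans (*-monoˡ (1ℚ + r) (0≤+ 0≤1 0≤r) (exp-harmonic i n i≤n))
    (exp-partial-step (0≤harmonic i) 0≤r (suc n)))
  where
  p = fromℕℚ (5 ℕ.+ i)
  r = recip p
  0≤r = <⇒≤ (0<recip (0<fromℕℚ-suc (4 ℕ.+ i)))
  eq : fromℕℚ (6 ℕ.+ i) * ⅕ ≡ (1ℚ + r) * (p * ⅕)
  eq = trans (cong (_* ⅕) (trans (fromℕℚ-suc (5 ℕ.+ i)) (cong (_+ p) (sym (*-recip (0<fromℕℚ-suc (4 ℕ.+ i)))))))
    (solve 2 (λ p r → (p :* r :+ p) :* con ⅕ := (con 1ℚ :+ r) :* (p :* con ⅕)) refl p r)

-- Real exponentials and powers of log n

eventually≥ᴺ : ∀ N → Eventually (λ m → N ℕ.≤ m)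
eventually≥ᴺ N = N , λ m h → h

eventually-× : ∀ {P Q : ℕ → Set} → Eventually P → Eventually Q → Eventually (λ m → P m × Q m)
eventually-× = eventually₂ (λ _ → _,_)

-- Only a rational lower bound `H` for the sum of the exponents enters. The error of `exp-+` is
-- uniform on bounded arguments, and the two sequences of approximations are bounded.
exp-product : ∀ a b {H c} → 0ℚ ≤ H → Eventually (λ m → H ≤ seq a m + seq b m) →
  Eventually (λ m → c ≤ exp-partial H m) → ∀ ε → 0ℚ < ε →
  Eventually (λ m → c ≤ seq (exp a) m * seq (exp b) m + ε)
exp-product a b {H} {c} 0≤H H≤ c≤ ε 0<ε =
  eventually₂ (λ m h₁ h₂ → step m h₁ (proj₁ h₂) (proj₂ h₂)) (N , λ m h → h)
    (eventually-× (eventually-× evK evL) (eventually-× H≤ c≤))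
  where
  K = proj₁ (Cauchy-bounded (cauchy a))
  L = proj₁ (Cauchy-bounded (cauchy b))
  evK : Eventually (λ m → ∣ seq a m ∣ ≤ K)
  evK = proj₂ (proj₂ (Cauchy-bounded (cauchy a)))
  evL : Eventually (λ m → ∣ seq b m ∣ ≤ L)
  evL = proj₂ (proj₂ (Cauchy-bounded (cauchy b)))
  k = proj₁ (∃-fromℕℚ≥ (K + L))
  K+L≤ : K + L ≤ fromℕℚ (suc k)
  K+L≤ = ≤-trans (proj₂ (∃-fromℕℚ≥ (K + L))) (fromℕℚ-mono (ℕ.n≤1+n k))
  N = proj₁ (exp-+ k ε 0<ε)
  step : ∀ m → N ℕ.≤ m → ∣ seq a m ∣ ≤ K × ∣ seq b m ∣ ≤ L →
    H ≤ seq a m + seq b m × c ≤ exp-partial H m → c ≤ seq (exp a) m * seq (exp b) m + ε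
  step m N≤m (a≤K , b≤L) (H≤ab , c≤P) = ≤-trans c≤P (≤-trans (exp-partial-mono 0≤H H≤ab m)
    (∣∣≤⇒≤+ (subst (_≤ ε) (∣-∣-comm (exp-partial (seq a m) m * exp-partial (seq b m) m) (exp-partial (seq a m + seq b m) m))
      (proj₂ (exp-+ k ε 0<ε) m N≤m (seq a m) (seq b m) (≤-trans (+-mono-≤ a≤K b≤L) K+L≤)))))

exp-inverse : ∀ a b → (∀ m → 0ℚ ≤ seq a m + seq b m) → ∀ ε → 0ℚ < ε →
  Eventually (λ m → 1ℚ ≤ seq (exp a) m * seq (exp b) m + ε)
exp-inverse a b h = exp-product a b ≤-refl (always h)
  (1 , λ { (suc m) _ → ≤-reflexive (sym (exp-partial-0 m)) })

-- At a negative argument the terms alternate in sign. But the product with the partial sum at the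
-- opposite argument, which is nonnegative, is eventually at least 1/2.
exp-nonneg : ∀ a → Eventually (λ m → 0ℚ ≤ seq (exp a) m)
exp-nonneg a = eventually₁ (λ m h → by-sign m h (≤-total 0ℚ (seq a m)))
  (exp-inverse a (-ℝ a) (λ m → ≤-reflexive (sym (+-inverseʳ (seq a m)))) ½ 0<½)
  where
  by-sign : ∀ m → 1ℚ ≤ seq (exp a) m * seq (exp (-ℝ a)) m + ½ → 0ℚ ≤ seq a m ⊎ seq a m ≤ 0ℚ → 0ℚ ≤ seq (exp a) m
  by-sign m h (inj₁ 0≤a) = 0≤exp-partial 0≤a m
  by-sign m h (inj₂ a≤0) = ≮⇒≥ λ P<0 → <-irrefl refl (<-≤-trans ½<1 (≤-trans h
    (≤-trans (+-monoˡ-≤ ½ (subst (seq (exp a) m * Q ≤_) (*-zeroˡ Q) (*-monoʳ Q 0≤Q (<⇒≤ P<0)))) (≤-reflexive (+-identityˡ ½)))))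
    where
    Q = seq (exp (-ℝ a)) m
    0≤Q : 0ℚ ≤ Q
    0≤Q = 0≤exp-partial (neg-antimono-≤ a≤0) m
    ½<1 : ½ < 1ℚ
    ½<1 = <-by ½ 0<½ refl

module _ (n : ℕ) .{{_ : NonTrivial n}} (L : ℕ) where

  ln≥ : 2 ℕ.^ (L ℕ.+ L) ℕ.≤ n → Eventually (λ m → fromℕℚ L ≤ seq (ln n) m)
  ln≥ h = eventually₁ (λ m p → ≤-trans (≤-reflexive eq) (≤-trans p
      (logPartial-mono (fromℕℚ-mono {1} (ℕ.m^n>0 2 (L ℕ.+ L))) (fromℕℚ-mono h) m)))
    (logPartial-2^-lower (L ℕ.+ L))
    where
    eq : fromℕℚ L ≡ fromℕℚ (L ℕ.+ L) * ½
    eq = trans (solve 1 (λ l → l := (l :+ l) :* con ½) refl (fromℕℚ L)) (cong (_* ½) (sym (fromℕℚ-+ L L)))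

  ln≤ : n ℕ.≤ 2 ℕ.^ L → ∀ m → seq (ln n) m ≤ fromℕℚ L
  ln≤ h m = ≤-trans (logPartial-mono (fromℕℚ-mono {1} (ℕ.<⇒≤ (ℕ.nonTrivial⇒n>1 n))) (fromℕℚ-mono h) m)
    (logPartial-2^-upper L m)

  0≤ln : ∀ m → 0ℚ ≤ seq (ln n) m
  0≤ln m = ≤-trans (≤-reflexive (sym (logPartial-1 m)))
    (logPartial-mono ≤-refl (fromℕℚ-mono {1} (ℕ.<⇒≤ (ℕ.nonTrivial⇒n>1 n))) m)

  -- Goes through the reciprocal: n^c ≤ u^L with u = 1/(1-c), by `ln≤` and `exp-partial-multiple`,
  -- while n^c times n^(-c) is at least 1 up to ε; v is 1/u.
  n^-c≥ : n ℕ.≤ 2 ℕ.^ L → ∀ {c u v} → 0ℚ ≤ c → c ≤ 1ℚ → u * (1ℚ - c) ≡ 1ℚ → 0ℚ ≤ u → u * v ≡ 1ℚ →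
    0ℚ ≤ v → v ≤ 1ℚ → ∀ ε → 0ℚ < ε → Eventually (λ m → v ^ L ≤ seq (n ^ℝ (-ℝ fromℚ c)) m + ε)
  n^-c≥ n≤ {c} {u} {v} 0≤c c≤1 eq 0≤u uv 0≤v v≤1 ε 0<ε =
    eventually₂ (λ m h (0≤P , 1≤m) → step m h 0≤P 1≤m)
      (exp-inverse a b (λ m → ≤-reflexive (sym (solve 2 (λ c w → (:- c) :* w :+ c :* w := con 0ℚ) refl c (seq (ln n) m)))) ε 0<ε)
      (eventually-× (exp-nonneg a) (eventually≥ᴺ 1))
    where
    a b : ℝ
    a = (-ℝ fromℚ c) *ℝ ln n
    b = fromℚ c *ℝ ln n
    0≤vᴸ = 0≤^ 0≤v L
    step : ∀ m → 1ℚ ≤ seq (exp a) m * seq (exp b) m + ε → 0ℚ ≤ seq (exp a) m → 1 ℕ.≤ m → v ^ L ≤ seq (exp a) m + ε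
    step (suc m) h 0≤P _ = subst₂ _≤_ (*-identityʳ (v ^ L)) refl
      (≤-trans (*-monoˡ (v ^ L) 0≤vᴸ (≤-trans h (+-monoˡ-≤ ε (*-monoˡ P 0≤P Q≤))))
      (≤-trans (≤-reflexive (trans (*-distribˡ-+ (v ^ L) (P * u ^ L) ε)
          (cong (_+ v ^ L * ε) (trans (solve 3 (λ v p u → v :* (p :* u) := p :* (u :* v)) refl (v ^ L) P (u ^ L))
            (trans (cong (P *_) (trans (sym (*-^ u v L)) (trans (cong (_^ L) uv) (1^ L)))) (*-identityʳ P))))))
        (+-monoʳ-≤ P (subst (v ^ L * ε ≤_) (*-identityˡ ε) (*-monoʳ ε (<⇒≤ 0<ε) (^≤1 0≤v v≤1 L))))))
      where
      P = seq (exp a) (suc m)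
      Q≤ : seq (exp b) (suc m) ≤ u ^ L
      Q≤ = ≤-trans (exp-partial-mono (0≤* 0≤c (0≤ln (suc m)))
          (≤-trans (*-monoˡ c 0≤c (ln≤ n≤ (suc m))) (≤-reflexive (*-comm c (fromℕℚ L)))) (suc m))
        (exp-partial-multiple 0≤c c≤1 eq 0≤u L m)

  -- In every approximation the multiples of ℓ cancel exactly, leaving the logarithm of log n ≥ L,
  -- where L = (4+i)/4 is a grid point.
  ln^-product : ∀ ℓ i → 4 ℕ.+ i ≡ 4 ℕ.* L → 2 ℕ.^ (L ℕ.+ L) ℕ.≤ n → ∀ ε → 0ℚ < ε →
    Eventually (λ m → fromℕℚ (suc (4 ℕ.* L)) * ⅕ ≤ seq (ln^ n (-ℝ ℓ)) m * seq (ln^ n (ℓ +ℝ 1ℝ)) m + ε)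
  ln^-product ℓ i eq h = exp-product ((-ℝ ℓ) *ℝ Y) ((ℓ +ℝ 1ℝ) *ℝ Y) (0≤harmonic i)
    (eventually₂ (λ m l g → ≤-trans g (≤-trans (logPartial-mono 1≤grid (≤-trans (≤-reflexive grid≡) l) m)
        (≤-reflexive (solve 2 (λ l y → y := (:- l) :* y :+ (l :+ con 1ℚ) :* y) refl (seq ℓ m) (seq Y m)))))
      (ln≥ h) (logPartial-grid i))
    (suc i , λ { (suc m) (ℕ.s≤s i≤m) → subst (λ k → fromℕℚ (suc k) * ⅕ ≤ exp-partial (harmonic i) (suc m)) eq (exp-harmonic i m i≤m) })
    where
    Y : ℝ
    Y = log (ln n) (0<ln n)
    grid≡ : fromℕℚ (4 ℕ.+ i) * ¼ ≡ fromℕℚ L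
    grid≡ = trans (cong (λ k → fromℕℚ k * ¼) eq) (trans (cong (_* ¼) (fromℕℚ-* 4 L))
      (solve 1 (λ l → con (fromℕℚ 4) :* l :* con ¼ := l) refl (fromℕℚ L)))
    1≤grid : 1ℚ ≤ fromℕℚ (4 ℕ.+ i) * ¼
    1≤grid = *-monoʳ ¼ (nonNegative⁻¹ ¼) (fromℕℚ-mono {4} {4 ℕ.+ i} (ℕ.m≤m+n 4 i))

-- The hypotheses of the theorem as rational inequalities

≤-limit : ∀ {p q K} → 0ℚ ≤ K → (∀ ε → 0ℚ < ε → ε ≤ 1ℚ → p ≤ q + ε * K) → p ≤ q
≤-limit {p} {q} {K} 0≤K h = ≮⇒≥ λ q<p →
  let η = p - q
      0<η : 0ℚ < η
      0<η = subst (_< η) (+-inverseʳ q) (+-monoˡ-< (- q) q<p)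
      D = 1ℚ + (K + η)
      0<D : 0ℚ < D
      0<D = <-≤-trans 0<1 (≤-by (K + η) (0≤+ 0≤K (<⇒≤ 0<η)) refl)
      ε = η * recip D
      0<ε = 0<* 0<η (0<recip 0<D)
      εD : ε * D ≡ η
      εD = trans (solve 3 (λ e r d → e :* r :* d := e :* (d :* r)) refl η (recip D) D)
        (trans (cong (η *_) (*-recip 0<D)) (*-identityʳ η))
      ε≤1 : ε ≤ 1ℚ
      ε≤1 = *-cancelˡ-≤ D 0<D (subst₂ _≤_ (trans (sym εD) (*-comm ε D)) (sym (*-identityʳ D))
        (≤-by (1ℚ + K) (0≤+ 0≤1 0≤K) (solve 2 (λ k e → e :+ (con 1ℚ :+ k) := con 1ℚ :+ (k :+ e)) refl K η)))
  in <-irrefl refl (<-≤-trans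
    (<-by (ε * (1ℚ + η)) (0<* 0<ε (0<+ 0<1 0<η))
      (trans (solve 4 (λ q e k η → q :+ e :* k :+ e :* (con 1ℚ :+ η) := q :+ e :* (con 1ℚ :+ (k :+ η))) refl q ε K η)
        (trans (cong (λ z → q + z) εD) (solve 2 (λ p q → q :+ (p :- q) := p) refl p q))))
    (h ε 0<ε ε≤1))

⁴/₅ : ℚ
⁴/₅ = + 4 / 5

-- The surplus 1/5 of (4L+1)/5 over 4L/5 pays for the approximation errors, which total ε(K+1) when
-- (log n)^(ℓ+1) is bounded by `K`.
⅕-split : ∀ {K} → 0ℚ < K → ∃ λ ε → 0ℚ < ε × ε * (K + 1ℚ) ≡ ⅕
⅕-split {K} 0<K = ⅕ * recip (K + 1ℚ) , 0<* (positive⁻¹ ⅕) (0<recip 0<K+1) ,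
  trans (solve 3 (λ f r k → f :* r :* k := f :* (k :* r)) refl ⅕ (recip (K + 1ℚ)) (K + 1ℚ))
    (trans (cong (⅕ *_) (*-recip 0<K+1)) (*-identityʳ ⅕))
  where
  0<K+1 = 0<+ 0<K 0<1

limit-step : ∀ {N c α ε K v w y z} → 0ℚ < N → N * α ≡ c → 0ℚ ≤ ε → ε * (K + 1ℚ) ≡ ⅕ → ⅕ + y ≡ z →
  z ≤ v * w + ε → N * v ≤ c + N * ε → 0ℚ ≤ w → ∣ w ∣ ≤ K → y ≤ α * w
limit-step {N} {c} {α} {ε} {K} {v} {w} 0<N Nα 0≤ε ε≡ lhs h₁ h₂ 0≤w w≤K =
  +-cancelˡ-≤ ⅕ (≤-trans (≤-reflexive lhs) (≤-trans h₁
    (≤-trans (+-monoˡ-≤ ε (*-monoʳ w 0≤w v≤))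
    (≤-trans (≤-by (ε * (K - w)) (0≤* 0≤ε (0≤q-p (≤-trans (p≤∣p∣ w) w≤K)))
        (solve 4 (λ a e k w → (a :+ e) :* w :+ e :+ e :* (k :- w) := e :* (k :+ con 1ℚ) :+ a :* w) refl α ε K w))
      (≤-reflexive (cong (_+ α * w) ε≡))))))
  where
  v≤ : v ≤ α + ε
  v≤ = *-cancelˡ-≤ N 0<N (≤-trans h₂ (≤-reflexive
    (trans (cong (_+ N * ε) (sym Nα)) (sym (*-distribˡ-+ N α ε)))))

-- Squares the bias hypothesis and multiplies by α, so that α (log n)^(ℓ+1) becomes a multiple of L.
-- The two errors add up to 23ε = ε + 22ε, and ε² ≤ ε makes the total linear in ε.
bias-step : ∀ {N l α B w r u ε} → 0ℚ ≤ N → 0ℚ ≤ α → 0ℚ ≤ r → 0ℚ ≤ u → 0ℚ ≤ ε → ε ≤ 1ℚ →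
  N * w ≤ (r + u) * (r + u) → ⁴/₅ * l ≤ α * w → fromℕℚ 22 * r ≤ B + ε → u ≤ ε →
  fromℕℚ 484 * ⁴/₅ * (N * l) ≤ B * B * α + ε * (α * (fromℕℚ 46 * B + fromℕℚ 529))
bias-step {N} {l} {α} {B} {w} {r} {u} {ε} 0≤N 0≤α 0≤r 0≤u 0≤ε ε≤1 Nw≤ h₁ h₂ h₃ = ≤-trans
  (≤-by (fromℕℚ 484 * N * (α * w - ⁴/₅ * l)) (0≤* (0≤* (0≤fromℕℚ 484) 0≤N) (0≤q-p h₁))
    (solve 4 (λ N l a w → con (fromℕℚ 484 * ⁴/₅) :* (N :* l) :+ con (fromℕℚ 484) :* N :* (a :* w :- con ⁴/₅ :* l)
      := con (fromℕℚ 484) :* a :* (N :* w)) refl N l α w))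
  (≤-trans (*-monoˡ (fromℕℚ 484 * α) (0≤* (0≤fromℕℚ 484) 0≤α) Nw≤)
  (≤-trans (≤-reflexive (solve 2 (λ a s → con (fromℕℚ 484) :* a :* (s :* s)
      := a :* (con (fromℕℚ 22) :* s :* (con (fromℕℚ 22) :* s))) refl α s))
  (≤-trans (*-monoˡ α 0≤α (*-mono 0≤22s (≤-trans 0≤22s 22s≤) 22s≤ 22s≤))
  (≤-by (ε * (α * (fromℕℚ 529 * (1ℚ - ε)))) (0≤* 0≤ε (0≤* 0≤α (0≤* (0≤fromℕℚ 529) (0≤q-p ε≤1))))
    (solve 3 (λ a b e → a :* ((b :+ con (fromℕℚ 23) :* e) :* (b :+ con (fromℕℚ 23) :* e))
        :+ e :* (a :* (con (fromℕℚ 529) :* (con 1ℚ :- e)))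
      := b :* b :* a :+ e :* (a :* (con (fromℕℚ 46) :* b :+ con (fromℕℚ 529)))) refl α B ε)))))
  where
  s = r + u
  0≤22s : 0ℚ ≤ fromℕℚ 22 * s
  0≤22s = 0≤* (0≤fromℕℚ 22) (0≤+ 0≤r 0≤u)
  22s≤ : fromℕℚ 22 * s ≤ B + fromℕℚ 23 * ε
  22s≤ = ≤-trans (≤-reflexive (*-distribˡ-+ (fromℕℚ 22) r u))
    (≤-trans (+-mono-≤ h₂ (*-monoˡ (fromℕℚ 22) (0≤fromℕℚ 22) h₃))
      (≤-reflexive (solve 2 (λ b e → b :+ e :+ con (fromℕℚ 22) :* e := b :+ con (fromℕℚ 23) :* e) refl B ε)))

module _ (ℓ : ℝ) (n : ℕ) .{{_ : NonTrivial n}} (L i c b : ℕ) (4+i≡4L : 4 ℕ.+ i ≡ 4 ℕ.* L)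
  (4ᴸ≤n : 2 ℕ.^ (L ℕ.+ L) ℕ.≤ n)
  (c≥ : fromℕ n *ℝ ln^ n (-ℝ ℓ) ≤ℝ fromℕ c)
  (b≥ : fromℕ 22 *ℝ √ (fromℕ n *ℝ ln^ n (ℓ +ℝ 1ℝ)) ≤ℝ fromℕ b) where
  private
    N = fromℕℚ n
    0<N : 0ℚ < N
    0<N = <-≤-trans 0<1 (fromℕℚ-mono {1} (ℕ.<⇒≤ (ℕ.nonTrivial⇒n>1 n)))
    α = fromℕℚ c * recip N
    0≤α : 0ℚ ≤ α
    0≤α = 0≤* (0≤fromℕℚ c) (<⇒≤ (0<recip 0<N))
    Nα : N * α ≡ fromℕℚ c
    Nα = trans (solve 3 (λ n c r → n :* (c :* r) := c :* (n :* r)) refl N (fromℕℚ c) (recip N))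
      (trans (cong (fromℕℚ c *_) (*-recip 0<N)) (*-identityʳ (fromℕℚ c)))
    V W : ℝ
    V = ln^ n (-ℝ ℓ)
    W = ln^ n (ℓ +ℝ 1ℝ)
    l = fromℕℚ L
    B = fromℕℚ b
    0≤B = 0≤fromℕℚ b

    X : ℚ
    X = fromℕℚ (suc (4 ℕ.* L)) * ⅕
    product≥ : ∀ ε → 0ℚ < ε → Eventually (λ m → X ≤ seq V m * seq W m + ε)
    product≥ = ln^-product n L ℓ i 4+i≡4L 4ᴸ≤n
    V≤ : ∀ ε → 0ℚ < ε → Eventually (λ m → N * seq V m ≤ fromℕℚ c + N * ε)
    V≤ ε 0<ε = c≥ (N * ε) (0<* 0<N 0<ε)
    0≤W : Eventually (λ m → 0ℚ ≤ seq W m)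
    0≤W = exp-nonneg ((ℓ +ℝ 1ℝ) *ℝ log (ln n) (0<ln n))
    W-bounded : ∃ λ K → 0ℚ < K × Eventually (λ m → ∣ seq W m ∣ ≤ K)
    W-bounded = Cauchy-bounded (cauchy W)
    ⅕+ : ⅕ + ⁴/₅ * l ≡ X
    ⅕+ = trans (solve 1 (λ l → con ⅕ :+ con ⁴/₅ :* l := (con 1ℚ :+ con (fromℕℚ 4) :* l) :* con ⅕) refl l)
      (cong (_* ⅕) (sym (trans (fromℕℚ-suc (4 ℕ.* L)) (cong (λ q → 1ℚ + q) (fromℕℚ-* 4 L)))))
    combine : ∀ K → Eventually (λ m → ∣ seq W m ∣ ≤ K) → ∀ ε → 0ℚ < ε → ε * (K + 1ℚ) ≡ ⅕ →
      Eventually (λ m → ⁴/₅ * l ≤ α * seq W m)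
    combine K W≤K ε 0<ε ε≡ = eventually₂
      {λ m → X ≤ seq V m * seq W m + ε × N * seq V m ≤ fromℕℚ c + N * ε}
      {λ m → 0ℚ ≤ seq W m × ∣ seq W m ∣ ≤ K}
      (λ m (h₁ , h₂) (h₃ , h₄) → limit-step {N} {fromℕℚ c} {α} {ε} {K} {seq V m} {seq W m} {⁴/₅ * l} {X}
        0<N Nα (<⇒≤ 0<ε) ε≡ ⅕+ h₁ h₂ h₃ h₄)
      (eventually-× {λ m → X ≤ seq V m * seq W m + ε} {λ m → N * seq V m ≤ fromℕℚ c + N * ε}
        (product≥ ε 0<ε) (V≤ ε 0<ε))
      (eventually-× {λ m → 0ℚ ≤ seq W m} {λ m → ∣ seq W m ∣ ≤ K} 0≤W W≤K)

  -- Multiplying c₁ ≥ n (log n)^(-ℓ) by (log n)^(ℓ+1) removes ℓ. This serves twice: to evaluate the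
  -- squared bias, and to turn O(L/α) rounds into O((log n)^(ℓ+1)).
  fraction*W≥ : Eventually (λ m → ⁴/₅ * l ≤ α * seq W m)
  fraction*W≥ = combine (proj₁ W-bounded) (proj₂ (proj₂ W-bounded))
    (proj₁ split) (proj₁ (proj₂ split)) (proj₂ (proj₂ split))
    where split = ⅕-split (proj₁ (proj₂ W-bounded))

  private
    √W≤ : ∀ ε → 0ℚ < ε → Eventually (λ m → fromℕℚ 22 * √-approx m (N * seq W m) ≤ B + ε)
    √W≤ = b≥
    K₂ = α * (fromℕℚ 46 * B + fromℕℚ 529)
    0≤K₂ : 0ℚ ≤ K₂
    0≤K₂ = 0≤* 0≤α (0≤+ (0≤* (0≤fromℕℚ 46) 0≤B) (0≤fromℕℚ 529))
    bias-limit : ∀ ε → 0ℚ < ε → ε ≤ 1ℚ → fromℕℚ 484 * ⁴/₅ * (N * l) ≤ B * B * α + ε * K₂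
    bias-limit ε 0<ε ε≤1 = at (proj₁ ev) (proj₂ ev (proj₁ ev) ℕ.≤-refl)
      where
      Q : ℕ → Set
      Q m = ⁴/₅ * l ≤ α * seq W m × (fromℕℚ 22 * √-approx m (N * seq W m) ≤ B + ε × unit m ≤ ε)
      ev : Eventually Q
      ev = eventually-× {λ m → ⁴/₅ * l ≤ α * seq W m} fraction*W≥
        (eventually-× {λ m → fromℕℚ 22 * √-approx m (N * seq W m) ≤ B + ε} {λ m → unit m ≤ ε} (√W≤ ε 0<ε) (unit-small ε 0<ε))
      at : ∀ m → Q m → fromℕℚ 484 * ⁴/₅ * (N * l) ≤ B * B * α + ε * K₂
      at m (h₁ , h₂ , h₃) = bias-step {N} {l} {α} {B} {seq W m} {√-approx m (N * seq W m)} {unit m} {ε}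
        (<⇒≤ 0<N) 0≤α (√-approx-nonneg m (N * seq W m)) (<⇒≤ (0<unit m)) (<⇒≤ 0<ε) ε≤1
        (≤-trans (p≤p⊔q (N * seq W m) 0ℚ) (√-approx-upper m (N * seq W m))) h₁ h₂ h₃

  bias²*fraction≥ : fromℕℚ 384 * (N * l) ≤ B * B * α
  bias²*fraction≥ = ≤-trans
    -- 22² · 4/5 = 384 + 16/5.
    (≤-by ((+ 16 / 5) * (N * l)) (0≤* (nonNegative⁻¹ (+ 16 / 5)) (0≤* (<⇒≤ 0<N) (0≤fromℕℚ L)))
      (solve 1 (λ z → con (fromℕℚ 384) :* z :+ con (+ 16 / 5) :* z := con (fromℕℚ 484 * ⁴/₅) :* z) refl (N * l)))
    (≤-limit {fromℕℚ 484 * ⁴/₅ * (N * l)} {B * B * α} {K₂} 0≤K₂ bias-limit)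

-- Rounding: multiples of a small number, and the integer logarithm to base 4

bracket : ∀ {p} → 0ℚ < p → p ≤ 1ℚ → ∀ k → ∃ λ N → fromℕℚ k ≤ fromℕℚ N * p × fromℕℚ N * p ≤ fromℕℚ (suc k)
bracket {p} 0<p p≤1 k = search (proj₁ (∃-fromℕℚ* (fromℕℚ k) p 0<p)) (proj₂ (∃-fromℕℚ* (fromℕℚ k) p 0<p))
  where
  search : ∀ M → fromℕℚ k ≤ fromℕℚ M * p → ∃ λ N → fromℕℚ k ≤ fromℕℚ N * p × fromℕℚ N * p ≤ fromℕℚ (suc k)
  search zero    h = 0 , h , ≤-trans (≤-reflexive (*-zeroˡ p)) (0≤fromℕℚ (suc k))
  search (suc M) h with fromℕℚ k ≤? fromℕℚ M * p
  ... | yes h′ = search M h′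
  ... | no  h′ = suc M , h , ≤-trans (≤-reflexive (trans (cong (_* p) (fromℕℚ-suc M))
      (solve 2 (λ m p → (con 1ℚ :+ m) :* p := p :+ m :* p) refl (fromℕℚ M) p)))
    (≤-trans (+-mono-≤ p≤1 (<⇒≤ (≰⇒> h′))) (≤-reflexive (sym (fromℕℚ-suc k))))

n<2^n : ∀ n → n ℕ.< 2 ℕ.^ n
n<2^n zero    = ℕ.s≤s ℕ.z≤n
n<2^n (suc n) = ℕ.≤-trans (ℕ.s≤s (n<2^n n))
  (ℕ.+-mono-≤ (ℕ.m^n>0 2 n) (ℕ.≤-reflexive (sym (ℕ.+-identityʳ (2 ℕ.^ n)))))

log₄ : ∀ n K → 2 ℕ.^ (K ℕ.+ K) ℕ.≤ n →
  ∃ λ L → K ℕ.≤ L × 2 ℕ.^ (L ℕ.+ L) ℕ.≤ n × n ℕ.< 2 ℕ.^ (suc L ℕ.+ suc L)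
log₄ n K h = search n K ℕ.≤-refl h (ℕ.m≤n+m n K)
  where
  L<4ᴸ : ∀ L → L ℕ.< 2 ℕ.^ (L ℕ.+ L)
  L<4ᴸ L = ℕ.<-≤-trans (n<2^n L) (ℕ.^-monoʳ-≤ 2 (ℕ.m≤m+n L L))
  -- The fuel cannot run out, because L < 4^L ≤ n.
  search : ∀ fuel L → K ℕ.≤ L → 2 ℕ.^ (L ℕ.+ L) ℕ.≤ n → n ℕ.≤ L ℕ.+ fuel →
    ∃ λ L → K ℕ.≤ L × 2 ℕ.^ (L ℕ.+ L) ℕ.≤ n × n ℕ.< 2 ℕ.^ (suc L ℕ.+ suc L)
  search zero L K≤L h n≤ = ⊥-elim (ℕ.<-irrefl refl (ℕ.<-≤-trans (L<4ᴸ L)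
    (ℕ.≤-trans h (ℕ.≤-trans n≤ (ℕ.≤-reflexive (ℕ.+-identityʳ L))))))
  search (suc fuel) L K≤L h n≤ with 2 ℕ.^ (suc L ℕ.+ suc L) ℕ.≤? n
  ... | yes h′ = search fuel (suc L) (ℕ.m≤n⇒m≤1+n K≤L) h′ (ℕ.≤-trans n≤ (ℕ.≤-reflexive (ℕ.+-suc L fuel)))
  ... | no  h′ = L , K≤L , h , ℕ.≰⇒> h′

-- The final estimate

⁹/₈ ⁹/₁₀ ⁸/₅ ⅛ ¹⁹/₂₀ : ℚ
⁹/₈   = + 9 / 8
⁹/₁₀  = + 9 / 10
⁸/₅   = + 8 / 5
⅛     = + 1 / 8
¹⁹/₂₀ = + 19 / 20

decide-≤ : ∀ {p q} → (p ≤ᵇ q) ≡ true → p ≤ q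
decide-≤ eq = ≤ᵇ⇒≤ (subst T (sym eq) tt)

-- 547 is 492 / (9/10) rounded up, for `fail-numeric`. At L = 100 the claim follows from 54700 ≤
-- 3^10 and 3 ≤ (9/8)^10; from L = 8 on, the left side grows by a factor of at most 9/8.
linear≤geometric : ∀ {L} → 100 ℕ.≤ L → fromℕℚ 547 * fromℕℚ L ≤ ⁹/₈ ^ L
linear≤geometric {L} 100≤L = subst (λ m → fromℕℚ 547 * fromℕℚ m ≤ ⁹/₈ ^ m)
  (ℕ.m∸n+n≡m 100≤L) (go (L ℕ.∸ 100))
  where
  3≤ : fromℕℚ 3 ≤ ⁹/₈ ^ 10
  3≤ = decide-≤ refl
  base : fromℕℚ 547 * fromℕℚ 100 ≤ ⁹/₈ ^ 100
  base = ≤-trans (decide-≤ {fromℕℚ 547 * fromℕℚ 100} {fromℕℚ 3 ^ 10} refl)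
    (≤-trans (^-mono (0≤fromℕℚ 3) 3≤ 10) (≤-reflexive (sym (^-* ⁹/₈ 10 10))))
  go : ∀ j → fromℕℚ 547 * fromℕℚ (j ℕ.+ 100) ≤ ⁹/₈ ^ (j ℕ.+ 100)
  go zero    = base
  go (suc j) = ≤-trans
    (≤-by (fromℕℚ 547 * ⅛ * (m - fromℕℚ 8)) (0≤* (nonNegative⁻¹ (fromℕℚ 547 * ⅛))
        (0≤q-p (fromℕℚ-mono (ℕ.≤-trans (ℕ.m≤m+n 8 92) (ℕ.m≤n+m 100 j)))))
      (trans (cong (λ q → fromℕℚ 547 * q + fromℕℚ 547 * ⅛ * (m - fromℕℚ 8)) (fromℕℚ-suc (j ℕ.+ 100)))
        (solve 1 (λ m → con (fromℕℚ 547) :* (con 1ℚ :+ m) :+ con (fromℕℚ 547 * ⅛) :* (m :- con (fromℕℚ 8))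
          := con ⁹/₈ :* (con (fromℕℚ 547) :* m)) refl m)))
    (*-monoˡ ⁹/₈ (nonNegative⁻¹ ⁹/₈) (go j))
    where m = fromℕℚ (j ℕ.+ 100)

module _ {n L : ℕ} {α : ℚ} (0≤α : 0ℚ ≤ α) (n< : fromℕℚ n + 1ℚ ≤ fromℕℚ 4 * fromℕℚ 4 ^ L) where
  private
    N = fromℕℚ n
    0≤N = 0≤fromℕℚ n
    l = fromℕℚ L

  -- Since B ≤ nα, the hypothesis gives nα³ ≥ 1.  This bounds the number of rounds by O(n^(1/3) L), which
  -- replaces an upper bound on (log n)^ℓ.
  cube-root : ∀ {B} → 1ℚ ≤ l → 0ℚ < N → 0ℚ ≤ B → B ≤ N * α → fromℕℚ 384 * (N * l) ≤ B * B * α →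
    1ℚ ≤ (α + α) * ⁸/₅ ^ L
  cube-root {B} 1≤l 0<N 0≤B B≤ h = ≮⇒≥ λ z<1 →
    let z≤1 = <⇒≤ z<1 in
    <-irrefl refl (<-≤-trans (≤-<-trans
      (subst (z * (z * z) ≤_) (*-identityʳ z) (*-monoˡ z 0≤z (*-mono {z} {1ℚ} {z} {1ℚ} 0≤z 0≤1 z≤1 z≤1))) z<1) 1≤z³)
    where
    z = (α + α) * ⁸/₅ ^ L
    p = ⁸/₅ ^ L
    0≤p = 0≤^ (nonNegative⁻¹ ⁸/₅) L
    0≤z : 0ℚ ≤ z
    0≤z = 0≤* (0≤+ 0≤α 0≤α) 0≤p
    0≤α³ = 0≤* 0≤α (0≤* 0≤α 0≤α)
    1≤Nα³ : 1ℚ ≤ N * (α * (α * α))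
    1≤Nα³ = *-cancelˡ-≤ N 0<N (≤-trans
      (≤-by (N * (fromℕℚ 383 + fromℕℚ 384 * (l - 1ℚ))) (0≤* 0≤N (0≤+ (0≤fromℕℚ 383) (0≤* (0≤fromℕℚ 384) (0≤q-p 1≤l))))
        (solve 2 (λ N l → N :* con 1ℚ :+ N :* (con (fromℕℚ 383) :+ con (fromℕℚ 384) :* (l :- con 1ℚ))
          := con (fromℕℚ 384) :* (N :* l)) refl N l))
      (≤-trans h (≤-trans (*-monoʳ α 0≤α (*-mono 0≤B (0≤* 0≤N 0≤α) B≤ B≤))
        (≤-reflexive (solve 2 (λ N a → N :* a :* (N :* a) :* a := N :* (N :* (a :* (a :* a)))) refl N α)))))
    -- (8/5)³ = 4.096. The base has to be at least the cube root of 4, and below 2 for the decay in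
    -- `fail-numeric`.
    4ᴸ≤ : fromℕℚ 4 ^ L ≤ p * (p * p)
    4ᴸ≤ = ≤-trans (^-mono {q = ⁸/₅ * (⁸/₅ * ⁸/₅)} (0≤fromℕℚ 4) (decide-≤ refl) L)
      (≤-reflexive (trans (*-^ ⁸/₅ (⁸/₅ * ⁸/₅) L) (cong (p *_) (*-^ ⁸/₅ ⁸/₅ L))))
    1≤z³ : 1ℚ ≤ z * (z * z)
    1≤z³ = ≤-trans 1≤Nα³
      (≤-by (α * (α * α) * (fromℕℚ 4 * (p * (p * p)) - N) + fromℕℚ 4 * (α * (α * α) * (p * (p * p))))
        (0≤+ (0≤* 0≤α³ (0≤q-p (≤-trans (≤-by 1ℚ 0≤1 refl) (≤-trans n< (*-monoˡ (fromℕℚ 4) (0≤fromℕℚ 4) 4ᴸ≤)))))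
          (0≤* (0≤fromℕℚ 4) (0≤* 0≤α³ (0≤* 0≤p (0≤* 0≤p 0≤p)))))
        (solve 3 (λ N a p → N :* (a :* (a :* a)) :+ (a :* (a :* a) :* (con (fromℕℚ 4) :* (p :* (p :* p)) :- N)
            :+ con (fromℕℚ 4) :* (a :* (a :* a) :* (p :* (p :* p))))
          := (a :+ a) :* p :* ((a :+ a) :* p :* ((a :+ a) :* p))) refl N α p))

  -- Both the late phase and the union over nodes cost at most 4 · 4^L · 8^(-L) = 4 · 2^(-L). With
  -- at most 122 L (8/5)^L rounds the sum is at most 492 L (4/5)^L; the factor 492 L is absorbed by
  -- (9/8)^L, and 9/10 ≤ (19/20)².
  fail-numeric : ∀ {t} → 0ℚ ≤ t → 1ℚ ≤ l → t * α ≤ fromℕℚ 61 * l → 1ℚ ≤ (α + α) * ⁸/₅ ^ L →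
    fromℕℚ 547 * l ≤ ⁹/₈ ^ L →
    N * ⁷/₉ ^ (L ℕ.* 9) + t * (N * ½ ^ (L ℕ.* 3) + ½ ^ (L ℕ.* 3)) ≤ ¹⁹/₂₀ ^ (suc L ℕ.+ suc L)
  fail-numeric {t} 0≤t 1≤l tα≤ 1≤αp 547l≤ = ≤-trans
    (+-mono-≤ term₁ (*-mono 0≤t 0≤4h t≤ term₂))
    (≤-trans (≤-trans (≤-reflexive (solve 3 (λ h l p → con (fromℕℚ 4) :* h :+ con (fromℕℚ 122) :* l :* p :* (con (fromℕℚ 4) :* h)
          := con (fromℕℚ 4) :* h :+ con (fromℕℚ 488) :* l :* (p :* h)) refl h l p))
        (≤-trans (+-mono-≤ (*-monoˡ (fromℕℚ 4) (0≤fromℕℚ 4) h≤lq)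
            (≤-reflexive (cong (fromℕℚ 488 * l *_) ph≡q)))
          (≤-reflexive (solve 2 (λ l q → con (fromℕℚ 4) :* (l :* q) :+ con (fromℕℚ 488) :* l :* q
            := con (fromℕℚ 492) :* l :* q) refl l q))))
      (≤-trans (*-monoʳ q 0≤q 492l≤) (≤-trans (≤-reflexive (trans (*-assoc ⁹/₁₀ (⁹/₈ ^ L) q) (cong (⁹/₁₀ *_) (sym (*-^ ⁹/₈ ⁴/₅ L)))))
        final)))
    where
    h = ½ ^ L
    p = ⁸/₅ ^ L
    q = ⁴/₅ ^ L
    0≤h = 0≤^ (<⇒≤ 0<½) L
    0≤q = 0≤^ (nonNegative⁻¹ ⁴/₅) L
    0≤p = 0≤^ (nonNegative⁻¹ ⁸/₅) L
    0≤4h : 0ℚ ≤ fromℕℚ 4 * h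
    0≤4h = 0≤* (0≤fromℕℚ 4) 0≤h
    4⅛ : fromℕℚ 4 * fromℕℚ 4 ^ L * ⅛ ^ L ≡ fromℕℚ 4 * h
    4⅛ = trans (*-assoc (fromℕℚ 4) (fromℕℚ 4 ^ L) (⅛ ^ L)) (cong (fromℕℚ 4 *_) (sym (*-^ (fromℕℚ 4) ⅛ L)))
    0≤⅛ᴸ = 0≤^ (nonNegative⁻¹ ⅛) L
    N≤ : N ≤ fromℕℚ 4 * fromℕℚ 4 ^ L
    N≤ = ≤-trans (≤-by 1ℚ 0≤1 refl) n<
    term₁ : N * ⁷/₉ ^ (L ℕ.* 9) ≤ fromℕℚ 4 * h
    term₁ = ≤-trans (*-mono 0≤N 0≤⅛ᴸ N≤ (≤-trans (≤-reflexive (^-* ⁷/₉ L 9))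
      (^-mono {⁷/₉ ^ 9} {⅛} (nonNegative⁻¹ (⁷/₉ ^ 9)) (decide-≤ refl) L))) (≤-reflexive 4⅛)
    term₂ : N * ½ ^ (L ℕ.* 3) + ½ ^ (L ℕ.* 3) ≤ fromℕℚ 4 * h
    term₂ = ≤-trans (≤-reflexive (trans (solve 2 (λ N e → N :* e :+ e := (N :+ con 1ℚ) :* e) refl N (½ ^ (L ℕ.* 3)))
        (cong ((N + 1ℚ) *_) (^-* ½ L 3))))
      (≤-trans (*-monoʳ (⅛ ^ L) 0≤⅛ᴸ n<) (≤-reflexive 4⅛))
    t≤ : t ≤ fromℕℚ 122 * l * p
    t≤ = ≤-trans (subst (_≤ t * ((α + α) * p)) (*-identityʳ t) (*-monoˡ t 0≤t 1≤αp))
      (≤-by ((p + p) * (fromℕℚ 61 * l - t * α)) (0≤* (0≤+ 0≤p 0≤p) (0≤q-p tα≤))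
        (solve 4 (λ t a p l → t :* ((a :+ a) :* p) :+ (p :+ p) :* (con (fromℕℚ 61) :* l :- t :* a)
          := con (fromℕℚ 122) :* l :* p) refl t α p l))
    ph≡q : p * h ≡ q
    ph≡q = sym (*-^ ⁸/₅ ½ L)
    h≤lq : h ≤ l * q
    h≤lq = ≤-trans (^-mono {½} {⁴/₅} (<⇒≤ 0<½) (decide-≤ refl) L)
      (subst (_≤ l * q) (*-identityˡ q) (*-monoʳ q 0≤q 1≤l))
    492l≤ : fromℕℚ 492 * l ≤ ⁹/₁₀ * ⁹/₈ ^ L
    492l≤ = ≤-trans (≤-by ((+ 3 / 10) * l) (0≤* (nonNegative⁻¹ (+ 3 / 10)) (0≤fromℕℚ L))
        (solve 1 (λ l → con (fromℕℚ 492) :* l :+ con (+ 3 / 10) :* l := con ⁹/₁₀ :* (con (fromℕℚ 547) :* l)) refl l))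
      (*-monoˡ ⁹/₁₀ (nonNegative⁻¹ ⁹/₁₀) 547l≤)
    final : ⁹/₁₀ * ⁹/₁₀ ^ L ≤ ¹⁹/₂₀ ^ (suc L ℕ.+ suc L)
    final = ≤-trans (^-mono {⁹/₁₀} {¹⁹/₂₀ * ¹⁹/₂₀} (nonNegative⁻¹ ⁹/₁₀) (decide-≤ refl) (suc L))
      (≤-reflexive (trans (*-^ ¹⁹/₂₀ ¹⁹/₂₀ (suc L)) (sym (^-+ ¹⁹/₂₀ (suc L) (suc L)))))

-- From the initial configuration to the frequencies of a colouring

sumV-count : ∀ {k m} (j : Fin k) (y : Vec (Fin k) m) → sumV (δ j) y ≡ fromℕℚ (Vec.count (Fin._≟ j) y)
sumV-count j []      = refl
sumV-count j (c ∷ y) with c Fin.≟ j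
... | yes _ = trans (cong (λ s → 1ℚ + s) (sumV-count j y)) (sym (fromℕℚ-suc (Vec.count (Fin._≟ j) y)))
... | no  _ = trans (+-identityˡ (sumV (δ j) y)) (sumV-count j y)

lookup≤head : ∀ {k a} (v : Vec ℕ k) → Linked ℕ._≥_ (a ∷ v) → ∀ j → lookup v j ℕ.≤ a
lookup≤head (b ∷ v) (b≤a ∷ _) zero    = b≤a
lookup≤head (b ∷ v) (b≤a ∷ l) (suc j) = ℕ.≤-trans (lookup≤head v l j) b≤a

count+bias≤c₁ : ∀ {k n} (𝒄 : Configuration (suc k) n) → Ordered 𝒄 → ∀ j → j ≢ zero →
  lookup (counts 𝒄) j ℕ.+ bias 𝒄 ℕ.≤ c₁ 𝒄
count+bias≤c₁ record { counts = a ∷ [] }    _         zero    j≢0 = ⊥-elim (j≢0 refl)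
count+bias≤c₁ record { counts = a ∷ b ∷ v } _         zero    j≢0 = ⊥-elim (j≢0 refl)
count+bias≤c₁ record { counts = a ∷ b ∷ v } (b≤a ∷ l) (suc j) j≢0 = ℕ.≤-trans
  (ℕ.+-monoˡ-≤ (a ℕ.∸ b) (below j)) (ℕ.≤-reflexive (ℕ.m+[n∸m]≡n b≤a))
  where
  below : ∀ j → lookup (b ∷ v) j ℕ.≤ b
  below zero    = ℕ.≤-refl
  below (suc j) = lookup≤head v l j

head≡lookup : ∀ {k} (v : Vec ℕ (suc k)) → Vec.head v ≡ lookup v zero
head≡lookup (a ∷ v) = refl

-- Ensures that h = 3L/n is at most the 1/729 of the late phase; 2187 = 3 · 729.
2187L≤ : ∀ {L} → 100 ℕ.≤ L → 729 ℕ.* (L ℕ.* 3) ℕ.≤ 2 ℕ.^ (L ℕ.+ L)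
2187L≤ {L} 100≤L = ℕ.≤-trans (ℕ.≤-reflexive (trans (cong (729 ℕ.*_) (ℕ.*-comm L 3)) (sym (ℕ.*-assoc 729 3 L))))
  (ℕ.≤-trans (ℕ.*-mono-≤ 2187≤ (ℕ.<⇒≤ (n<2^n L))) (ℕ.≤-reflexive (sym (ℕ.^-distribˡ-+-* 2 L L))))
  where
  2187≤ : 2187 ℕ.≤ 2 ℕ.^ L
  2187≤ = ℕ.≤-trans (ℕ.m≤m+n 2187 1909) (ℕ.^-monoʳ-≤ 2 {12} {L} (ℕ.≤-trans (ℕ.m≤m+n 12 88) 100≤L))

-- Choice of the parameters and assembly

module Consensus {k n L c b : ℕ} (x : Colouring (suc k) (suc n)) (100≤L : 100 ℕ.≤ L)
  (4ᴸ≤n : 2 ℕ.^ (L ℕ.+ L) ℕ.≤ suc n) (n<4ᴸ⁺¹ : suc n ℕ.< 2 ℕ.^ (suc L ℕ.+ suc L)) (b≤c : b ℕ.≤ c)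
  (count₁ : sumV (δ zero) x ≡ fromℕℚ c)
  (leads : ∀ i → lookup x i ≢ zero → sumV (δ (lookup x i)) x + fromℕℚ b ≤ fromℕℚ c)
  (biased : fromℕℚ 384 * (fromℕℚ (suc n) * fromℕℚ L) ≤
    fromℕℚ b * fromℕℚ b * (fromℕℚ c * recip (fromℕℚ (suc n)))) where
  private
    N = fromℕℚ (suc n)
    l = fromℕℚ L
    r = recip N
    B = fromℕℚ b
    0<N = 0<fromℕℚ-suc n
    0≤N = <⇒≤ 0<N
    0<r = 0<recip 0<N
    0≤r = <⇒≤ 0<r
    Nr : N * r ≡ 1ℚ
    Nr = *-recip 0<N
    0≤B = 0≤fromℕℚ b
    0≤l = 0≤fromℕℚ L
    1≤l : 1ℚ ≤ l
    1≤l = fromℕℚ-mono {1} {L} (ℕ.≤-trans (ℕ.m≤m+n 1 99) 100≤L)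

  α σ₀ : ℚ
  α  = fromℕℚ c * r
  σ₀ = B * r

  private
    0≤α : 0ℚ ≤ α
    0≤α = 0≤* (0≤fromℕℚ c) 0≤r
    0≤σ₀ : 0ℚ ≤ σ₀
    0≤σ₀ = 0≤* 0≤B 0≤r
    0<384 : 0ℚ < fromℕℚ 384 * (N * l)
    0<384 = 0<* (0<fromℕℚ-suc 383) (0<* 0<N (<-≤-trans 0<1 1≤l))
    freq≡ : ∀ j → freq x j ≡ sumV (δ j) x * r
    freq≡ j = trans (sym (*-identityˡ (freq x j))) (trans (cong (_* freq x j) (sym Nr))
      (trans (solve 3 (λ n r f → n :* r :* f := n :* f :* r) refl N r (freq x j)) (cong (_* r) (freq-sumV x j))))
    freq₁ : freq x zero ≡ α
    freq₁ = trans (freq≡ zero) (cong (_* r) count₁)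
    α≤1 : α ≤ 1ℚ
    α≤1 = subst (_≤ 1ℚ) freq₁ (freq≤1 x zero)

  0<α : 0ℚ < α
  0<α = ≰⇒> λ α≤0 → <-irrefl refl (<-≤-trans 0<384 (≤-trans biased
    (≤-trans (*-monoˡ (B * B) (0≤* 0≤B 0≤B) α≤0) (≤-reflexive (*-zeroʳ (B * B))))))

  private
    leading : Leading α σ₀ x
    leading = record
      { large = ≤-reflexive (sym freq₁)
      ; lead  = λ i x≢0 → subst₂ _≤_
          (trans (*-distribʳ-+ r (sumV (δ (lookup x i)) x) B) (cong (_+ B * r) (sym (freq≡ (lookup x i)))))
          (sym freq₁) (*-monoʳ r 0≤r (leads i x≢0))
      }
    -- 2^(-3L) has to survive the union over fewer than 4^(L+1) nodes and O(L (8/5)^L) rounds.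
    D = L ℕ.* 3
    h : ℚ
    h = fromℕℚ D * r
    0≤h : 0ℚ ≤ h
    0≤h = 0≤* (0≤fromℕℚ D) 0≤r
    D≡Nh : fromℕℚ D ≡ N * h
    D≡Nh = sym (trans (solve 3 (λ n d r → n :* (d :* r) := d :* (n :* r)) refl N (fromℕℚ D) r)
      (trans (cong (fromℕℚ D *_) Nr) (*-identityʳ (fromℕℚ D))))
    729D≤n : 729 ℕ.* D ℕ.≤ suc n
    729D≤n = ℕ.≤-trans (2187L≤ 100≤L) 4ᴸ≤n
    D≤n : D ℕ.≤ suc n
    D≤n = ℕ.≤-trans (ℕ.m≤n*m D 729) 729D≤n
    h≤1/729 : h ≤ + 1 / 729
    h≤1/729 = *-cancelˡ-≤ (fromℕℚ 729) (0<fromℕℚ-suc 728) (≤-trans (≤-reflexive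
        (trans (sym (*-assoc (fromℕℚ 729) (fromℕℚ D) r)) (cong (_* r) (sym (fromℕℚ-* 729 D)))))
      (≤-trans (*-monoʳ r 0≤r (fromℕℚ-mono 729D≤n)) (≤-reflexive Nr)))
    -- 384 / 128 = 3, the factor in `D`.
    h≤σ₀ : h ≤ + 1 / 128 * (σ₀ * σ₀ * α)
    h≤σ₀ = ≤-trans (≤-reflexive (trans (cong (_* r) (fromℕℚ-* L 3))
        (trans (sym (*-identityʳ (l * fromℕℚ 3 * r))) (trans (cong (l * fromℕℚ 3 * r *_) (sym Nr))
          (solve 3 (λ l r N → l :* con (fromℕℚ 3) :* r :* (N :* r) := con (+ 1 / 128) :* (con (fromℕℚ 384) :* (N :* l) :* (r :* r)))
            refl l r N)))))
      (≤-trans (*-monoˡ (+ 1 / 128) (nonNegative⁻¹ (+ 1 / 128)) (*-monoʳ (r * r) (0≤* 0≤r 0≤r) biased))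
        (≤-reflexive (solve 3 (λ b r a → con (+ 1 / 128) :* (b :* b :* a :* (r :* r))
          := con (+ 1 / 128) :* (b :* r :* (b :* r) :* a)) refl B r α)))
    -- At Mα ≥ 12, Bernoulli shows that M rounds double the lead; the upper end 13 limits the total
    -- time.
    bracketed : ∃ λ M → fromℕℚ 12 ≤ fromℕℚ M * α × fromℕℚ M * α ≤ fromℕℚ 13
    bracketed = bracket 0<α α≤1 12
    M = proj₁ bracketed
    -- The initial lead is at least 1/n, and 2L+2 doublings exceed n.
    T₁ = (suc L ℕ.+ suc L) ℕ.* M
    -- (7/9)^9 ≤ 1/8, so these rounds contribute the same 8^(-L) as the tails do.
    T₂ = L ℕ.* 9
    g : ℚ
    g = 1ℚ + + 1 / 12 * α
    2≤gᴹ : fromℕℚ 2 ≤ g ^ M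
    2≤gᴹ = ≤-trans (≤-by (+ 1 / 12 * (fromℕℚ M * α - fromℕℚ 12))
        (0≤* (nonNegative⁻¹ (+ 1 / 12)) (0≤q-p (proj₁ (proj₂ bracketed))))
        (solve 2 (λ m a → con (fromℕℚ 2) :+ con (+ 1 / 12) :* (m :* a :- con (fromℕℚ 12))
          := con 1ℚ :+ m :* (con (+ 1 / 12) :* a)) refl (fromℕℚ M) α))
      (bernoulli (0≤* (nonNegative⁻¹ (+ 1 / 12)) 0≤α) M)
    1≤B : 1ℚ ≤ B
    1≤B = positive-≥1 b refl
      where
      positive-≥1 : ∀ m → m ≡ b → 1ℚ ≤ fromℕℚ m
      positive-≥1 (suc m) _  = fromℕℚ-mono {1} {suc m} (ℕ.s≤s ℕ.z≤n)
      positive-≥1 zero    eq = ⊥-elim (<-irrefl refl (<-≤-trans 0<384 (≤-trans biased (≤-reflexive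
        (trans (cong (λ m → fromℕℚ m * fromℕℚ m * α) (sym eq)) (*-zeroˡ α))))))
    1<growth : 1ℚ < σ₀ * g ^ T₁
    1<growth = <-≤-trans
      (subst (_< r * fromℕℚ (2 ℕ.^ (suc L ℕ.+ suc L))) (trans (*-comm r N) Nr)
        (*-monoʳ-<-pos r {{positive 0<r}} (fromℕℚ-< n<4ᴸ⁺¹)))
      (*-mono 0≤r (0≤^ (0≤+ 0≤1 (0≤* (nonNegative⁻¹ (+ 1 / 12)) 0≤α)) T₁)
        (subst (_≤ σ₀) (*-identityˡ r) (*-monoʳ r 0≤r 1≤B))
        (≤-trans (≤-reflexive (sym (fromℕℚ-^ 2 (suc L ℕ.+ suc L))))
          (≤-trans (^-mono (0≤fromℕℚ 2) 2≤gᴹ (suc L ℕ.+ suc L)) (≤-reflexive (sym (^-* g (suc L ℕ.+ suc L) M))))))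
      where
      fromℕℚ-< : ∀ {m p} → m ℕ.< p → fromℕℚ m < fromℕℚ p
      fromℕℚ-< {m} {p} m<p = <-≤-trans (<-by 1ℚ 0<1 (trans (+-comm (fromℕℚ m) 1ℚ) (sym (fromℕℚ-suc m)))) (fromℕℚ-mono m<p)
    n+1≤ : fromℕℚ (suc n) + 1ℚ ≤ fromℕℚ 4 * fromℕℚ 4 ^ L
    n+1≤ = ≤-trans (≤-reflexive (trans (+-comm N 1ℚ) (sym (fromℕℚ-suc (suc n)))))
      (≤-trans (fromℕℚ-mono n<4ᴸ⁺¹) (≤-reflexive (trans (sym (fromℕℚ-^ 2 (suc L ℕ.+ suc L)))
        (trans (^-+ (fromℕℚ 2) (suc L) (suc L)) (sym (*-^ (fromℕℚ 2) (fromℕℚ 2) (suc L)))))))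

  time : ℕ
  time = T₁ ℕ.+ T₂

  -- From Mα ≤ 13, α ≤ 1 and L ≥ 1: 13(2L+2) + 9L ≤ 61L.
  time≤ : fromℕℚ time * α ≤ fromℕℚ 61 * l
  time≤ = ≤-trans (≤-reflexive (cong (_* α) eq))
    (≤-by ((l + l + fromℕℚ 2) * (fromℕℚ 13 - fromℕℚ M * α) + (fromℕℚ 9 * l * (1ℚ - α) + fromℕℚ 26 * (l - 1ℚ)))
      (0≤+ (0≤* (0≤+ (0≤+ 0≤l 0≤l) (0≤fromℕℚ 2)) (0≤q-p (proj₂ (proj₂ bracketed))))
        (0≤+ (0≤* (0≤* (0≤fromℕℚ 9) 0≤l) (0≤q-p α≤1)) (0≤* (0≤fromℕℚ 26) (0≤q-p 1≤l))))
      (solve 3 (λ l m a → ((l :+ l :+ con (fromℕℚ 2)) :* m :+ l :* con (fromℕℚ 9)) :* a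
          :+ ((l :+ l :+ con (fromℕℚ 2)) :* (con (fromℕℚ 13) :- m :* a)
          :+ (con (fromℕℚ 9) :* l :* (con 1ℚ :- a) :+ con (fromℕℚ 26) :* (l :- con 1ℚ)))
        := con (fromℕℚ 61) :* l) refl l (fromℕℚ M) α))
    where
    eq : fromℕℚ time ≡ (l + l + fromℕℚ 2) * fromℕℚ M + l * fromℕℚ 9
    eq = trans (fromℕℚ-+ T₁ T₂) (cong₂ _+_
      (trans (fromℕℚ-* (suc L ℕ.+ suc L) M) (cong (_* fromℕℚ M) (trans (fromℕℚ-+ (suc L) (suc L))
        (trans (cong₂ _+_ (fromℕℚ-suc L) (fromℕℚ-suc L))
          (solve 1 (λ l → con 1ℚ :+ l :+ (con 1ℚ :+ l) := l :+ l :+ con (fromℕℚ 2)) refl l)))))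
      (fromℕℚ-* L 9))

  fail≤ : fail time x ≤ ¹⁹/₂₀ ^ (suc L ℕ.+ suc L)
  fail≤ = ≤-trans
    (fail-leading {α = α} {σ₀} {h} {D} {T₂} 0≤α 0≤σ₀ 0≤h h≤1/729 h≤σ₀ D≤n (≤-reflexive D≡Nh)
      T₁ {σ₀} x ≤-refl 1<growth leading)
    (fail-numeric {suc n} {L} {α} 0≤α n+1≤ {fromℕℚ time} (0≤fromℕℚ time) 1≤l time≤
      (cube-root {suc n} {L} {α} 0≤α n+1≤ {B} 1≤l 0<N 0≤B B≤ biased)
      (linear≤geometric 100≤L))
    where
    B≤ : B ≤ N * α
    B≤ = ≤-trans (fromℕℚ-mono b≤c) (≤-reflexive (sym (trans
      (solve 3 (λ n c r → n :* (c :* r) := c :* (n :* r)) refl N (fromℕℚ c) r)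
      (trans (cong (fromℕℚ c *_) Nr) (*-identityʳ (fromℕℚ c))))))

module Main (ℓ : ℝ) {k n : ℕ} .{{_ : NonTrivial (suc n)}} (100≤ : 2 ℕ.^ (100 ℕ.+ 100) ℕ.≤ suc n)
  (𝒄 : Configuration (suc k) (suc n)) (ordered : Ordered 𝒄)
  (c₁≥ : fromℕ (suc n) *ℝ ln^ (suc n) (-ℝ ℓ) ≤ℝ fromℕ (c₁ 𝒄))
  (bias≥ : fromℕ 22 *ℝ √ (fromℕ (suc n) *ℝ ln^ (suc n) (ℓ +ℝ 1ℝ)) ≤ℝ fromℕ (bias 𝒄))
  (x : Colouring (suc k) (suc n)) (hasConfiguration : x HasConfiguration 𝒄) where
  private
    size = log₄ (suc n) 100 100≤
    L = proj₁ size
    100≤L : 100 ℕ.≤ L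
    100≤L = proj₁ (proj₂ size)
    4ᴸ≤n : 2 ℕ.^ (L ℕ.+ L) ℕ.≤ suc n
    4ᴸ≤n = proj₁ (proj₂ (proj₂ size))
    n<4ᴸ⁺¹ : suc n ℕ.< 2 ℕ.^ (suc L ℕ.+ suc L)
    n<4ᴸ⁺¹ = proj₂ (proj₂ (proj₂ size))
    -- The index at which the grid point (4+i)/4 is L.
    i = 4 ℕ.* L ℕ.∸ 4
    4+i : 4 ℕ.+ i ≡ 4 ℕ.* L
    4+i = ℕ.m+[n∸m]≡n (ℕ.*-monoʳ-≤ 4 {1} {L} (ℕ.≤-trans (ℕ.m≤m+n 1 99) 100≤L))
    α l : ℚ
    α = fromℕℚ (c₁ 𝒄) * recip (fromℕℚ (suc n))
    l = fromℕℚ L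
    W : ℝ
    W = ln^ (suc n) (ℓ +ℝ 1ℝ)
    W≥ : Eventually (λ m → ⁴/₅ * l ≤ α * seq W m)
    W≥ = fraction*W≥ ℓ (suc n) L i (c₁ 𝒄) (bias 𝒄) 4+i 4ᴸ≤n c₁≥ bias≥
    biased : fromℕℚ 384 * (fromℕℚ (suc n) * l) ≤ fromℕℚ (bias 𝒄) * fromℕℚ (bias 𝒄) * α
    biased = bias²*fraction≥ ℓ (suc n) L i (c₁ 𝒄) (bias 𝒄) 4+i 4ᴸ≤n c₁≥ bias≥
    count≡ : ∀ j → Vec.count (Fin._≟ j) x ≡ lookup (counts 𝒄) j
    count≡ j = trans (sym (Vec.lookup∘tabulate (λ j → Vec.count (Fin._≟ j) x) j))
      (cong (λ v → lookup v j) hasConfiguration)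
    count₁ : sumV (δ zero) x ≡ fromℕℚ (c₁ 𝒄)
    count₁ = trans (sumV-count zero x) (cong fromℕℚ (trans (count≡ zero) (sym (head≡lookup (counts 𝒄)))))
    leads : ∀ i → lookup x i ≢ zero → sumV (δ (lookup x i)) x + fromℕℚ (bias 𝒄) ≤ fromℕℚ (c₁ 𝒄)
    leads i x≢0 = ≤-trans (≤-reflexive (trans (cong (_+ fromℕℚ (bias 𝒄))
          (trans (sumV-count (lookup x i) x) (cong fromℕℚ (count≡ (lookup x i)))))
        (sym (fromℕℚ-+ (lookup (counts 𝒄) (lookup x i)) (bias 𝒄)))))
      (fromℕℚ-mono (count+bias≤c₁ 𝒄 ordered (lookup x i) x≢0))
    module C = Consensus {k} {n} {L} {c₁ 𝒄} {bias 𝒄} x 100≤L 4ᴸ≤n n<4ᴸ⁺¹ (ℕ.m∸n≤m (c₁ 𝒄) (c₂ 𝒄)) count₁ leads biased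
    v = ¹⁹/₂₀ ^ (suc L ℕ.+ suc L)

  time : ℕ
  time = C.time

  -- 77 · 4/5 = 61 + 3/5 exceeds the 61 of `C.time≤`; α then cancels.
  time≤CW : fromℕ time ≤ℝ fromℕ 77 *ℝ W
  time≤CW ε 0<ε = eventually₁ {λ m → ⁴/₅ * l ≤ α * seq W m} {λ m → fromℕℚ time ≤ fromℕℚ 77 * seq W m + ε}
    (λ m h → ≤-trans (bound m h) (≤-by {fromℕℚ 77 * seq W m} ε (<⇒≤ 0<ε) refl)) W≥
    where
    bound : ∀ m → ⁴/₅ * l ≤ α * seq W m → fromℕℚ time ≤ fromℕℚ 77 * seq W m
    bound m h = *-cancelˡ-≤ α C.0<α (≤-trans (≤-reflexive (*-comm α (fromℕℚ time)))
      (≤-trans C.time≤ (≤-trans (≤-by (⅗ * l) (0≤* (nonNegative⁻¹ ⅗) (0≤fromℕℚ L))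
          (solve 1 (λ l → con (fromℕℚ 61) :* l :+ con ⅗ :* l := con (fromℕℚ 77) :* (con ⁴/₅ :* l)) refl l))
        (≤-trans (*-monoˡ (fromℕℚ 77) (0≤fromℕℚ 77) h)
          (≤-reflexive (solve 2 (λ a w → con (fromℕℚ 77) :* (a :* w) := a :* (con (fromℕℚ 77) :* w)) refl α (seq W m)))))))
      where
      ⅗ : ℚ
      ⅗ = + 3 / 5

  -- As n < 2^(2L+2) and exp(1/20) ≤ 20/19, the power n^(-1/20) is at least (19/20)^(2L+2) up to ε,
  -- and that is the bound of `C.fail≤`.
  Pr≥ : 1ℝ -ℝ (suc n) ^ℝ (-ℝ fromℚ (+ 1 / 20)) ≤ℝ fromℚ (Pr-consensus-within time x)
  Pr≥ ε 0<ε = eventually₁ {λ m → v ≤ P m + ε} {λ m → 1ℚ + - P m ≤ Pr-consensus-within time x + ε} bound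
    (n^-c≥ (suc n) (suc L ℕ.+ suc L) (ℕ.<⇒≤ n<4ᴸ⁺¹) {+ 1 / 20} {+ 20 / 19} {¹⁹/₂₀}
      (nonNegative⁻¹ (+ 1 / 20)) (decide-≤ refl) refl (nonNegative⁻¹ (+ 20 / 19)) refl
      (nonNegative⁻¹ ¹⁹/₂₀) (decide-≤ refl) ε 0<ε)
    where
    P : ℕ → ℚ
    P m = seq ((suc n) ^ℝ (-ℝ fromℚ (+ 1 / 20))) m
    f = fail time x
    bound : ∀ m → v ≤ P m + ε → 1ℚ + - P m ≤ Pr-consensus-within time x + ε
    bound m h = ≤-trans (rearrange (P m) f (≤-trans C.fail≤ h))
      (≤-reflexive (cong (_+ ε) (sym (Pr≡1-fail time x))))
      where
      rearrange : ∀ p f → f ≤ p + ε → 1ℚ + - p ≤ 1ℚ - f + ε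
      rearrange p f h = ≤-by ((p + ε) - f) (0≤q-p h)
        (solve 3 (λ p f e → con 1ℚ :+ :- p :+ ((p :+ e) :- f) := con 1ℚ :- f :+ e) refl p f ε)

corollary3p3 : (ℓ : ℝ) →
    Σ ℝ λ C → Σ ℝ λ c → Σ ℕ λ n₀ →
    0ℝ <ℝ C × 0ℝ <ℝ c ×
    ((n : ℕ) .{{_ : NonTrivial n}} → n₀ ℕ.≤ n →
    (k : ℕ) (𝒄 : Configuration (suc k) n) → Ordered 𝒄 →
    fromℕ n *ℝ ln^ n (-ℝ ℓ) ≤ℝ fromℕ (c₁ 𝒄) →
    fromℕ 22 *ℝ √ (fromℕ n *ℝ ln^ n (ℓ +ℝ 1ℝ)) ≤ℝ fromℕ (bias 𝒄) →
    (x : Colouring (suc k) n) → x HasConfiguration 𝒄 →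
    Σ ℕ λ T →
    fromℕ T ≤ℝ C *ℝ ln^ n (ℓ +ℝ 1ℝ) ×
    1ℝ -ℝ n ^ℝ (-ℝ c) ≤ℝ fromℚ (Pr-consensus-within T x))
-- None of these constants depends on ℓ; n₀ = 4^100 makes `L` at least 100.
corollary3p3 ℓ = fromℕ 77 , fromℚ (+ 1 / 20) , 2 ℕ.^ (100 ℕ.+ 100) , 0<fromℕ 77 ,
  0<-by (fromℚ (+ 1 / 20)) (+ 1 / 20) (positive⁻¹ (+ 1 / 20)) (always λ _ → ≤-refl) , main
  where
  main : (n : ℕ) .{{_ : NonTrivial n}} → 2 ℕ.^ (100 ℕ.+ 100) ℕ.≤ n →
    (k : ℕ) (𝒄 : Configuration (suc k) n) → Ordered 𝒄 →
    fromℕ n *ℝ ln^ n (-ℝ ℓ) ≤ℝ fromℕ (c₁ 𝒄) →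
    fromℕ 22 *ℝ √ (fromℕ n *ℝ ln^ n (ℓ +ℝ 1ℝ)) ≤ℝ fromℕ (bias 𝒄) →
    (x : Colouring (suc k) n) → x HasConfiguration 𝒄 →
    Σ ℕ λ T → fromℕ T ≤ℝ fromℕ 77 *ℝ ln^ n (ℓ +ℝ 1ℝ) ×
      1ℝ -ℝ n ^ℝ (-ℝ fromℚ (+ 1 / 20)) ≤ℝ fromℚ (Pr-consensus-within T x)
  main zero    h = ⊥-elim (ℕ.<-irrefl refl (ℕ.<-≤-trans (ℕ.m^n>0 2 (100 ℕ.+ 100)) h))
  main (suc n) h k 𝒄 ordered c₁≥ bias≥ x hc = M.time , M.time≤CW , M.Pr≥
    where module M = Main ℓ h 𝒄 ordered c₁≥ bias≥ x hc
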